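{- Let $F$ be an ordered graph. The induced $F$-removal lemma has polynomial bounds if and only if $|V(F)|=2$, or $F \in \{D, D^{\leftarrow}, \overline{D}, \overline{D^{\leftarrow}}\}$.
   Context: An ordered graph is a graph with a linear order on its vertex set. An ordered graph $H$ is an induced subgraph of an ordered graph $G$ (an induced copy of $H$ in $G$) if there is an order-preserving injection $V(H)\to V(G)$ mapping edges to edges and non-edges to non-edges. An $n$-vertex ordered graph $G$ is $\varepsilon$-far from being induced $F$-free if one must add/delete at least $\varepsilon n^2$ edges of $G$ to obtain an ordered graph containing no induced copy of $F$. The induced $F$-removal lemma has polynomial bounds if there are constants $c, C>0$ (depending only on $F$) such that for every $\varepsilon\in(0,1)$ and every $n$, every $n$-vertex ordered graph which is $\varepsilon$-far from being induced $F$-free contains at least $c\,\varepsilon^{C} n^{v(F)}$ induced copies of $F$ (equivalently, the function $\delta_F(\varepsilon)$ in the induced removal lemma can be taken polynomial in $\varepsilon$). $D$ denotes the ordered graph with vertices $x<y<z$ and edges $\{x,y\},\{x,z\}$. For an ordered graph $G$, $\overline{G}$ is its complement (same vertex order) and $G^{\leftarrow}$ is obtained from $G$ by reversing the vertex order.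
   Formalization: F is assumed to have at least two vertices, since for a graph F with at most one vertex the removal lemma trivially has polynomial bounds although F is not listed; ε and c are rational and C is a natural number, which is equivalent to the real form. -}

module Defs where

open import Data.Nat as ℕ using (ℕ; zero; suc)
open import Data.Integer using (+_)
open import Data.Rational using (ℚ; _/_; _*_; 1ℚ)
open import Data.Bool using (Bool; true; false; not; if_then_else_)
import Data.Bool.Properties as BoolP
open import Data.Fin using (Fin; zero; suc; _<_; _<?_; _≟_; opposite)
open import Data.Fin.Properties using (all?)
open import Data.Vec using (Vec; []; _∷_; lookup)
open import Data.List using (List; []; _∷_; [_]; length; filter; allFin; cartesianProduct; cartesianProductWith)
open import Data.Product using (_×_; _,_; Σ; proj₁; proj₂)
open import Data.Sum using (_⊎_)
open import Data.Empty using (⊥)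
open import Relation.Nullary using (¬_; Dec; does)
open import Relation.Nullary.Decidable using (_×-dec_; _→-dec_; ¬?)
open import Relation.Binary.PropositionalEquality using (_≡_; _≢_; refl)

-- Ordered graphs: vertex set Fin n with its natural linear order,
-- simple (symmetric, loopless) adjacency.

record OGraph (n : ℕ) : Set where
  field
    adj    : Fin n → Fin n → Bool
    sym    : ∀ i j → adj i j ≡ adj j i
    irrefl : ∀ i → adj i i ≡ false
open OGraph public

v : ∀ {k} → OGraph k → ℕ
v {k} _ = k

IsInducedCopy : ∀ {k n} → OGraph k → OGraph n → (Fin k → Fin n) → Set
IsInducedCopy F G f =
  (∀ i j → i < j → f i < f j) × (∀ i j → adj G (f i) (f j) ≡ adj F i j)

isInducedCopy? : ∀ {k n} (F : OGraph k) (G : OGraph n) (f : Fin k → Fin n) →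
                 Dec (IsInducedCopy F G f)
isInducedCopy? F G f =
  all? (λ i → all? (λ j → (i <? j) →-dec (f i <? f j)))
  ×-dec all? (λ i → all? (λ j → adj G (f i) (f j) BoolP.≟ adj F i j))

InducedFree : ∀ {k n} → OGraph k → OGraph n → Set
InducedFree F G = ¬ (Σ (Fin _ → Fin _) (IsInducedCopy F G))

allVecs : (n k : ℕ) → List (Vec (Fin n) k)
allVecs n zero    = [ [] ]
allVecs n (suc k) = cartesianProductWith _∷_ (allFin n) (allVecs n k)

-- Number of induced copies of F in G (= number of order-preserving
-- embeddings, each induced copy corresponds to exactly one).
copies : ∀ {k n} → OGraph k → OGraph n → ℕ
copies {k} {n} F G =
  length (filter (λ w → isInducedCopy? F G (lookup w)) (allVecs n k))

dist : ∀ {n} → OGraph n → OGraph n → ℕ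
dist {n} G H =
  length (filter (λ p → (proj₁ p <? proj₂ p)
                         ×-dec ¬? (adj G (proj₁ p) (proj₂ p) BoolP.≟ adj H (proj₁ p) (proj₂ p)))
                 (cartesianProduct (allFin n) (allFin n)))

ℕ→ℚ : ℕ → ℚ
ℕ→ℚ m = + m / 1

infixr 8 _^ℚ_
_^ℚ_ : ℚ → ℕ → ℚ
p ^ℚ zero  = 1ℚ
p ^ℚ suc m = p * (p ^ℚ m)

Far : ∀ {k n} → OGraph k → ℚ → OGraph n → Set
Far {k} {n} F ε G =
  ∀ (H : OGraph n) → InducedFree F H →
    Data.Rational._≤_ (ε * ℕ→ℚ (n ℕ.* n)) (ℕ→ℚ (dist G H))

PolyRemoval : ∀ {k} → OGraph k → Set
PolyRemoval {k} F =
  Σ ℚ λ c → Σ ℕ λ C →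
    Data.Rational._<_ (Data.Rational.0ℚ) c ×
    (∀ (ε : ℚ) → Data.Rational._<_ Data.Rational.0ℚ ε → Data.Rational._<_ ε 1ℚ →
     ∀ (n : ℕ) (G : OGraph n) → Far F ε G →
       Data.Rational._≤_ (c * (ε ^ℚ C) * ℕ→ℚ (n ℕ.^ k)) (ℕ→ℚ (copies F G)))

private
  dadj : Fin 3 → Fin 3 → Bool
  dadj zero (suc zero)       = true
  dadj zero (suc (suc zero)) = true
  dadj (suc zero) zero       = true
  dadj (suc (suc zero)) zero = true
  dadj _ _                   = false

  dsym : ∀ i j → dadj i j ≡ dadj j i
  dsym zero zero = refl
  dsym zero (suc zero) = refl
  dsym zero (suc (suc zero)) = refl
  dsym (suc zero) zero = refl
  dsym (suc zero) (suc zero) = refl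
  dsym (suc zero) (suc (suc zero)) = refl
  dsym (suc (suc zero)) zero = refl
  dsym (suc (suc zero)) (suc zero) = refl
  dsym (suc (suc zero)) (suc (suc zero)) = refl

  dirr : ∀ i → dadj i i ≡ false
  dirr zero = refl
  dirr (suc zero) = refl
  dirr (suc (suc zero)) = refl

D : OGraph 3
D = record { adj = dadj ; sym = dsym ; irrefl = dirr }

compl : ∀ {n} → OGraph n → OGraph n
compl G = record
  { adj    = λ i j → if does (i ≟ j) then false else not (adj G i j)
  ; sym    = csym
  ; irrefl = cirr }
  where
  open import Relation.Nullary using (yes; no)
  open import Relation.Binary.PropositionalEquality using (cong) renaming (sym to ≡sym)
  csym : ∀ i j → (if does (i ≟ j) then false else not (adj G i j))
                ≡ (if does (j ≟ i) then false else not (adj G j i))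
  csym i j with i ≟ j | j ≟ i
  ... | yes _ | yes _ = refl
  ... | yes p | no q  = Data.Empty.⊥-elim (q (≡sym p))
  ... | no p  | yes q = Data.Empty.⊥-elim (p (≡sym q))
  ... | no _  | no _  = cong not (OGraph.sym G i j)
  cirr : ∀ i → (if does (i ≟ i) then false else not (adj G i i)) ≡ false
  cirr i with i ≟ i
  ... | yes _ = refl
  ... | no p  = Data.Empty.⊥-elim (p refl)

rev : ∀ {n} → OGraph n → OGraph n
rev G = record
  { adj    = λ i j → adj G (opposite i) (opposite j)
  ; sym    = λ i j → OGraph.sym G (opposite i) (opposite j)
  ; irrefl = λ i → OGraph.irrefl G (opposite i) }

-- Equality of ordered graphs on the same vertex set Fin n
-- (ordered isomorphism between ordered graphs on Fin n is the identity).
_≅_ : ∀ {n} → OGraph n → OGraph n → Set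
G ≅ H = ∀ i j → adj G i j ≡ adj H i j

InDFamily : ∀ {k} → OGraph k → Set
InDFamily {suc (suc (suc zero))} F =
  F ≅ D ⊎ F ≅ rev D ⊎ F ≅ compl D ⊎ F ≅ compl (rev D)
InDFamily {_} F = ⊥

{-# OPTIONS --safe #-}

-- If F is on at least three vertices and not in the family of D, then F is hard. Split the vertices
-- into k parts, part i being a copy of the box [k d]^m, and plant in it the copies of F with vertices
-- x + i a, where a runs over the points of [d]^m on a sphere. Two vertices determine a planted copy, so
-- the planted copies are pair-disjoint and the graph is far from F-free. If the pairs of parts that see
-- the pattern x, x + (j - i) a are chosen well (a "certificate"), then every copy of F contains three
-- vertices that see it pairwise, and strict convexity of the sphere leaves few such triangles.
-- Monochromatic triples of F give a certificate, so by Ramsey only k at most 5 needs a search.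
--
-- For D, note that G is D-free iff every forward neighbourhood is a clique. Take a D-free set R, with
-- the forest in which the parent of r is its first forward neighbour in R. A vertex y is inner if,
-- added to R, it has exactly one child of large height and few forward neighbours that this child does
-- not see. Let inner x see those inner y which the heavy child of x sees, and let any other x keep
-- only its neighbours among the inner y that lie late in its forward neighbourhood. The resulting graph
-- is always D-free. On a D-free set, leaving two vertices x, y out, it predicts their adjacency from
-- the rest up to few errors; so a random R produces a D-free graph close to G unless G has many copies
-- of D.

module Submission where

open import Defs
open import Data.Nat using (ℕ; _≤_)
open import Data.Sum using (_⊎_)
open import Relation.Binary.PropositionalEquality using (_≡_)
open import Function.Bundles using (_⇔_)

open import Level using (Level)
open import Algebra.Properties.CommutativeSemigroup using () renaming (interchange to +-interchange)
open import Data.Bool using (Bool; true; false; not; if_then_else_)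
import Data.Bool.Properties as BoolP
open import Data.Empty using (⊥; ⊥-elim)
open import Data.Fin as Fin using (Fin; zero; suc; toℕ; opposite)
import Data.Fin.Properties as FinP
open import Data.Fin.Patterns using (0F; 1F; 2F; 3F; 4F)
open import Data.Integer as ℤ using (+[1+_])
import Data.Integer.Properties as ℤP
open import Data.List as List using (List; length; filter; allFin; cartesianProduct; cartesianProductWith)
import Data.List.Properties as ListP
open import Data.List.Membership.Propositional using (_∈_)
import Data.List.Membership.Propositional.Properties as Mem
import Data.List.Relation.Unary.All as All
import Data.List.Relation.Unary.AllPairs as AP
import Data.List.Relation.Unary.Any as Any
import Data.List.Relation.Unary.Any.Properties as AnyP
open import Data.List.Relation.Unary.Unique.Propositional using (Unique)
import Data.List.Relation.Unary.Unique.Propositional.Properties as UniqueP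
open import Data.Nat using (zero; suc; _+_; _*_; _∸_; _^_; z≤n; s≤s; NonZero; >-nonZero; ∣_-_∣) renaming (_<_ to _<ⁿ_)
open import Data.Nat.DivMod using (_/_; m/n*n≤m; m%n<n; m≡m%n+[m/n]*n; m≥n⇒m/n>0)
import Data.Nat.ListAction as ListA
import Data.Nat.ListAction.Properties as ListAP
open import Data.Nat.Properties
open import Data.Nat.Tactic.RingSolver using (solve-∀)
open import Data.Product using (∃; _×_; _,_; proj₁; proj₂)
open import Data.Rational as ℚ using (ℚ; mkℚ; 0ℚ; 1ℚ)
import Data.Rational.Properties as ℚP
open import Data.Rational.Solver using (module +-*-Solver)
open import Data.Rational.Unnormalised as ℚᵘ using (mkℚᵘ; *≤*; *<*; *≡*)
import Data.Rational.Unnormalised.Properties as ℚᵘP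
open import Data.Sum using (inj₁; inj₂)
open import Data.Unit using (⊤; tt)
open import Data.Vec as Vec using (Vec; []; _∷_; lookup; _[_]≔_)
import Data.Vec.Properties as VecP
open import Function using (_∘_; id; case_of_; mk⇔)
open import Relation.Binary using (Tri; tri<; tri≈; tri>)
open import Relation.Binary.PropositionalEquality using (_≢_; refl; trans; cong; cong₂; subst; subst₂; module ≡-Reasoning) renaming (sym to ≡-sym)
open import Relation.Nullary using (¬_; Dec; yes; no; does; contradiction)
open import Relation.Nullary.Decidable using (_×-dec_; _→-dec_; _⊎-dec_; ¬?; map′; True; toWitness)
open import Relation.Unary using (Pred; Decidable)

-- Both halves are a competition of exponents. On the hard side the sphere costs a factor of order
-- d² in the density of the planted copies, while a special triangle is fixed by one of its edges up
-- to `k` choices, which saves a factor `d ^ dim`; as `dim` is free, no fixed power of ε survives.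
-- Inside a part and across unpatterned parts the graph is constant, so a certificate is a finite
-- statement about the maps from vertices of a copy to parts.
--
-- For `D`, the rounding has to be `D`-free whatever R is and yet follow G when R is good. Hence no
-- edge is copied from G on its own: each edge x y has a witness in R from which climbing in the
-- forest ends in a heavy child of y. A `D`-free sample of N = s² vertices then allows at most 4 s +
-- 1 errors per vertex, so O(N^(3/2)) wrong pairs, whereas a far G forces about N² / E of them on
-- average. With s a large multiple of E the two are incompatible. Each kind of error is charged to
-- a set of size about N / s = s, which is why the thresholds for height and for excess are both s.

private variable
  ℓ ℓ′ ℓ″ : Level
  n m N k : ℕ

-- Finite sums, indicators and averages over tuples

opaque

  ∑ : (Fin n → ℕ) → ℕ
  ∑ {zero}  f = 0
  ∑ {suc n} f = f zero + ∑ (f ∘ suc)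

  ∑-cong : {f g : Fin n → ℕ} → (∀ i → f i ≡ g i) → ∑ f ≡ ∑ g
  ∑-cong {zero}  h = refl
  ∑-cong {suc n} h = cong₂ _+_ (h zero) (∑-cong (h ∘ suc))

  ∑-mono : {f g : Fin n → ℕ} → (∀ i → f i ≤ g i) → ∑ f ≤ ∑ g
  ∑-mono {zero}  h = z≤n
  ∑-mono {suc n} h = +-mono-≤ (h zero) (∑-mono (h ∘ suc))

  ∑-const : ∀ n c → ∑ {n} (λ _ → c) ≡ n * c
  ∑-const zero    c = refl
  ∑-const (suc n) c = cong (c +_) (∑-const n c)

  ∑-bound : ∀ {f : Fin n → ℕ} {c} → (∀ i → f i ≤ c) → ∑ f ≤ n * c
  ∑-bound {n} {c = c} h = ≤-trans (∑-mono h) (≤-reflexive (∑-const n c))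

  ∑-zero : ∀ {f : Fin n → ℕ} → (∀ i → f i ≡ 0) → ∑ f ≡ 0
  ∑-zero {n} h = trans (∑-cong h) (trans (∑-const n 0) (*-zeroʳ n))

  ∑-*ˡ : ∀ c (f : Fin n → ℕ) → ∑ (λ i → c * f i) ≡ c * ∑ f
  ∑-*ˡ {zero}  c f = ≡-sym (*-zeroʳ c)
  ∑-*ˡ {suc n} c f = trans (cong (c * f zero +_) (∑-*ˡ c (f ∘ suc))) (≡-sym (*-distribˡ-+ c (f zero) _))

  ∑-+ : (f g : Fin n → ℕ) → ∑ (λ i → f i + g i) ≡ ∑ f + ∑ g
  ∑-+ {zero}  f g = refl
  ∑-+ {suc n} f g = trans (cong (f zero + g zero +_) (∑-+ (f ∘ suc) (g ∘ suc)))
                          (+-interchange +-commutativeSemigroup (f zero) (g zero) _ _)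

  ∑-comm : (f : Fin m → Fin n → ℕ) → ∑ (λ i → ∑ (f i)) ≡ ∑ (λ j → ∑ λ i → f i j)
  ∑-comm {zero} {n} f = ≡-sym (∑-zero {n} λ _ → refl)
  ∑-comm {suc m} f = trans (cong (∑ (f zero) +_) (∑-comm (f ∘ suc))) (≡-sym (∑-+ (f zero) _))

  term≤∑ : (f : Fin n → ℕ) (i : Fin n) → f i ≤ ∑ f
  term≤∑ f zero    = m≤m+n _ _
  term≤∑ f (suc i) = ≤-trans (term≤∑ (f ∘ suc) i) (m≤n+m _ _)

  two-terms≤∑ : (f : Fin n → ℕ) {i j : Fin n} → i ≢ j → f i + f j ≤ ∑ f
  two-terms≤∑ f {zero}  {zero}  i≢j = contradiction refl i≢j
  two-terms≤∑ f {zero}  {suc j} i≢j = +-monoʳ-≤ (f zero) (term≤∑ (f ∘ suc) j)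
  two-terms≤∑ f {suc i} {zero}  i≢j =
    ≤-trans (≤-reflexive (+-comm (f (suc i)) (f zero))) (+-monoʳ-≤ (f zero) (term≤∑ (f ∘ suc) i))
  two-terms≤∑ f {suc i} {suc j} i≢j =
    ≤-trans (two-terms≤∑ (f ∘ suc) (i≢j ∘ cong suc)) (m≤n+m _ _)

  average≤some : (f : Fin (suc n) → ℕ) → ∃ λ i → ∑ f ≤ suc n * f i
  average≤some {zero}  f = zero , ≤-refl
  average≤some {suc n} f with average≤some (f ∘ suc)
  ... | i , h with ≤-total (f zero) (f (suc i))
  ... | inj₁ f₀≤ = suc i , +-mono-≤ f₀≤ h
  ... | inj₂ ≤f₀ = zero , +-monoʳ-≤ (f zero) (≤-trans h (*-monoʳ-≤ (suc n) ≤f₀))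

ind : {P : Set ℓ} → Dec P → ℕ
ind (yes _) = 1
ind (no _)  = 0

ind≤1 : {P : Set ℓ} (p? : Dec P) → ind p? ≤ 1
ind≤1 (yes _) = ≤-refl
ind≤1 (no _)  = z≤n

ind-yes : {P : Set ℓ} (p? : Dec P) → P → ind p? ≡ 1
ind-yes (yes _) p = refl
ind-yes (no ¬p) p = contradiction p ¬p

ind-no : {P : Set ℓ} (p? : Dec P) → ¬ P → ind p? ≡ 0
ind-no (yes p) ¬p = contradiction p ¬p
ind-no (no _)  ¬p = refl

ind-≤ : {P : Set ℓ} (p? : Dec P) {c : ℕ} → (P → 1 ≤ c) → ind p? ≤ c
ind-≤ (yes p) h = h p
ind-≤ (no _)  h = z≤n

1≤ind : {P : Set ℓ} (p? : Dec P) → P → 1 ≤ ind p?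
1≤ind p? p = ≤-reflexive (≡-sym (ind-yes p? p))

ind-mono : {P : Set ℓ} {Q : Set ℓ′} (p? : Dec P) (q? : Dec Q) → (P → Q) → ind p? ≤ ind q?
ind-mono p? q? h = ind-≤ p? (λ p → ≤-reflexive (≡-sym (ind-yes q? (h p))))

ind-≤∑ : {P : Set ℓ} {R : Fin n → Set ℓ′} (p? : Dec P) (q? : ∀ i → Dec (R i)) →
         (P → ∃ R) → ind p? ≤ ∑ (ind ∘ q?)
ind-≤∑ p? q? h = ind-≤ p? λ p →
  ≤-trans (≤-reflexive (≡-sym (ind-yes (q? _) (proj₂ (h p))))) (term≤∑ (ind ∘ q?) (proj₁ (h p)))

opaque
  unfolding ∑

  ∑-ind-unique : {P : Fin n → Set ℓ} (P? : ∀ i → Dec (P i)) →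
                 (∀ i j → P i → P j → i ≡ j) → ∑ (ind ∘ P?) ≤ 1
  ∑-ind-unique {zero}  P? u = z≤n
  ∑-ind-unique {suc n} P? u with P? zero
  ... | yes p = ≤-reflexive (cong suc (∑-zero λ i → ind-no (P? (suc i)) λ q → FinP.0≢1+n (u _ _ p q)))
  ... | no  _ = ∑-ind-unique (P? ∘ suc) (λ i j p q → FinP.suc-injective (u _ _ p q))

  ∑-ind-exists : {P : Fin n → Set ℓ} (P? : ∀ i → Dec (P i)) → 1 ≤ ∑ (ind ∘ P?) → ∃ P
  ∑-ind-exists {suc n} P? h with P? zero
  ... | yes p = zero , p
  ... | no  _ = let i , p = ∑-ind-exists (P? ∘ suc) h in suc i , p

∑-ind≤n : {P : Fin n → Set ℓ} (P? : ∀ i → Dec (P i)) → ∑ (ind ∘ P?) ≤ n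
∑-ind≤n {n} P? = ≤-trans (∑-bound (ind≤1 ∘ P?)) (≤-reflexive (*-identityʳ n))

opaque

  ∑ᵀ : ∀ N → (Vec (Fin n) N → ℕ) → ℕ
  ∑ᵀ zero    g = g []
  ∑ᵀ (suc N) g = ∑ λ x → ∑ᵀ N (g ∘ (x ∷_))

  ∑ᵀ-mono : ∀ N {f g : Vec (Fin n) N → ℕ} → (∀ q → f q ≤ g q) → ∑ᵀ N f ≤ ∑ᵀ N g
  ∑ᵀ-mono zero    h = h []
  ∑ᵀ-mono (suc N) h = ∑-mono λ x → ∑ᵀ-mono N (h ∘ (x ∷_))

  ∑ᵀ-cong : ∀ N {f g : Vec (Fin n) N → ℕ} → (∀ q → f q ≡ g q) → ∑ᵀ N f ≡ ∑ᵀ N g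
  ∑ᵀ-cong zero    h = h []
  ∑ᵀ-cong (suc N) h = ∑-cong λ x → ∑ᵀ-cong N (h ∘ (x ∷_))

  ∑ᵀ-const : ∀ N c → ∑ᵀ {n} N (λ _ → c) ≡ n ^ N * c
  ∑ᵀ-const zero    c = ≡-sym (+-identityʳ c)
  ∑ᵀ-const {n} (suc N) c = begin
    ∑ {n} (λ _ → ∑ᵀ {n} N (λ _ → c)) ≡⟨ ∑-const n _ ⟩
    n * ∑ᵀ {n} N (λ _ → c)           ≡⟨ cong (n *_) (∑ᵀ-const N c) ⟩
    n * (n ^ N * c)                  ≡⟨ ≡-sym (*-assoc n (n ^ N) c) ⟩
    n ^ suc N * c                    ∎
    where open ≡-Reasoning

  ∑ᵀ-*ˡ : ∀ N c (f : Vec (Fin n) N → ℕ) → ∑ᵀ N (λ q → c * f q) ≡ c * ∑ᵀ N f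
  ∑ᵀ-*ˡ zero    c f = refl
  ∑ᵀ-*ˡ (suc N) c f = trans (∑-cong λ x → ∑ᵀ-*ˡ N c (f ∘ (x ∷_))) (∑-*ˡ c _)

  ∑ᵀ-+ : ∀ N (f g : Vec (Fin n) N → ℕ) → ∑ᵀ N (λ q → f q + g q) ≡ ∑ᵀ N f + ∑ᵀ N g
  ∑ᵀ-+ zero    f g = refl
  ∑ᵀ-+ (suc N) f g = trans (∑-cong λ x → ∑ᵀ-+ N (f ∘ (x ∷_)) (g ∘ (x ∷_))) (∑-+ _ _)

  ∑ᵀ-∑-comm : ∀ N (f : Vec (Fin n) N → Fin m → ℕ) →
              ∑ᵀ N (λ q → ∑ (f q)) ≡ ∑ λ i → ∑ᵀ N (λ q → f q i)
  ∑ᵀ-∑-comm zero    f = refl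
  ∑ᵀ-∑-comm (suc N) f = trans (∑-cong λ x → ∑ᵀ-∑-comm N (f ∘ (x ∷_))) (∑-comm _)

  -- Redrawing one entry of a uniformly random tuple leaves it uniform; the factor `n` counts the
  -- values that are overwritten.
  ∑ᵀ-resample : ∀ N (a : Fin N) (g : Vec (Fin n) N → ℕ) →
                ∑ᵀ N (λ q → ∑ λ x → g (q [ a ]≔ x)) ≡ n * ∑ᵀ N g
  ∑ᵀ-resample {n} (suc N) zero g = begin
    ∑ (λ _ → ∑ᵀ N (λ q → ∑ λ x → g (x ∷ q)))  ≡⟨ ∑-const n _ ⟩
    n * ∑ᵀ N (λ q → ∑ λ x → g (x ∷ q))        ≡⟨ cong (n *_) (∑ᵀ-∑-comm N λ q x → g (x ∷ q)) ⟩
    n * ∑ (λ x → ∑ᵀ N (g ∘ (x ∷_)))           ∎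
    where open ≡-Reasoning
  ∑ᵀ-resample {n} (suc N) (suc a) g =
    trans (∑-cong λ y → ∑ᵀ-resample N a (g ∘ (y ∷_))) (∑-*ˡ n _)

private
  lookup-updates : ∀ {q : Vec (Fin n) N} {a b c : Fin N} {x y z} (P : Fin n → Fin n → Fin n → ℕ) →
    a ≢ b → a ≢ c → b ≢ c →
    let q′ = ((q [ a ]≔ x) [ b ]≔ y) [ c ]≔ z in
    P (lookup q′ a) (lookup q′ b) (lookup q′ c) ≡ P x y z
  lookup-updates {q = q} {a} {b} {c} {x} {y} {z} P a≢b a≢c b≢c
    rewrite VecP.lookup∘update c ((q [ a ]≔ x) [ b ]≔ y) z
          | VecP.lookup∘update′ b≢c ((q [ a ]≔ x) [ b ]≔ y) z
          | VecP.lookup∘update b (q [ a ]≔ x) y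
          | VecP.lookup∘update′ a≢c ((q [ a ]≔ x) [ b ]≔ y) z
          | VecP.lookup∘update′ a≢b (q [ a ]≔ x) y
          | VecP.lookup∘update a q x = refl

-- Three distinct entries of a random tuple form a uniformly random triple: redraw them one after
-- the other. Both sides are cleared of denominators.
∑ᵀ-three : ∀ N {a b c : Fin N} → a ≢ b → a ≢ c → b ≢ c → (P : Fin n → Fin n → Fin n → ℕ) →
  n ^ 3 * ∑ᵀ N (λ q → P (lookup q a) (lookup q b) (lookup q c)) ≡
  n ^ N * ∑ λ x → ∑ λ y → ∑ λ z → P x y z
∑ᵀ-three {n} N {a} {b} {c} a≢b a≢c b≢c P = begin
  n ^ 3 * ∑ᵀ N g                        ≡⟨ cong (_* ∑ᵀ N g) (cong (λ t → n * (n * t)) (*-identityʳ n)) ⟩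
  n * (n * n) * ∑ᵀ N g                  ≡⟨ trans (*-assoc n _ _) (cong (n *_) (*-assoc n n _)) ⟩
  n * (n * (n * ∑ᵀ N g))                ≡⟨ cong (λ t → n * (n * t)) (≡-sym (∑ᵀ-resample N c g)) ⟩
  n * (n * ∑ᵀ N (λ q → ∑ λ z → g (q [ c ]≔ z)))
    ≡⟨ cong (n *_) (≡-sym (∑ᵀ-resample N b _)) ⟩
  n * ∑ᵀ N (λ q → ∑ λ y → ∑ λ z → g ((q [ b ]≔ y) [ c ]≔ z))
    ≡⟨ ≡-sym (∑ᵀ-resample N a _) ⟩
  ∑ᵀ N (λ q → ∑ λ x → ∑ λ y → ∑ λ z → g (((q [ a ]≔ x) [ b ]≔ y) [ c ]≔ z))
    ≡⟨ ∑ᵀ-cong N (λ q → ∑-cong λ x → ∑-cong λ y → ∑-cong λ z →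
         lookup-updates {q = q} P a≢b a≢c b≢c) ⟩
  ∑ᵀ {n} N (λ q → ∑ λ x → ∑ λ y → ∑ λ z → P x y z) ≡⟨ ∑ᵀ-const N _ ⟩
  n ^ N * ∑ (λ x → ∑ λ y → ∑ λ z → P x y z) ∎
  where
  open ≡-Reasoning
  g : Vec (Fin n) N → ℕ
  g q = P (lookup q a) (lookup q b) (lookup q c)

-- Lengths of lists, copies and distance as sums

module _ {A : Set ℓ} {B : Set ℓ′} where

  length-injection : {xs : List A} {ys : List B} (f : A → B) → Unique xs →
    (∀ {x} → x ∈ xs → f x ∈ ys) →
    (∀ {x y} → x ∈ xs → y ∈ xs → f x ≡ f y → x ≡ y) → length xs ≤ length ys
  length-injection {xs} {ys} f uniq f∈ inj = FinP.injective⇒≤ {f = index} index-injective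
    where
    mem : ∀ i → List.lookup xs i ∈ xs
    mem i = Mem.∈-lookup i
    index : Fin (length xs) → Fin (length ys)
    index i = Any.index (f∈ (mem i))
    lookup-injective : ∀ {zs : List A} → Unique zs → ∀ i j → List.lookup zs i ≡ List.lookup zs j → i ≡ j
    lookup-injective (px AP.∷ u) zero zero e = refl
    lookup-injective (px AP.∷ u) zero (suc j) e = contradiction e (All.lookup px (Mem.∈-lookup j))
    lookup-injective (px AP.∷ u) (suc i) zero e = contradiction (≡-sym e) (All.lookup px (Mem.∈-lookup i))
    lookup-injective (px AP.∷ u) (suc i) (suc j) e = cong suc (lookup-injective u i j e)
    index-injective : ∀ {i j} → index i ≡ index j → i ≡ j
    index-injective {i} {j} e = lookup-injective uniq i j (inj (mem i) (mem j)
      (trans (AnyP.lookup-index (f∈ (mem i)))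
        (trans (cong (List.lookup ys) e) (≡-sym (AnyP.lookup-index (f∈ (mem j)))))))

module _ {A : Set ℓ} where

  length-filter : {P : Pred A ℓ′} (P? : Decidable P) (xs : List A) →
                  length (filter P? xs) ≡ ListA.sum (List.map (ind ∘ P?) xs)
  length-filter P? List.[] = refl
  length-filter P? (x List.∷ xs) with P? x
  ... | yes _ = cong suc (length-filter P? xs)
  ... | no  _ = length-filter P? xs

sum-cartesianProductWith : ∀ {A : Set ℓ} {B : Set ℓ′} {C : Set ℓ″} (f : A → B → C) (g : C → ℕ) xs ys →
  ListA.sum (List.map g (cartesianProductWith f xs ys)) ≡
  ListA.sum (List.map (λ x → ListA.sum (List.map (g ∘ f x) ys)) xs)
sum-cartesianProductWith f g List.[] ys = refl
sum-cartesianProductWith f g (x List.∷ xs) ys = begin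
  ListA.sum (List.map g (List.map (f x) ys List.++ cartesianProductWith f xs ys))
    ≡⟨ cong ListA.sum (ListP.map-++ g (List.map (f x) ys) _) ⟩
  ListA.sum (List.map g (List.map (f x) ys) List.++ List.map g (cartesianProductWith f xs ys))
    ≡⟨ ListAP.sum-++ (List.map g (List.map (f x) ys)) _ ⟩
  ListA.sum (List.map g (List.map (f x) ys)) + ListA.sum (List.map g (cartesianProductWith f xs ys))
    ≡⟨ cong₂ _+_ (cong ListA.sum (≡-sym (ListP.map-∘ ys))) (sum-cartesianProductWith f g xs ys) ⟩
  _ ∎
  where open ≡-Reasoning

opaque
  unfolding ∑

  sum-allFin : ∀ n (g : Fin n → ℕ) → ListA.sum (List.map g (allFin n)) ≡ ∑ g
  sum-allFin n g = trans (cong ListA.sum (ListP.map-tabulate id g)) (sum-tabulate n g)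
    where
    sum-tabulate : ∀ n (g : Fin n → ℕ) → ListA.sum (List.tabulate g) ≡ ∑ g
    sum-tabulate zero    g = refl
    sum-tabulate (suc n) g = cong (g zero +_) (sum-tabulate n (g ∘ suc))

opaque
  unfolding ∑ᵀ

  sum-allVecs : ∀ n N (g : Vec (Fin n) N → ℕ) → ListA.sum (List.map g (allVecs n N)) ≡ ∑ᵀ N g
  sum-allVecs n zero    g = +-identityʳ _
  sum-allVecs n (suc N) g = begin
    _ ≡⟨ sum-cartesianProductWith _∷_ g (allFin n) (allVecs n N) ⟩
    _ ≡⟨ sum-allFin n _ ⟩
    _ ≡⟨ ∑-cong (λ x → sum-allVecs n N (g ∘ (x ∷_))) ⟩
    _ ∎
    where open ≡-Reasoning

copies-∑ᵀ : (F : OGraph k) (G : OGraph n) →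
            copies F G ≡ ∑ᵀ k (λ w → ind (isInducedCopy? F G (lookup w)))
copies-∑ᵀ {k} {n} F G = trans (length-filter _ (allVecs n k)) (sum-allVecs n k _)

Differ : OGraph n → OGraph n → Fin n → Fin n → Set
Differ G H x y = x Fin.< y × adj G x y ≢ adj H x y

differ? : (G H : OGraph n) (x y : Fin n) → Dec (Differ G H x y)
differ? G H x y = (x Fin.<? y) ×-dec ¬? (adj G x y BoolP.≟ adj H x y)
  where

  import Data.Bool.Properties as BoolP

dist-∑ : (G H : OGraph n) → dist G H ≡ ∑ λ x → ∑ λ y → ind (differ? G H x y)
dist-∑ {n} G H = begin
  _ ≡⟨ length-filter _ (cartesianProduct (allFin n) (allFin n)) ⟩
  _ ≡⟨ sum-cartesianProductWith _,_ _ (allFin n) (allFin n) ⟩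
  _ ≡⟨ sum-allFin n _ ⟩
  _ ≡⟨ ∑-cong (λ x → sum-allFin n _) ⟩
  _ ∎
  where open ≡-Reasoning

∈-allVecs : (w : Vec (Fin n) N) → w ∈ allVecs n N
∈-allVecs []      = Any.here refl
∈-allVecs (x ∷ w) = Mem.∈-cartesianProductWith⁺ _∷_ (Mem.∈-allFin x) (∈-allVecs w)

allVecs-unique : ∀ n N → Unique (allVecs n N)
allVecs-unique n zero    = All.[] AP.∷ AP.[]
allVecs-unique n (suc N) =
  UniqueP.cartesianProductWith⁺ _∷_ VecP.∷-injective (UniqueP.allFin⁺ n) (allVecs-unique n N)

-- The removal lemma for ε = 1 / E, free of division.
PolyRemovalℕ : OGraph k → Set
PolyRemovalℕ {k} F = ∃ λ q → ∃ λ C → ∀ E n (G : OGraph n) → 2 ≤ E →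
  (∀ H → InducedFree F H → n * n ≤ E * dist G H) → n ^ k ≤ q * E ^ C * copies F G

-- Double counting over codes in `Fin m`: each element has a code and no code serves two elements.
-- Codes form a relation, so an element may have several.
∑-ind-fibres : {P : Fin n → Set ℓ} {R : Fin n → Fin m → Set ℓ′}
  (P? : ∀ i → Dec (P i)) (R? : ∀ i c → Dec (R i c)) →
  (∀ i → P i → ∃ (R i)) → (∀ {i j} c → P i → P j → R i c → R j c → i ≡ j) → ∑ (ind ∘ P?) ≤ m
∑-ind-fibres {n} {m = m} {P = P} {R} P? R? code unique = begin
  ∑ (ind ∘ P?)                                   ≤⟨ ∑-mono (λ i → ind-≤∑ (P? i) (PR? i) λ p →
                                                      proj₁ (code i p) , p , proj₂ (code i p)) ⟩
  ∑ (λ i → ∑ λ c → ind (PR? i c))                ≡⟨ ∑-comm (λ i c → ind (PR? i c)) ⟩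
  ∑ (λ c → ∑ λ i → ind (PR? i c))                ≤⟨ ∑-mono (λ c → ∑-ind-unique (λ i → PR? i c)
                                                      λ { i j (p , r) (p′ , r′) → unique c p p′ r r′ }) ⟩
  ∑ {m} (λ c → 1)                                ≡⟨ trans (∑-const m 1) (*-identityʳ m) ⟩
  m                                              ∎
  where
  open ≤-Reasoning
  PR? : ∀ i c → Dec (P i × R i c)
  PR? i c = P? i ×-dec R? i c

∑∑-ind-unique : {P : Fin n → Fin m → Set ℓ} (P? : ∀ i j → Dec (P i j)) →
  (∀ {i j i′ j′} → P i j → P i′ j′ → i ≡ i′ × j ≡ j′) → ∑ (λ i → ∑ λ j → ind (P? i j)) ≤ 1
∑∑-ind-unique {P = P} P? unique = ≤-trans (∑-mono inner) (∑-ind-unique (λ i → FinP.any? (P? i))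
    λ { i j (_ , p) (_ , p′) → proj₁ (unique p p′) })
  where
  inner : ∀ i → ∑ (λ j → ind (P? i j)) ≤ ind (FinP.any? (P? i))
  inner i with FinP.any? (P? i)
  ... | yes _ = ∑-ind-unique (P? i) λ j j′ p p′ → proj₂ (unique p p′)
  ... | no ¬p = ≤-reflexive (∑-zero λ j → ind-no (P? i j) λ p → ¬p (j , p))

-- Union bound over the positions: at distinct positions the triple is uniform, and at repeated ones
-- the term vanishes because `P` forces distinct vertices.
triples-in-tuples : ∀ N {P : Fin n → Fin n → Fin n → Set ℓ} (P? : ∀ x y z → Dec (P x y z)) →
  (∀ {x y z} → P x y z → x ≢ y × x ≢ z × y ≢ z) →
  n ^ 3 * ∑ᵀ N (λ q → ∑ λ a → ∑ λ b → ∑ λ c → ind (P? (lookup q a) (lookup q b) (lookup q c))) ≤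
  N ^ 3 * (n ^ N * ∑ λ x → ∑ λ y → ∑ λ z → ind (P? x y z))
triples-in-tuples {n = n} N {P} P? distinct = begin
  n ^ 3 * ∑ᵀ N (λ q → ∑ λ a → ∑ λ b → ∑ λ c → g a b c q)
    ≡⟨ cong (n ^ 3 *_) (trans (∑ᵀ-∑-comm N (λ q a → ∑ λ b → ∑ λ c → g a b c q))
         (∑-cong λ a → trans (∑ᵀ-∑-comm N (λ q b → ∑ λ c → g a b c q))
         (∑-cong λ b → ∑ᵀ-∑-comm N (λ q c → g a b c q)))) ⟩
  n ^ 3 * ∑ (λ a → ∑ λ b → ∑ λ c → ∑ᵀ N (g a b c))
    ≡⟨ ≡-sym (trans (∑-cong λ a → trans (∑-cong λ b → ∑-*ˡ (n ^ 3) (λ c → ∑ᵀ N (g a b c)))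
         (∑-*ˡ (n ^ 3) (λ b → ∑ λ c → ∑ᵀ N (g a b c))))
         (∑-*ˡ (n ^ 3) (λ a → ∑ λ b → ∑ λ c → ∑ᵀ N (g a b c)))) ⟩
  ∑ (λ a → ∑ λ b → ∑ λ c → n ^ 3 * ∑ᵀ N (g a b c))
    ≤⟨ ∑-bound (λ a → ∑-bound λ b → ∑-bound λ c → each a b c) ⟩
  N * (N * (N * T))  ≡⟨ trans (cong (N *_) (≡-sym (*-assoc N N T))) (≡-sym (*-assoc N (N * N) T)) ⟩
  N * (N * N) * T    ≡⟨ cong (λ t → N * (N * t) * T) (≡-sym (*-identityʳ N)) ⟩
  N ^ 3 * T          ∎
  where
  open ≤-Reasoning
  T = n ^ N * ∑ λ x → ∑ λ y → ∑ λ z → ind (P? x y z)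
  g : Fin N → Fin N → Fin N → Vec (Fin n) N → ℕ
  g a b c q = ind (P? (lookup q a) (lookup q b) (lookup q c))
  vanish : ∀ {a b c} → (∀ q → ¬ P (lookup q a) (lookup q b) (lookup q c)) → n ^ 3 * ∑ᵀ N (g a b c) ≤ T
  vanish {a} {b} {c} ¬P = ≤-trans (≤-reflexive (trans (cong (n ^ 3 *_)
      (trans (∑ᵀ-cong N λ q → ind-no (P? _ _ _) (¬P q)) (trans (∑ᵀ-const {n} N 0) (*-zeroʳ (n ^ N)))))
      (*-zeroʳ (n ^ 3)))) z≤n
  each : ∀ a b c → n ^ 3 * ∑ᵀ N (g a b c) ≤ T
  each a b c with a FinP.≟ b | a FinP.≟ c | b FinP.≟ c
  ... | yes refl | _ | _ = vanish λ q p → proj₁ (distinct p) refl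
  ... | no _ | yes refl | _ = vanish λ q p → proj₁ (proj₂ (distinct p)) refl
  ... | no _ | no _ | yes refl = vanish λ q p → proj₂ (proj₂ (distinct p)) refl
  ... | no a≢b | no a≢c | no b≢c = ≤-reflexive (∑ᵀ-three N a≢b a≢c b≢c (λ x y z → ind (P? x y z)))

-- Strict convexity of the sphere

-- The expansion of a squared difference over ℕ, with the mixed term on the side where it is added.
∣m-n∣²+2mn : ∀ m n → ∣ m - n ∣ * ∣ m - n ∣ + 2 * (m * n) ≡ m * m + n * n
∣m-n∣²+2mn m n with ≤-total m n
... | inj₁ m≤n with m≤n⇒∃[o]m+o≡n m≤n
... | e , refl rewrite ∣m-m+n∣≡n m e = identity m e
  where
  identity : ∀ m e → e * e + 2 * (m * (m + e)) ≡ m * m + (m + e) * (m + e)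
  identity = solve-∀
∣m-n∣²+2mn m n | inj₂ n≤m with m≤n⇒∃[o]m+o≡n n≤m
... | e , refl rewrite ∣-∣-comm (n + e) n | ∣m-m+n∣≡n n e = identity n e
  where
  identity : ∀ n e → e * e + 2 * ((n + e) * n) ≡ (n + e) * (n + e) + n * n
  identity = solve-∀

module _ {D : ℕ} (p q : ℕ) (a a′ a″ : Fin D → ℕ)
  (collinear : ∀ t → suc p * a t + suc q * a′ t ≡ (suc p + suc q) * a″ t)
  (s : ℕ) (on : ∑ (λ t → a t * a t) ≡ s) (on′ : ∑ (λ t → a′ t * a′ t) ≡ s)
  (on″ : ∑ (λ t → a″ t * a″ t) ≡ s) where

  private
    T = ∑ λ t → a t * a′ t
    P = suc p
    Q = suc q

    expand : ∀ x y → (P * x + Q * y) * (P * x + Q * y) ≡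
             P * P * (x * x) + (Q * Q * (y * y) + 2 * (P * Q) * (x * y))
    expand = lemma p q
      where
      lemma : ∀ p q x y → (suc p * x + suc q * y) * (suc p * x + suc q * y) ≡
        suc p * suc p * (x * x) + (suc q * suc q * (y * y) + 2 * (suc p * suc q) * (x * y))
      lemma = solve-∀

    regroup : ∀ p q s → (suc p + suc q) * (suc p + suc q) * s ≡
      suc p * suc p * s + (suc q * suc q * s + 2 * (suc p * suc q) * s)
    regroup = solve-∀

    square : ∀ t → (P + Q) * (P + Q) * (a″ t * a″ t) ≡
             P * P * (a t * a t) + (Q * Q * (a′ t * a′ t) + 2 * (P * Q) * (a t * a′ t))
    square t = begin
      (P + Q) * (P + Q) * (a″ t * a″ t)         ≡⟨ [m*n]*[o*p]≡[m*o]*[n*p] (P + Q) (P + Q) (a″ t) (a″ t) ⟩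
      (P + Q) * a″ t * ((P + Q) * a″ t)         ≡⟨ cong₂ _*_ (≡-sym (collinear t)) (≡-sym (collinear t)) ⟩
      (P * a t + Q * a′ t) * (P * a t + Q * a′ t) ≡⟨ expand (a t) (a′ t) ⟩
      _ ∎
      where open ≡-Reasoning

    -- Expanding the square of `P a + Q a′` when all three squared norms are `s` leaves the inner
    -- product `T` as the only unknown, which forces `T = s`.
    summed : (P + Q) * (P + Q) * s ≡ P * P * s + (Q * Q * s + 2 * (P * Q) * T)
    summed = begin
      (P + Q) * (P + Q) * s
        ≡⟨ cong ((P + Q) * (P + Q) *_) (≡-sym on″) ⟩
      (P + Q) * (P + Q) * ∑ (λ t → a″ t * a″ t)
        ≡⟨ ≡-sym (∑-*ˡ ((P + Q) * (P + Q)) (λ t → a″ t * a″ t)) ⟩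
      ∑ (λ t → (P + Q) * (P + Q) * (a″ t * a″ t))
        ≡⟨ ∑-cong square ⟩
      ∑ (λ t → P * P * (a t * a t) + (Q * Q * (a′ t * a′ t) + 2 * (P * Q) * (a t * a′ t)))
        ≡⟨ ∑-+ (λ t → P * P * (a t * a t)) (λ t → Q * Q * (a′ t * a′ t) + 2 * (P * Q) * (a t * a′ t)) ⟩
      ∑ (λ t → P * P * (a t * a t)) + ∑ (λ t → Q * Q * (a′ t * a′ t) + 2 * (P * Q) * (a t * a′ t))
        ≡⟨ cong₂ _+_ (∑-*ˡ (P * P) (λ t → a t * a t))
             (trans (∑-+ (λ t → Q * Q * (a′ t * a′ t)) (λ t → 2 * (P * Q) * (a t * a′ t)))
               (cong₂ _+_ (∑-*ˡ (Q * Q) (λ t → a′ t * a′ t)) (∑-*ˡ (2 * (P * Q)) (λ t → a t * a′ t)))) ⟩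
      P * P * ∑ (λ t → a t * a t) + (Q * Q * ∑ (λ t → a′ t * a′ t) + 2 * (P * Q) * T)
        ≡⟨ cong₂ _+_ (cong (P * P *_) on) (cong (_+ 2 * (P * Q) * T) (cong (Q * Q *_) on′)) ⟩
      _ ∎
      where open ≡-Reasoning

    s≡T : s ≡ T
    s≡T = *-cancelˡ-≡ s T (2 * (P * Q)) (+-cancelˡ-≡ (Q * Q * s) _ _ (+-cancelˡ-≡ (P * P * s) _ _
            (trans (≡-sym (regroup p q s)) summed)))

    gap : Fin D → ℕ
    gap t = ∣ a t - a′ t ∣

    gaps : ∑ (λ t → gap t * gap t) ≡ 0
    gaps = +-cancelʳ-≡ (2 * T) _ 0 (begin
      ∑ (λ t → gap t * gap t) + 2 * T
        ≡⟨ cong (∑ (λ t → gap t * gap t) +_) (≡-sym (∑-*ˡ 2 (λ t → a t * a′ t))) ⟩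
      ∑ (λ t → gap t * gap t) + ∑ (λ t → 2 * (a t * a′ t))
        ≡⟨ ≡-sym (∑-+ (λ t → gap t * gap t) (λ t → 2 * (a t * a′ t))) ⟩
      ∑ (λ t → gap t * gap t + 2 * (a t * a′ t))   ≡⟨ ∑-cong (λ t → ∣m-n∣²+2mn (a t) (a′ t)) ⟩
      ∑ (λ t → a t * a t + a′ t * a′ t)            ≡⟨ ∑-+ (λ t → a t * a t) (λ t → a′ t * a′ t) ⟩
      ∑ (λ t → a t * a t) + ∑ (λ t → a′ t * a′ t)  ≡⟨ cong₂ _+_ (trans on s≡T) (trans on′ s≡T) ⟩
      T + T                                        ≡⟨ cong (T +_) (≡-sym (+-identityʳ T)) ⟩
      2 * T                                        ∎)
      where open ≡-Reasoning

  -- The squared distance of `a` and `a′` is `2 s - 2 T = 0`, and a vanishing sum of squares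
  -- vanishes termwise. The weights `suc p` and `suc q` will be differences of part indices.
  sphere-strictly-convex : ∀ t → a t ≡ a′ t
  sphere-strictly-convex t = ∣m-n∣≡0⇒m≡n (square≡0 (gap t)
      (n≤0⇒n≡0 (≤-trans (term≤∑ (λ t → gap t * gap t) t) (≤-reflexive gaps))))
    where
    square≡0 : ∀ x → x * x ≡ 0 → x ≡ 0
    square≡0 zero _ = refl

funToFin-cong : {f g : Fin m → Fin n} → (∀ i → f i ≡ g i) → Fin.funToFin f ≡ Fin.funToFin g
funToFin-cong {zero}  h = refl
funToFin-cong {suc m} h = cong₂ Fin.combine (h zero) (funToFin-cong (h ∘ suc))

finToFun-injective : {i j : Fin (m ^ n)} → (∀ t → Fin.finToFun {m} {n} i t ≡ Fin.finToFun j t) → i ≡ j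
finToFun-injective {m} {n} {i} {j} h = trans (≡-sym (FinP.funToFin-finToFin {n} {m} i))
  (trans (funToFin-cong h) (FinP.funToFin-finToFin {n} {m} j))

-- Applied to each coordinate of `ξ + i α`, this recovers base and direction of a planted copy from
-- its vertices in two parts.
affine-injective : ∀ {a a′ b b′ i j} → i <ⁿ j →
  a + i * b ≡ a′ + i * b′ → a + j * b ≡ a′ + j * b′ → a ≡ a′ × b ≡ b′
affine-injective {a} {a′} {b} {b′} {i} i<j e₁ e₂ with m≤n⇒∃[o]m+o≡n i<j
... | e , refl = +-cancelʳ-≡ (i * b) a a′ (trans e₁ (cong (λ t → a′ + i * t) (≡-sym b≡b′))) , b≡b′
  where
  split : ∀ a i e b → a + (suc i + e) * b ≡ (a + i * b) + suc e * b
  split = solve-∀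
  b≡b′ : b ≡ b′
  b≡b′ = *-cancelˡ-≡ b b′ (suc e) (+-cancelˡ-≡ (a + i * b) _ _
    (trans (≡-sym (split a i e b)) (trans e₂ (trans (split a′ i e b′) (cong (_+ suc e * b′) (≡-sym e₁))))))

-- Certificates and the construction

Monotone : (Fin k → Fin k) → Set
Monotone φ = ∀ p q → p Fin.< q → φ p Fin.≤ φ q

-- What a copy reveals about the pairs whose colour depends on their parts alone: those inside one
-- part and those across unpatterned parts.
Viable : (Fin k → Fin k → Bool) → (Fin k → Fin k → Bool) → (Fin k → Bool) → (Fin k → Fin k) → Set
Viable A S b φ = ∀ p q → p Fin.< q →
  (φ p ≡ φ q → b (φ p) ≡ A p q) ×
  (φ p Fin.< φ q → S (φ p) (φ q) ≡ false → A (φ p) (φ q) ≡ A p q)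

-- Across patterned parts the special pairs have the colour given by `A` and all others the opposite
-- one. A copy that shows the colour of `A` there must therefore use a special pair.
MatchedPair : (Fin k → Fin k → Bool) → (Fin k → Fin k → Bool) → (Fin k → Fin k) → Fin k → Fin k → Set
MatchedPair A S φ p q =
  p Fin.< q × φ p Fin.< φ q × S (φ p) (φ q) ≡ true × A (φ p) (φ q) ≡ A p q

MatchedTriple : (Fin k → Fin k → Bool) → (Fin k → Fin k → Bool) → (Fin k → Fin k) →
  Fin k → Fin k → Fin k → Set
MatchedTriple A S φ p q r = MatchedPair A S φ p q × MatchedPair A S φ q r × MatchedPair A S φ p r

-- S is the set of pairs of parts that carry a Behrend-type pattern, b the colour inside each part
-- and φ the map sending a vertex of a copy to its part.
Certificate : (Fin k → Fin k → Bool) → Set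
Certificate {k} A = ∃ λ S → ∃ λ b → ∀ φ → Monotone φ → Viable A S b φ →
  ∃ λ p → ∃ λ q → ∃ λ r → MatchedTriple {k} A S φ p q r

-- Part i is a copy of the box [k d]^D; x in part i and x + (j - i) α in part j are special when
-- α lies in [d]^D on the sphere of radius √s.
module Construction {k : ℕ} (F : OGraph k) (S : Fin k → Fin k → Bool) (b : Fin k → Bool) (D d s : ℕ) where

  B W V : ℕ
  B = k * d
  W = B ^ D
  V = k * W

  Vertex = Fin V
  Box = Fin (d ^ D)

  coord : Box → Fin D → ℕ
  coord α t = toℕ (Fin.finToFun {d} {D} α t)

  opaque

    part : Vertex → Fin k
    part x = proj₁ (Fin.remQuot {k} W x)

    dig : Vertex → Fin D → ℕ
    dig x t = toℕ (Fin.finToFun {B} {D} (proj₂ (Fin.remQuot {k} W x)) t)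

    mk : Fin k → (Fin D → Fin B) → Vertex
    mk i g = Fin.combine i (Fin.funToFin g)

    part-mk : ∀ i g → part (mk i g) ≡ i
    part-mk i g = cong proj₁ (FinP.remQuot-combine {k} {W} i (Fin.funToFin g))

    dig-mk : ∀ i g t → dig (mk i g) t ≡ toℕ (g t)
    dig-mk i g t = trans (cong (λ r → toℕ (Fin.finToFun {B} {D} (proj₂ r) t))
        (FinP.remQuot-combine {k} {W} i (Fin.funToFin g))) (cong toℕ (FinP.finToFun-funToFin g t))

    vertex-≡ : ∀ {x y} → part x ≡ part y → (∀ t → dig x t ≡ dig y t) → x ≡ y
    vertex-≡ {x} {y} e h = trans (≡-sym (FinP.combine-remQuot {k} W x))
      (trans (cong₂ Fin.combine e (finToFun-injective {B} {D} (λ t → FinP.toℕ-injective (h t))))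
        (FinP.combine-remQuot {k} W y))

    part<⇒< : ∀ {x y} → part x Fin.< part y → x Fin.< y
    part<⇒< {x} {y} lt = subst₂ Fin._<_ (FinP.combine-remQuot {k} W x) (FinP.combine-remQuot {k} W y)
      (FinP.combine-monoˡ-< (proj₂ (Fin.remQuot {k} W x)) (proj₂ (Fin.remQuot {k} W y)) lt)

    <⇒part≤ : ∀ {x y} → x Fin.< y → part x Fin.≤ part y
    <⇒part≤ {x} {y} x<y = ≮⇒≥ λ lt → <-asym (part<⇒< {y} {x} lt) x<y

  OnSphere : Box → Set
  OnSphere α = ∑ (λ t → coord α t * coord α t) ≡ s

  onSphere? : ∀ α → Dec (OnSphere α)
  onSphere? α = ∑ (λ t → coord α t * coord α t) ≟ s

  Shift : Vertex → Vertex → Box → Set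
  Shift x y α = ∀ t → dig y t ≡ dig x t + (toℕ (part y) ∸ toℕ (part x)) * coord α t

  shift? : ∀ x y α → Dec (Shift x y α)
  shift? x y α = FinP.all? λ t → dig y t ≟ dig x t + (toℕ (part y) ∸ toℕ (part x)) * coord α t

  Special : Vertex → Vertex → Set
  Special x y = ∃ λ α → OnSphere α × Shift x y α

  special? : ∀ x y → Dec (Special x y)
  special? x y = FinP.any? λ α → onSphere? α ×-dec shift? x y α

  colour : Bool → Bool → Bool → Bool
  colour patterned special c = if patterned then (if special then c else not c) else c

  across : Vertex → Vertex → Bool
  across x y = colour (S (part x) (part y)) (does (special? x y)) (adj F (part x) (part y))

  adjᶜ : ∀ x y → Tri (part x Fin.< part y) (part x ≡ part y) (part y Fin.< part x) → Bool
  adjᶜ x y (tri< _ _ _) = across x y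
  adjᶜ x y (tri> _ _ _) = across y x
  adjᶜ x y (tri≈ _ _ _) = if does (x FinP.≟ y) then false else b (part x)

  adjᴳ : Vertex → Vertex → Bool
  adjᴳ x y = adjᶜ x y (FinP.<-cmp (part x) (part y))

  adj-< : ∀ {x y} → part x Fin.< part y → adjᴳ x y ≡ across x y
  adj-< {x} {y} lt with FinP.<-cmp (part x) (part y)
  ... | tri< _ _ _ = refl
  ... | tri≈ ¬lt _ _ = contradiction lt ¬lt
  ... | tri> ¬lt _ _ = contradiction lt ¬lt

  adj-> : ∀ {x y} → part y Fin.< part x → adjᴳ x y ≡ across y x
  adj-> {x} {y} gt with FinP.<-cmp (part x) (part y)
  ... | tri< _ _ ¬gt = contradiction gt ¬gt
  ... | tri≈ _ _ ¬gt = contradiction gt ¬gt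
  ... | tri> _ _ _ = refl

  adj-≈ : ∀ {x y} → part x ≡ part y → adjᴳ x y ≡ (if does (x FinP.≟ y) then false else b (part x))
  adj-≈ {x} {y} e with FinP.<-cmp (part x) (part y)
  ... | tri< _ ¬e _ = contradiction e ¬e
  ... | tri≈ _ _ _ = refl
  ... | tri> _ ¬e _ = contradiction e ¬e

  does-≟-sym : (x y : Vertex) → does (x FinP.≟ y) ≡ does (y FinP.≟ x)
  does-≟-sym x y with x FinP.≟ y | y FinP.≟ x
  ... | yes _ | yes _ = refl
  ... | no _ | no _ = refl
  ... | yes e | no ¬e = contradiction (≡-sym e) ¬e
  ... | no ¬e | yes e = contradiction (≡-sym e) ¬e

  adj-sym : ∀ x y → adjᴳ x y ≡ adjᴳ y x
  adj-sym x y = case FinP.<-cmp (part x) (part y) of λ where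
    (tri< lt _ _) → trans (adj-< {x} {y} lt) (≡-sym (adj-> {y} {x} lt))
    (tri> _ _ gt) → trans (adj-> {x} {y} gt) (≡-sym (adj-< {y} {x} gt))
    (tri≈ _ e _) → trans (adj-≈ {x} {y} e) (trans
      (cong₂ (λ r c → if r then false else b c) (does-≟-sym x y) e) (≡-sym (adj-≈ {y} {x} (≡-sym e))))

  adj-irrefl : ∀ x → adjᴳ x x ≡ false
  adj-irrefl x = trans (adj-≈ {x} {x} refl) lemma
    where
    lemma : (if does (x FinP.≟ x) then false else b (part x)) ≡ false
    lemma with x FinP.≟ x
    ... | yes _ = refl
    ... | no ¬e = contradiction refl ¬e

  G : OGraph V
  G = record { adj = adjᴳ ; sym = adj-sym ; irrefl = adj-irrefl }

  point : Box → Box → Fin k → Vertex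
  point ξ α i = mk i λ t → Fin.fromℕ< (bound t)
    -- The digit is below `d + i d`, and `(i + 1) d ≤ k d`: hence the side `B = k * d` of the boxes.
    where
    bound : ∀ t → coord ξ t + toℕ i * coord α t <ⁿ B
    bound t = ≤-trans (+-monoˡ-≤ _ (FinP.toℕ<n (Fin.finToFun {d} {D} ξ t)))
      (≤-trans (+-monoʳ-≤ d (*-monoʳ-≤ (toℕ i) (<⇒≤ (FinP.toℕ<n (Fin.finToFun {d} {D} α t)))))
        (*-monoˡ-≤ d (FinP.toℕ<n i)))

  part-point : ∀ ξ α i → part (point ξ α i) ≡ i
  part-point ξ α i = part-mk i _

  dig-point : ∀ ξ α i t → dig (point ξ α i) t ≡ coord ξ t + toℕ i * coord α t
  dig-point ξ α i t = trans (dig-mk i _ t) (FinP.toℕ-fromℕ< _)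

  point-special : ∀ ξ {α i j} → OnSphere α → i Fin.< j → Special (point ξ α i) (point ξ α j)
  point-special ξ {α} {i} {j} on i<j = α , on , λ t → begin
    dig (point ξ α j) t                          ≡⟨ dig-point ξ α j t ⟩
    coord ξ t + toℕ j * coord α t                ≡⟨ cong (λ r → coord ξ t + r * coord α t)
                                                      (≡-sym (m+[n∸m]≡n (<⇒≤ i<j))) ⟩
    coord ξ t + (toℕ i + (toℕ j ∸ toℕ i)) * coord α t
      ≡⟨ split (coord ξ t) (toℕ i) (toℕ j ∸ toℕ i) (coord α t) ⟩
    coord ξ t + toℕ i * coord α t + (toℕ j ∸ toℕ i) * coord α t
      ≡⟨ cong₂ _+_ (≡-sym (dig-point ξ α i t)) (cong (_* coord α t)
           (≡-sym (cong₂ (λ u v → toℕ u ∸ toℕ v) (part-point ξ α j) (part-point ξ α i)))) ⟩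
    _ ∎
    where
    open ≡-Reasoning
    split : ∀ x i e a → x + (i + e) * a ≡ x + i * a + e * a
    split = solve-∀

  across-special : ∀ {x y} → Special x y → across x y ≡ adj F (part x) (part y)
  across-special {x} {y} sp with S (part x) (part y)
  ... | false = refl
  ... | true with special? x y
  ... | yes _ = refl
  ... | no ¬sp = contradiction sp ¬sp

  point-part< : ∀ ξ α {i j} → i Fin.< j → part (point ξ α i) Fin.< part (point ξ α j)
  point-part< ξ α = subst₂ Fin._<_ (≡-sym (part-point ξ α _)) (≡-sym (part-point ξ α _))

  point-adj : ∀ ξ {α i j} → OnSphere α → i Fin.< j → adjᴳ (point ξ α i) (point ξ α j) ≡ adj F i j
  point-adj ξ {α} {i} {j} on i<j = trans (adj-< {point ξ α i} {point ξ α j} (point-part< ξ α i<j))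
    (trans (across-special {point ξ α i} {point ξ α j} (point-special ξ on i<j))
      (cong₂ (adj F) (part-point ξ α i) (part-point ξ α j)))

  -- The planted copy with base `ξ` and direction `α` passes through `x` and `y`; such pairs are
  -- charged when the planted copies are destroyed.
  Link : Vertex → Vertex → Box → Box → Set
  Link x y ξ α = OnSphere α × (part x Fin.< part y × (x ≡ point ξ α (part x) × y ≡ point ξ α (part y)))

  link? : ∀ x y ξ α → Dec (Link x y ξ α)
  link? x y ξ α = onSphere? α ×-dec ((part x FinP.<? part y) ×-dec
    ((x FinP.≟ point ξ α (part x)) ×-dec (y FinP.≟ point ξ α (part y))))

  link-unique : ∀ {x y ξ α ξ′ α′} → Link x y ξ α → Link x y ξ′ α′ → ξ ≡ ξ′ × α ≡ α′
  link-unique {x} {y} {ξ} {α} {ξ′} {α′} (_ , lt , ex , ey) (_ , _ , ex′ , ey′) =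
    finToFun-injective {d} {D} (λ t → FinP.toℕ-injective (proj₁ (both t))) ,
    finToFun-injective {d} {D} (λ t → FinP.toℕ-injective (proj₂ (both t)))
    where
    digits : ∀ {z} → z ≡ point ξ α (part z) → z ≡ point ξ′ α′ (part z) → ∀ t →
             coord ξ t + toℕ (part z) * coord α t ≡ coord ξ′ t + toℕ (part z) * coord α′ t
    digits {z} e e′ t = trans (≡-sym (dig-point ξ α (part z) t))
      (trans (cong (λ u → dig u t) (trans (≡-sym e) e′)) (dig-point ξ′ α′ (part z) t))
    both : ∀ t → coord ξ t ≡ coord ξ′ t × coord α t ≡ coord α′ t
    both t = affine-injective lt (digits ex ex′ t) (digits ey ey′ t)

  -- If no pair of the planted copy were changed, the copy would survive in `H`.
  broken-link : ∀ H → InducedFree F H → ∀ ξ α → OnSphere α →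
    ∃ λ x → ∃ λ y → Differ G H x y × Link x y ξ α
  broken-link H free ξ α on with FinP.any? (λ i → FinP.any? (λ j →
      (i FinP.<? j) ×-dec ¬? (adjᴳ (point ξ α i) (point ξ α j) BoolP.≟ adj H (point ξ α i) (point ξ α j))))
  ... | yes (i , j , i<j , ≢) = point ξ α i , point ξ α j ,
      (part<⇒< {point ξ α i} {point ξ α j} (point-part< ξ α i<j) , ≢) ,
      on , point-part< ξ α i<j ,
      cong (point ξ α) (≡-sym (part-point ξ α i)) , cong (point ξ α) (≡-sym (part-point ξ α j))
  ... | no none = contradiction (f , order , edges) free
    where
    f = point ξ α
    order : ∀ i j → i Fin.< j → f i Fin.< f j
    order i j i<j = part<⇒< {f i} {f j} (point-part< ξ α i<j)
    edges< : ∀ i j → i Fin.< j → adj H (f i) (f j) ≡ adj F i j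
    edges< i j i<j with adjᴳ (f i) (f j) BoolP.≟ adj H (f i) (f j)
    ... | yes e = trans (≡-sym e) (point-adj ξ on i<j)
    ... | no ≢ = contradiction (i , j , i<j , ≢) none
    edges : ∀ i j → adj H (f i) (f j) ≡ adj F i j
    edges i j = case FinP.<-cmp i j of λ where
      (tri< lt _ _) → edges< i j lt
      (tri≈ _ refl _) → trans (OGraph.irrefl H (f i)) (≡-sym (OGraph.irrefl F i))
      (tri> _ _ gt) → trans (OGraph.sym H (f i) (f j)) (trans (edges< j i gt) (OGraph.sym F j i))

  sphere-size : ℕ
  sphere-size = ∑ (λ α → ind (onSphere? α))

  -- Each planted copy has a pair on which `G` and `H` differ, and by `link-unique` such a pair is
  -- charged by one copy only.
  planted-far : ∀ H → InducedFree F H → d ^ D * sphere-size ≤ dist G H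
  planted-far H free = begin
    d ^ D * sphere-size
      ≡⟨ ≡-sym (∑-const (d ^ D) sphere-size) ⟩
    ∑ {d ^ D} (λ ξ → ∑ λ α → ind (onSphere? α))
      ≤⟨ ∑-mono (λ ξ → ∑-mono λ α → ind-≤ (onSphere? α) λ on →
           let x , y , dl = broken-link H free ξ α on in
           ≤-trans (≤-reflexive (≡-sym (ind-yes (dl? x y ξ α) dl)))
             (≤-trans (term≤∑ (λ y → ind (dl? x y ξ α)) y) (term≤∑ (λ x → ∑ λ y → ind (dl? x y ξ α)) x))) ⟩
    ∑ (λ ξ → ∑ λ α → ∑ λ x → ∑ λ y → ind (dl? x y ξ α))
      ≡⟨ ∑-cong (λ ξ → trans (∑-comm λ α x → ∑ λ y → ind (dl? x y ξ α))
           (∑-cong λ x → ∑-comm λ α y → ind (dl? x y ξ α))) ⟩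
    ∑ (λ ξ → ∑ λ x → ∑ λ y → ∑ λ α → ind (dl? x y ξ α))
      ≡⟨ trans (∑-comm λ ξ x → ∑ λ y → ∑ λ α → ind (dl? x y ξ α))
           (∑-cong λ x → ∑-comm λ ξ y → ∑ λ α → ind (dl? x y ξ α)) ⟩
    ∑ (λ x → ∑ λ y → ∑ λ ξ → ∑ λ α → ind (dl? x y ξ α))
      ≤⟨ ∑-mono (λ x → ∑-mono λ y → few x y) ⟩
    ∑ (λ x → ∑ λ y → ind (differ? G H x y))
      ≡⟨ ≡-sym (dist-∑ G H) ⟩
    dist G H ∎
    where
    open ≤-Reasoning
    dl? : ∀ x y ξ α → Dec (Differ G H x y × Link x y ξ α)
    dl? x y ξ α = differ? G H x y ×-dec link? x y ξ α
    few : ∀ x y → ∑ (λ ξ → ∑ λ α → ind (dl? x y ξ α)) ≤ ind (differ? G H x y)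
    few x y = bound (differ? G H x y)
      where
      bound : (δ? : Dec (Differ G H x y)) → ∑ (λ ξ → ∑ λ α → ind (dl? x y ξ α)) ≤ ind δ?
      bound (yes _) = ∑∑-ind-unique (dl? x y) λ (_ , l) (_ , l′) → link-unique l l′
      bound (no ¬δ) = ≤-reflexive (∑-zero λ ξ → ∑-zero λ α → ind-no (dl? x y ξ α) (¬δ ∘ proj₁))

  Edge : Vertex → Vertex → Set
  Edge x y = part x Fin.< part y × Special x y

  edge? : ∀ x y → Dec (Edge x y)
  edge? x y = (part x FinP.<? part y) ×-dec special? x y

  Triangle : Vertex → Vertex → Vertex → Set
  Triangle x y z = Edge x y × Edge y z × Edge x z

  triangle? : ∀ x y z → Dec (Triangle x y z)
  triangle? x y z = edge? x y ×-dec edge? y z ×-dec edge? x z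

  triangle-distinct : ∀ {x y z} → Triangle x y z → x ≢ y × x ≢ z × y ≢ z
  triangle-distinct ((x<y , _) , (y<z , _) , (x<z , _)) =
    (λ { refl → <-irrefl refl x<y }) , (λ { refl → <-irrefl refl x<z }) , λ { refl → <-irrefl refl y<z }

  -- For parts i < j < l, going from i to l directly or through j gives (j - i) α + (l - j) α′ = (l
  -- - i) α″ in each coordinate. Strict convexity then identifies the directions.
  triangle-progression : ∀ {x y z} → Triangle x y z → ∃ λ α → Shift x y α × Shift y z α
  triangle-progression {x} {y} {z} ((x<y , α , on , e) , (y<z , α′ , on′ , e′) , (x<z , α″ , on″ , e″)) =
    α , e , λ t → trans (e′ t) (cong (λ r → dig y t + (toℕ (part z) ∸ toℕ (part y)) * r) (≡-sym (α≡α′ t)))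
    where
    gap : ∀ {i j} → i <ⁿ j → ∃ λ p → i + suc p ≡ j × j ∸ i ≡ suc p
    gap {i} lt with m≤n⇒∃[o]m+o≡n lt
    ... | p , refl = p , +-suc i p , trans (cong (_∸ i) (≡-sym (+-suc i p))) (m+n∸m≡n i (suc p))
    p = proj₁ (gap x<y)
    q = proj₁ (gap y<z)
    xy = proj₂ (gap x<y)
    yz = proj₂ (gap y<z)
    xz : toℕ (part z) ∸ toℕ (part x) ≡ suc p + suc q
    xz = trans (cong (_∸ toℕ (part x)) (trans (≡-sym (proj₁ yz))
      (trans (cong (_+ suc q) (≡-sym (proj₁ xy))) (+-assoc (toℕ (part x)) (suc p) (suc q)))))
      (m+n∸m≡n (toℕ (part x)) _)
    collinear : ∀ t → suc p * coord α t + suc q * coord α′ t ≡ (suc p + suc q) * coord α″ t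
    collinear t = +-cancelˡ-≡ (dig x t) _ _ (begin
      dig x t + (suc p * coord α t + suc q * coord α′ t)
        ≡⟨ ≡-sym (+-assoc (dig x t) _ _) ⟩
      dig x t + suc p * coord α t + suc q * coord α′ t
        ≡⟨ cong (_+ suc q * coord α′ t) (trans (cong (λ r → dig x t + r * coord α t) (≡-sym (proj₂ xy))) (≡-sym (e t))) ⟩
      dig y t + suc q * coord α′ t
        ≡⟨ trans (cong (λ r → dig y t + r * coord α′ t) (≡-sym (proj₂ yz))) (≡-sym (e′ t)) ⟩
      dig z t ≡⟨ trans (e″ t) (cong (λ r → dig x t + r * coord α″ t) xz) ⟩
      _ ∎)
      where open ≡-Reasoning
    α≡α′ : ∀ t → coord α t ≡ coord α′ t
    α≡α′ = sphere-strictly-convex p q (coord α) (coord α′) (coord α″) collinear s on on′ on″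

  -- For a given `x`, the vertex `y` is recovered from its part and a direction `α`.
  edges-from : ∀ x → ∑ (λ y → ind (edge? x y)) ≤ k * d ^ D
  edges-from x = ∑-ind-fibres (edge? x) code?
    (λ { y (_ , α , _ , e) → Fin.combine (part y) α ,
       subst (Code y) (≡-sym (FinP.remQuot-combine (part y) α)) (refl , e) })
    λ { c _ _ (e , h) (e′ , h′) → vertex-≡ (trans e (≡-sym e′)) λ t → trans (h t)
         (trans (cong (λ j → dig x t + (toℕ j ∸ toℕ (part x)) * coord (proj₂ (Fin.remQuot {k} (d ^ D) c)) t)
           (trans e (≡-sym e′))) (≡-sym (h′ t))) }
    where
    Code : Vertex → Fin k × Box → Set
    Code y (j , α) = part y ≡ j × Shift x y α
    code? : ∀ y c → Dec (Code y (Fin.remQuot {k} (d ^ D) c))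
    code? y c = (part y FinP.≟ proj₁ (Fin.remQuot {k} (d ^ D) c)) ×-dec shift? x y (proj₂ (Fin.remQuot {k} (d ^ D) c))

  -- The pair `x`, `y` fixes the direction, after division by the positive difference of part
  -- indices; direction and part then fix `z`.
  shift-unique : ∀ {x y z z′} → part z ≡ part z′ → part x Fin.< part y →
    (∃ λ α → Shift x y α × Shift y z α) → (∃ λ α → Shift x y α × Shift y z′ α) → z ≡ z′
  shift-unique {x} {y} {z} {z′} e lt (α , h , h₁) (α′ , h′ , h₁′) = vertex-≡ e λ t →
    trans (h₁ t) (trans (cong₂ (λ j a → dig y t + (toℕ j ∸ toℕ (part y)) * a) e (same t)) (≡-sym (h₁′ t)))
    where
    same : ∀ t → coord α t ≡ coord α′ t
    same t = *-cancelˡ-≡ _ _ (toℕ (part y) ∸ toℕ (part x)) {{>-nonZero (m<n⇒0<n∸m lt)}}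
      (+-cancelˡ-≡ (dig x t) _ _ (trans (≡-sym (h t)) (h′ t)))

  triangles-on : ∀ x y → ∑ (λ z → ind (triangle? x y z)) ≤ ind (edge? x y) * k
  triangles-on x y = bound (edge? x y)
    where
    unique : ∀ {z z′} j → Triangle x y z → Triangle x y z′ → part z ≡ j → part z′ ≡ j → z ≡ z′
    unique {z} {z′} j τ τ′ e e′ = shift-unique (trans e (≡-sym e′)) (proj₁ (proj₁ τ))
      (triangle-progression τ) (triangle-progression τ′)
    bound : (e? : Dec (Edge x y)) → ∑ (λ z → ind (triangle? x y z)) ≤ ind e? * k
    bound (no ¬e) = ≤-reflexive (∑-zero λ z → ind-no (triangle? x y z) (¬e ∘ proj₁))
    bound (yes _) = ≤-trans (∑-ind-fibres (triangle? x y) (λ z j → part z FinP.≟ j)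
      (λ z _ → part z , refl) unique) (≤-reflexive (≡-sym (*-identityˡ k)))

  triangle-count : ∑ (λ x → ∑ λ y → ∑ λ z → ind (triangle? x y z)) ≤ V * (k * d ^ D * k)
  triangle-count = ∑-bound λ x → begin
    ∑ (λ y → ∑ λ z → ind (triangle? x y z)) ≤⟨ ∑-mono (triangles-on x) ⟩
    ∑ (λ y → ind (edge? x y) * k)           ≡⟨ ∑-cong (λ y → *-comm (ind (edge? x y)) k) ⟩
    ∑ (λ y → k * ind (edge? x y))           ≡⟨ ∑-*ˡ k (λ y → ind (edge? x y)) ⟩
    k * ∑ (λ y → ind (edge? x y))           ≤⟨ *-monoʳ-≤ k (edges-from x) ⟩
    k * (k * d ^ D)                         ≡⟨ *-comm k (k * d ^ D) ⟩
    k * d ^ D * k                           ∎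
    where open ≤-Reasoning

  module _ (certifies : ∀ φ → Monotone φ → Viable (adj F) S b φ →
                        ∃ λ p → ∃ λ q → ∃ λ r → MatchedTriple (adj F) S φ p q r) where

    colour-matched : ∀ {x y c} → S (part x) (part y) ≡ true → across x y ≡ c →
                     adj F (part x) (part y) ≡ c → Special x y
    colour-matched {x} {y} patterned e e′ with S (part x) (part y) | special? x y
    ... | true | yes sp = sp
    ... | true | no _ = contradiction (trans e′ (≡-sym e)) (BoolP.not-¬ refl)

    -- Parts are intervals of the vertex order, so the map from the copy to its parts is monotone;
    -- it is viable, and each matched pair of the certificate is special.
    copy⇒triangle : ∀ f → IsInducedCopy F G f →
      ∃ λ p → ∃ λ q → ∃ λ r → Triangle (f p) (f q) (f r)
    copy⇒triangle f (order , edges) with certifies φ (λ p q p<q → <⇒part≤ (order p q p<q)) viable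
      where
      φ = part ∘ f
      viable : Viable (adj F) S b φ
      viable p q p<q =
        (λ e → trans (inside e) (edges p q)) ,
        λ lt unpatterned → trans (≡-sym (plain unpatterned)) (trans (≡-sym (adj-< {f p} {f q} lt)) (edges p q))
        where
        inside : part (f p) ≡ part (f q) → b (part (f p)) ≡ adjᴳ (f p) (f q)
        inside e with f p FinP.≟ f q | adj-≈ {f p} {f q} e
        ... | yes fp≡fq | _ = contradiction (order p q p<q) (<-irrefl (cong toℕ fp≡fq))
        ... | no _ | e′ = ≡-sym e′
        plain : S (part (f p)) (part (f q)) ≡ false → across (f p) (f q) ≡ adj F (part (f p)) (part (f q))
        plain u rewrite u = refl
    ... | p , q , r , pq , qr , pr = p , q , r , edge pq , edge qr , edge pr
      where
      edge : ∀ {p q} → MatchedPair (adj F) S (part ∘ f) p q → Edge (f p) (f q)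
      edge {p} {q} (p<q , lt , patterned , e) =
        lt , colour-matched {f p} {f q} patterned (trans (≡-sym (adj-< {f p} {f q} lt)) (edges p q)) e

    few-copies : V ^ 3 * copies F G ≤ k ^ 3 * (V ^ k * (V * (k * d ^ D * k)))
    few-copies = begin
      V ^ 3 * copies F G
        ≡⟨ cong (V ^ 3 *_) (copies-∑ᵀ F G) ⟩
      V ^ 3 * ∑ᵀ k (λ w → ind (isInducedCopy? F G (lookup w)))
        ≤⟨ *-monoʳ-≤ (V ^ 3) (∑ᵀ-mono k λ w → ind-≤ (isInducedCopy? F G (lookup w)) λ copy →
             let p , q , r , τ = copy⇒triangle (lookup w) copy in
             ≤-trans (≤-reflexive (≡-sym (ind-yes (triangle? _ _ _) τ)))
             (≤-trans (term≤∑ (λ r → ind (triangle? (lookup w p) (lookup w q) (lookup w r))) r)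
             (≤-trans (term≤∑ (λ q → ∑ λ r → ind (triangle? (lookup w p) (lookup w q) (lookup w r))) q)
               (term≤∑ (λ p → ∑ λ q → ∑ λ r → ind (triangle? (lookup w p) (lookup w q) (lookup w r))) p)))) ⟩
      V ^ 3 * ∑ᵀ k (λ w → ∑ λ p → ∑ λ q → ∑ λ r → ind (triangle? (lookup w p) (lookup w q) (lookup w r)))
        ≤⟨ triples-in-tuples k triangle? triangle-distinct ⟩
      k ^ 3 * (V ^ k * ∑ λ x → ∑ λ y → ∑ λ z → ind (triangle? x y z))
        ≤⟨ *-monoʳ-≤ (k ^ 3) (*-monoʳ-≤ (V ^ k) triangle-count) ⟩
      k ^ 3 * (V ^ k * (V * (k * d ^ D * k))) ∎
      where open ≤-Reasoning

-- Pigeonhole over the at most `D d² + 1` values of the squared norm on `[d]^D`.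
popular-sphere : ∀ {k} (F : OGraph k) S b D d → ∃ λ s →
  d ^ D ≤ suc (D * (d * d)) * Construction.sphere-size F S b D d s
popular-sphere F S b D d = toℕ s , (begin
  d ^ D                                   ≡⟨ ≡-sym (trans (∑-const (d ^ D) 1) (*-identityʳ (d ^ D))) ⟩
  ∑ {d ^ D} (λ α → 1)                     ≤⟨ ∑-mono (λ α → ≤-trans
                                               (≤-reflexive (≡-sym (ind-yes (on? (radius α) α) (≡-sym (FinP.toℕ-fromℕ< (norm< α))))))
                                               (term≤∑ (λ s → ind (on? s α)) (radius α))) ⟩
  ∑ (λ α → ∑ λ s → ind (on? s α))         ≡⟨ ∑-comm (λ α s → ind (on? s α)) ⟩
  ∑ size                                  ≤⟨ proj₂ best ⟩
  suc (D * (d * d)) * size s              ∎)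
  where
  open ≤-Reasoning
  coord : Fin (d ^ D) → Fin D → ℕ
  coord α t = toℕ (Fin.finToFun {d} {D} α t)
  norm : Fin (d ^ D) → ℕ
  norm α = ∑ λ t → coord α t * coord α t
  norm< : ∀ α → norm α <ⁿ suc (D * (d * d))
  norm< α = s≤s (∑-bound λ t → *-mono-≤ (coord≤ t) (coord≤ t))
    where
    coord≤ : ∀ t → coord α t ≤ d
    coord≤ t = <⇒≤ (FinP.toℕ<n (Fin.finToFun {d} {D} α t))
  radius : ∀ α → Fin (suc (D * (d * d)))
  radius α = Fin.fromℕ< (norm< α)
  on? : (s : Fin (suc (D * (d * d)))) (α : Fin (d ^ D)) → Dec (norm α ≡ toℕ s)
  on? s = Construction.onSphere? F S b D d (toℕ s)
  size : Fin (suc (D * (d * d))) → ℕ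
  size s = ∑ λ α → ind (on? s α)
  best = average≤some size
  s = proj₁ best

^-distribʳ-* : ∀ o m n → (m * n) ^ o ≡ m ^ o * n ^ o
^-distribʳ-* zero    m n = refl
^-distribʳ-* (suc o) m n = trans (cong (m * n *_) (^-distribʳ-* o m n)) ([m*n]*[o*p]≡[m*o]*[n*p] m n _ _)

-- The density of the planted copies is at least K / d² for a K independent of d, whereas that of all
-- copies is at most d ^ (- dim); dim = 2 C + 1 and large d refute a bound of degree C.
certificate⇒¬poly : (F : OGraph k) → 2 ≤ k → Certificate (adj F) → ¬ PolyRemovalℕ F
certificate⇒¬poly {k} F 2≤k (S , b , certifies) (q , C , poly) = <-irrefl refl (begin-strict
  d ^ dim                             ≤⟨ m≤m*n (d ^ dim) K ⟩
  d ^ dim * K                         ≤⟨ dense ⟩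
  q * E ^ C * k ^ 5                 ≤⟨ *-monoˡ-≤ (k ^ 5) (*-monoʳ-≤ q (^-monoˡ-≤ C E≤)) ⟩
  q * (M * (d * d)) ^ C * k ^ 5     ≡⟨ cong (λ t → q * t * k ^ 5) (^-distribʳ-* C M (d * d)) ⟩
  q * (M ^ C * (d * d) ^ C) * k ^ 5 ≡⟨ regroup q (M ^ C) ((d * d) ^ C) (k ^ 5) ⟩
  q * M ^ C * k ^ 5 * (d * d) ^ C   <⟨ *-monoˡ-< ((d * d) ^ C) (n<1+n (q * M ^ C * k ^ 5)) ⟩
  d * (d * d) ^ C                   ≡⟨ cong (d *_) (trans (^-distribʳ-* C d d) (≡-sym (^-distribˡ-+-* d C C))) ⟩
  d ^ dim                             ∎)
  where
  open ≤-Reasoning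
  dim = suc (C + C)
  -- `K` is the ratio of `V * V` to `d ^ dim * d ^ dim`, the price of having `k` parts and boxes of
  -- side `k d`.
  K = k * k * (k ^ dim * k ^ dim)
  M = K * suc dim
  -- `d` exceeds the product of all constant factors that the supposed bound yields, so the spare
  -- factor `d` in `d ^ (2 C + 1)` decides.
  d = suc (q * M ^ C * k ^ 5)
  s = proj₁ (popular-sphere F S b dim d)
  open Construction F S b dim d s
  E = K * suc (dim * (d * d))

  instance
    k≢0 : NonZero k
    k≢0 = >-nonZero (≤-trans (s≤s z≤n) 2≤k)
    kᴰ≢0 : NonZero (k ^ dim)
    kᴰ≢0 = m^n≢0 k dim
    dᴰ≢0 : NonZero (d ^ dim)
    dᴰ≢0 = m^n≢0 d dim
    K≢0 : NonZero K
    K≢0 = m*n≢0 (k * k) (k ^ dim * k ^ dim) {{m*n≢0 k k}} {{m*n≢0 (k ^ dim) (k ^ dim)}}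
    ddᶜ≢0 : NonZero ((d * d) ^ C)
    ddᶜ≢0 = m^n≢0 (d * d) C
    V≢0 : NonZero V
    V≢0 = m*n≢0 k (B ^ dim) {{k≢0}} {{m^n≢0 B dim {{m*n≢0 k d}}}}

  regroup : ∀ q a b c → q * (a * b) * c ≡ q * a * c * b
  regroup = solve-∀

  2≤E : 2 ≤ E
  2≤E = ≤-trans 2≤k (≤-trans (m≤m*n k k) (≤-trans (m≤m*n (k * k) (k ^ dim * k ^ dim) {{m*n≢0 (k ^ dim) (k ^ dim)}}) (m≤m*n K _)))

  E≤ : E ≤ M * (d * d)
  E≤ = ≤-trans (*-monoʳ-≤ K (+-monoˡ-≤ (dim * (d * d)) {1} {d * d} (s≤s z≤n))) (≤-reflexive (≡-sym (*-assoc K (suc dim) (d * d))))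

  V*V : V * V ≡ K * (d ^ dim * d ^ dim)
  V*V = trans (cong (λ t → k * t * (k * t)) (^-distribʳ-* dim k d)) (lemma k (k ^ dim) (d ^ dim))
    where
    lemma : ∀ k a b → k * (a * b) * (k * (a * b)) ≡ k * k * (a * a) * (b * b)
    lemma = solve-∀

  far : ∀ H → InducedFree F H → V * V ≤ E * dist G H
  far H free = begin
    V * V                                             ≡⟨ V*V ⟩
    K * (d ^ dim * d ^ dim)                               ≤⟨ *-monoʳ-≤ K (*-monoʳ-≤ (d ^ dim) (proj₂ (popular-sphere F S b dim d))) ⟩
    K * (d ^ dim * (suc (dim * (d * d)) * sphere-size))   ≡⟨ lemma K (d ^ dim) (suc (dim * (d * d))) sphere-size ⟩
    E * (d ^ dim * sphere-size)                         ≤⟨ *-monoʳ-≤ E (planted-far H free) ⟩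
    E * dist G H                                      ∎
    where
    lemma : ∀ k a b c → k * (a * (b * c)) ≡ k * b * (a * c)
    lemma = solve-∀

  dense : d ^ dim * K ≤ q * E ^ C * k ^ 5
  dense = *-cancelʳ-≤ _ _ (d ^ dim) (begin
    d ^ dim * K * d ^ dim              ≡⟨ trans (lemma₀ (d ^ dim) K) (≡-sym V*V) ⟩
    V * V                          ≤⟨ *-cancelʳ-≤ (V * V) _ (V ^ k * V) {{m*n≢0 (V ^ k) V {{m^n≢0 V k}}}} cubes ⟩
    q * E ^ C * k ^ 5 * d ^ dim      ∎)
    where
    lemma₀ : ∀ a b → a * b * a ≡ b * (a * a)
    lemma₀ = solve-∀
    lemma₁ : ∀ v p → v * v * (p * v) ≡ v * (v * (v * 1)) * p
    lemma₁ = solve-∀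
    lemma₂ : ∀ k p v a e → e * (k * (k * (k * 1)) * (p * (v * (k * a * k)))) ≡
                           e * (k * (k * (k * (k * (k * 1))))) * a * (p * v)
    lemma₂ = solve-∀
    lemma₃ : ∀ v e c → v * (e * c) ≡ e * (v * c)
    lemma₃ = solve-∀
    cubes : V * V * (V ^ k * V) ≤ q * E ^ C * k ^ 5 * d ^ dim * (V ^ k * V)
    cubes = begin
      V * V * (V ^ k * V)                         ≡⟨ lemma₁ V (V ^ k) ⟩
      V ^ 3 * V ^ k                               ≤⟨ *-monoʳ-≤ (V ^ 3) (poly E V G 2≤E far) ⟩
      V ^ 3 * (q * E ^ C * copies F G)            ≡⟨ lemma₃ (V ^ 3) (q * E ^ C) (copies F G) ⟩
      q * E ^ C * (V ^ 3 * copies F G)            ≤⟨ *-monoʳ-≤ (q * E ^ C) (few-copies certifies) ⟩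
      q * E ^ C * (k ^ 3 * (V ^ k * (V * (k * d ^ dim * k))))
                                                  ≡⟨ lemma₂ k (V ^ k) V (d ^ dim) (q * E ^ C) ⟩
      q * E ^ C * k ^ 5 * d ^ dim * (V ^ k * V)     ∎

-- Finding certificates: monochromatic triples, exhaustive search, Ramsey

certificate-cong : {A A′ : Fin k → Fin k → Bool} → (∀ i j → i Fin.< j → A i j ≡ A′ i j) →
  Certificate A → Certificate A′
certificate-cong {A = A} {A′} A≗A′ (S , b , certifies) = S , b , λ φ mono viable →
  let p , q , r , pq , qr , pr = certifies φ mono λ p q p<q →
        (λ e → trans (proj₁ (viable p q p<q) e) (≡-sym (A≗A′ p q p<q))) ,
        λ lt u → trans (A≗A′ _ _ lt) (trans (proj₂ (viable p q p<q) lt u) (≡-sym (A≗A′ p q p<q)))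
  in p , q , r , pair φ pq , pair φ qr , pair φ pr
  where
  pair : ∀ φ {p q} → MatchedPair A S φ p q → MatchedPair A′ S φ p q
  pair φ (p<q , lt , s , e) = p<q , lt , s , trans (≡-sym (A≗A′ _ _ lt)) (trans e (A≗A′ _ _ p<q))

Monochromatic : (Fin k → Fin k → Bool) → Set
Monochromatic A = ∃ λ p → ∃ λ q → ∃ λ r → p Fin.< q × q Fin.< r × A p q ≡ A q r × A p q ≡ A p r

-- Pattern the pairs of parts that have the colour `c` of the triple and give the inside of every
-- part the colour `not c`. A pair of colour `c` in a copy then lies neither inside a part nor
-- across unpatterned parts, so it is matched; this applies to all three pairs of the triple.
monochromatic⇒certificate : (A : Fin k → Fin k → Bool) → Monochromatic A → Certificate A
monochromatic⇒certificate A (p , q , r , p<q , q<r , e₁ , e₂) =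
  (λ i j → does (A i j BoolP.≟ c)) , (λ _ → not c) , λ φ mono viable →
    p , q , r , matched mono viable p<q refl , matched mono viable q<r (≡-sym e₁) ,
    matched mono viable (FinP.<-trans p<q q<r) (≡-sym e₂)
  where
  c = A p q
  S = λ i j → does (A i j BoolP.≟ c)
  matched : ∀ {φ} → Monotone φ → Viable A S (λ _ → not c) φ → ∀ {u w} → u Fin.< w → A u w ≡ c →
            MatchedPair A S φ u w
  matched {φ} mono viable {u} {w} u<w e with φ u FinP.≟ φ w
  ... | yes same = contradiction (trans (proj₁ (viable u w u<w) same) e) (BoolP.not-¬ refl ∘ ≡-sym)
  ... | no differ with FinP.≤∧≢⇒< (mono u w u<w) differ
  ... | lt with A (φ u) (φ w) BoolP.≟ c | proj₂ (viable u w u<w) lt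
  ... | yes e′ | _ = u<w , lt , refl , trans e′ (≡-sym e)
  ... | no ¬e′ | h = contradiction (trans (h refl) e) ¬e′

allBools? : {P : Vec Bool n → Set ℓ} → (∀ v → Dec (P v)) → Dec (∀ v → P v)
allBools? {zero}  P? = map′ (λ { p [] → p }) (λ h → h []) (P? [])
allBools? {suc n} P? = map′ (λ { (f , t) (false ∷ v) → f v ; (f , t) (true ∷ v) → t v })
  (λ h → (λ v → h (false ∷ v)) , λ v → h (true ∷ v))
  (allBools? (λ v → P? (false ∷ v)) ×-dec allBools? λ v → P? (true ∷ v))

-- Monotone maps as vectors with a running lower bound, so that the search enumerates nondecreasing
-- vectors only.
Rising : ℕ → Vec (Fin k) n → Set
Rising l []      = ⊤
Rising l (x ∷ v) = l ≤ toℕ x × Rising (toℕ x) v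

allRising? : ∀ l {P : Vec (Fin k) n → Set ℓ} → (∀ v → Dec (P v)) → Dec (∀ v → Rising l v → P v)
allRising? {n = zero}  l P? = map′ (λ { p [] _ → p }) (λ h → h [] tt) (P? [])
allRising? {n = suc n} l P? = map′ (λ { h (x ∷ v) (l≤x , rising) → h x l≤x v rising })
  (λ h x l≤x v rising → h (x ∷ v) (l≤x , rising))
  (FinP.all? λ x → (l ≤? toℕ x) →-dec allRising? (toℕ x) λ v → P? (x ∷ v))

rising : ∀ l (φ : Fin n → Fin k) → (∀ p → l ≤ toℕ (φ p)) → (∀ p q → p Fin.< q → φ p Fin.≤ φ q) →
  Rising l (Vec.tabulate φ)
rising {zero}  l φ above mono = tt
rising {suc n} l φ above mono = above zero ,
  rising (toℕ (φ zero)) (φ ∘ suc) (λ p → mono zero (suc p) (s≤s z≤n)) λ p q p<q → mono (suc p) (suc q) (s≤s p<q)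

-- Row i of the table of a graph lists the pairs (i , j) with i < j.
Table : ℕ → Set
Table zero    = ⊤
Table (suc k) = Vec Bool k × Table k

-- The value `false` on and below the diagonal is a placeholder: by `certificate-cong` only the
-- pairs `i < j` matter.
entry : Table k → Fin k → Fin k → Bool
entry {suc k} (row , t) zero    (suc j) = lookup row j
entry {suc k} (row , t) (suc i) (suc j) = entry t i j
entry {suc k} (row , t) _       zero    = false

table : (Fin k → Fin k → Bool) → Table k
table {zero}  A = tt
table {suc k} A = Vec.tabulate (A zero ∘ suc) , table (λ i j → A (suc i) (suc j))

entry-table : (A : Fin k → Fin k → Bool) → ∀ i j → i Fin.< j → entry (table A) i j ≡ A i j
entry-table {suc k} A zero    (suc j) _         = VecP.lookup∘tabulate (A zero ∘ suc) j
entry-table {suc k} A (suc i) (suc j) (s≤s i<j) = entry-table (λ i j → A (suc i) (suc j)) i j i<j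

allTable? : {P : Table k → Set ℓ} → (∀ t → Dec (P t)) → Dec (∀ t → P t)
allTable? {zero}  P? = map′ (λ { p tt → p }) (λ h → h tt) (P? tt)
allTable? {suc k} P? = map′ (λ { h (r , t) → h r t }) (λ h r t → h (r , t))
  (allBools? λ r → allTable? λ t → P? (r , t))

Candidate : ℕ → Set
Candidate k = List (Fin k × Fin k) × Vec Bool k

patterned : Candidate k → Fin k → Fin k → Bool
patterned (pairs , _) i j = does (Any.any? (λ (u , w) → (i FinP.≟ u) ×-dec (j FinP.≟ w)) pairs)

Certifies : (Fin k → Fin k → Bool) → Candidate k → Set
Certifies A κ = ∀ w → Rising 0 w → Viable A (patterned κ) (lookup (proj₂ κ)) (lookup w) →
  ∃ λ p → ∃ λ q → ∃ λ r → MatchedTriple A (patterned κ) (lookup w) p q r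

certifies? : (A : Fin k → Fin k → Bool) (κ : Candidate k) → Dec (Certifies A κ)
certifies? A κ = allRising? 0 λ w →
  ((FinP.all? λ p → FinP.all? λ q → (p FinP.<? q) →-dec
     (((lookup w p FinP.≟ lookup w q) →-dec (lookup (proj₂ κ) (lookup w p) BoolP.≟ A p q)) ×-dec
      ((lookup w p FinP.<? lookup w q) →-dec ((patterned κ (lookup w p) (lookup w q) BoolP.≟ false) →-dec
        (A (lookup w p) (lookup w q) BoolP.≟ A p q))))) →-dec
   (FinP.any? λ p → FinP.any? λ q → FinP.any? λ r → pair? w p q ×-dec pair? w q r ×-dec pair? w p r))
  where
  pair? : ∀ w p q → Dec (MatchedPair A (patterned κ) (lookup w) p q)
  pair? w p q = (p FinP.<? q) ×-dec (lookup w p FinP.<? lookup w q) ×-dec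
    (patterned κ (lookup w p) (lookup w q) BoolP.≟ true) ×-dec (A (lookup w p) (lookup w q) BoolP.≟ A p q)

certifies⇒certificate : (A : Fin k → Fin k → Bool) (κ : Candidate k) → Certifies A κ → Certificate A
certifies⇒certificate A κ certifies = S , lookup (proj₂ κ) , λ φ mono viable →
  let w = Vec.tabulate φ
      e : ∀ p → lookup w p ≡ φ p
      e = VecP.lookup∘tabulate φ
      p , q , r , pq , qr , pr = certifies w
        (rising 0 φ (λ p → z≤n) mono)
        (λ p q p<q →
          (λ same → trans (cong (lookup (proj₂ κ)) (e p))
             (proj₁ (viable p q p<q) (trans (≡-sym (e p)) (trans same (e q))))) ,
          λ lt u → trans (cong₂ A (e p) (e q)) (proj₂ (viable p q p<q) (subst₂ Fin._<_ (e p) (e q) lt)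
             (trans (≡-sym (cong₂ S (e p) (e q))) u)))
  in p , q , r , pair φ pq , pair φ qr , pair φ pr
  where
  S = patterned κ
  pair : ∀ φ {p q} → MatchedPair A S (lookup (Vec.tabulate φ)) p q → MatchedPair A S φ p q
  pair φ {p} {q} m rewrite VecP.lookup∘tabulate φ p | VecP.lookup∘tabulate φ q = m

monochromatic? : (A : Fin k → Fin k → Bool) → Dec (Monochromatic A)
monochromatic? A = FinP.any? λ p → FinP.any? λ q → FinP.any? λ r →
  (p FinP.<? q) ×-dec (q FinP.<? r) ×-dec (A p q BoolP.≟ A q r) ×-dec (A p q BoolP.≟ A p r)

Solved : List (Candidate k) → (Fin k → Fin k → Bool) → Set
Solved κs A = Monochromatic A ⊎ Any.Any (Certifies A) κs

solved? : (κs : List (Candidate k)) (A : Fin k → Fin k → Bool) → Dec (Solved κs A)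
solved? κs A = monochromatic? A ⊎-dec Any.any? (certifies? A) κs

solved⇒certificate : (κs : List (Candidate k)) (A : Fin k → Fin k → Bool) → Solved κs A → Certificate A
solved⇒certificate κs A (inj₁ m) = monochromatic⇒certificate A m
solved⇒certificate κs A (inj₂ any) =
  let κ , certifies = Any.satisfied any in certifies⇒certificate A κ certifies

-- `checked` holds by evaluation, which runs through every graph on `k` vertices, first looking for
-- a monochromatic triple and then trying the candidates.
all-certified : (κs : List (Candidate k)) → True (allTable? (λ t → solved? κs (entry {k} t))) →
  (A : Fin k → Fin k → Bool) → Certificate A
all-certified κs checked A = certificate-cong (entry-table A)
  (solved⇒certificate κs (entry (table A)) (toWitness checked (table A)))

constant : List (Fin k × Fin k) → Candidate k
constant pairs = pairs , Vec.replicate _ false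

triple : Fin k → Fin k → Fin k → List (Fin k × Fin k)
triple p q r = (p , q) List.∷ (q , r) List.∷ (p , r) List.∷ List.[]

-- The candidates come from a computer search.
opaque

  certificate₄ : (A : Fin 4 → Fin 4 → Bool) → Certificate A
  certificate₄ = all-certified
    ( constant (triple 0F 1F 2F) List.∷ constant (triple 0F 1F 3F) List.∷ constant (triple 0F 2F 3F)
    List.∷ (triple 0F 2F 3F , split)
    List.∷ ((0F , 2F) List.∷ (0F , 3F) List.∷ (1F , 2F) List.∷ (1F , 3F) List.∷ (2F , 3F) List.∷ List.[] , split)
    List.∷ constant ((0F , 1F) List.∷ (0F , 2F) List.∷ (0F , 3F) List.∷ (1F , 3F) List.∷ (2F , 3F) List.∷ List.[])
    List.∷ List.[]) _
    where
    split : Vec Bool 4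
    split = false ∷ false ∷ true ∷ true ∷ []

  certificate₅ : (A : Fin 5 → Fin 5 → Bool) → Certificate A
  certificate₅ = all-certified
    (constant (triple 0F 1F 2F) List.∷ constant (triple 0F 1F 3F) List.∷ constant (triple 0F 1F 4F) List.∷ List.[]) _
  
opaque

  three-equal : (v : Vec Bool 5) → ∃ λ i → ∃ λ j → ∃ λ l →
    i Fin.< j × j Fin.< l × lookup v i ≡ lookup v j × lookup v i ≡ lookup v l
  three-equal = toWitness {a? = allBools? λ v → FinP.any? λ i → FinP.any? λ j → FinP.any? λ l →
    (i FinP.<? j) ×-dec (j FinP.<? l) ×-dec (lookup v i BoolP.≟ lookup v j) ×-dec (lookup v i BoolP.≟ lookup v l)} _

-- The classical proof of R(3,3) ≤ 6: three of the five pairs at vertex 0 share a colour `c`. Either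
-- two of their other ends are joined in colour `c`, or these ends form a triangle in `not c`.
ramsey : (A : Fin 6 → Fin 6 → Bool) → Monochromatic A
ramsey A with three-equal (Vec.tabulate (A zero ∘ suc))
... | i , j , l , i<j , j<l , e₁ , e₂ = choose (agree i j) (agree j l) (agree i l)
  where
  c = A zero (suc i)
  e : ∀ t → lookup (Vec.tabulate (A zero ∘ suc)) t ≡ A zero (suc t)
  e = VecP.lookup∘tabulate (A zero ∘ suc)
  cj : c ≡ A zero (suc j)
  cj = trans (≡-sym (e i)) (trans e₁ (e j))
  cl : c ≡ A zero (suc l)
  cl = trans (≡-sym (e i)) (trans e₂ (e l))
  agree : ∀ u w → A (suc u) (suc w) ≡ c ⊎ A (suc u) (suc w) ≡ not c
  agree u w with A (suc u) (suc w) | c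
  ... | true | true = inj₁ refl
  ... | true | false = inj₂ refl
  ... | false | true = inj₂ refl
  ... | false | false = inj₁ refl
  choose : A (suc i) (suc j) ≡ c ⊎ A (suc i) (suc j) ≡ not c → A (suc j) (suc l) ≡ c ⊎ A (suc j) (suc l) ≡ not c →
    A (suc i) (suc l) ≡ c ⊎ A (suc i) (suc l) ≡ not c → Monochromatic A
  choose (inj₁ h) _ _ = zero , suc i , suc j , s≤s z≤n , s≤s i<j , ≡-sym h , cj
  choose _ (inj₁ h) _ = zero , suc j , suc l , s≤s z≤n , s≤s j<l , trans (≡-sym cj) (≡-sym h) , trans (≡-sym cj) cl
  choose _ _ (inj₁ h) = zero , suc i , suc l , s≤s z≤n , s≤s (FinP.<-trans i<j j<l) , ≡-sym h , cl
  choose (inj₂ h₁) (inj₂ h₂) (inj₂ h₃) = suc i , suc j , suc l , s≤s i<j , s≤s j<l ,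
    trans h₁ (≡-sym h₂) , trans h₁ (≡-sym h₃)

certificate₆₊ : ∀ k (A : Fin (6 + k) → Fin (6 + k) → Bool) → Certificate A
certificate₆₊ k A = monochromatic⇒certificate A (restrict (ramsey λ i j → A (i Fin.↑ˡ k) (j Fin.↑ˡ k)))
  where
  <-↑ˡ : {i j : Fin 6} → i Fin.< j → (i Fin.↑ˡ k) Fin.< (j Fin.↑ˡ k)
  <-↑ˡ {i} {j} = subst₂ _<ⁿ_ (≡-sym (FinP.toℕ-↑ˡ i k)) (≡-sym (FinP.toℕ-↑ˡ j k))
  restrict : Monochromatic (λ i j → A (i Fin.↑ˡ k) (j Fin.↑ˡ k)) → Monochromatic A
  restrict (p , q , r , p<q , q<r , e) = p Fin.↑ˡ k , q Fin.↑ˡ k , r Fin.↑ˡ k , <-↑ˡ p<q , <-↑ˡ q<r , e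

opaque

  -- The hypothesis singles out exactly the graphs outside the family of `D`. Patterning all pairs
  -- of parts is enough; the two candidates differ in the colour inside the parts.
  certificate₃ : (A : Fin 3 → Fin 3 → Bool) → A 0F 1F ≡ A 1F 2F → Certificate A
  certificate₃ A e = certificate-cong (entry-table A) (solved⇒certificate κs (entry (table A))
    (toWitness {a? = allTable? λ t → (entry t 0F 1F BoolP.≟ entry t 1F 2F) →-dec solved? κs (entry t)} _ (table A) e))
    where
    κs : List (Candidate 3)
    κs = constant (triple 0F 1F 2F) List.∷ (triple 0F 1F 2F , Vec.replicate 3 true) List.∷ List.[]

≅-upper : {F H : OGraph k} → (∀ i j → i Fin.< j → adj F i j ≡ adj H i j) → F ≅ H
≅-upper {F = F} {H} h i j = case FinP.<-cmp i j of λ where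
  (tri< lt _ _) → h i j lt
  (tri≈ _ refl _) → trans (OGraph.irrefl F i) (≡-sym (OGraph.irrefl H i))
  (tri> _ _ gt) → trans (OGraph.sym F i j) (trans (h j i gt) (OGraph.sym H j i))

-- The colours of the pairs 01 and 02 remain free, and their four values give the four members of
-- the family.
D-family : (F : OGraph 3) → adj F 0F 1F ≢ adj F 1F 2F → InDFamily F
D-family F a≢c = choose _ _ _ refl refl refl a≢c
  where
  upper : (H : OGraph 3) → adj F 0F 1F ≡ adj H 0F 1F → adj F 0F 2F ≡ adj H 0F 2F → adj F 1F 2F ≡ adj H 1F 2F → F ≅ H
  upper H e₀₁ e₀₂ e₁₂ = ≅-upper {F = F} {H} λ where
    zero (suc zero) _ → e₀₁
    zero (suc (suc zero)) _ → e₀₂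
    (suc zero) (suc (suc zero)) _ → e₁₂
    (suc zero) (suc zero) (s≤s ())
    (suc (suc zero)) (suc zero) (s≤s ())
    (suc (suc zero)) (suc (suc zero)) (s≤s (s≤s ()))
  choose : ∀ a b c → adj F 0F 1F ≡ a → adj F 0F 2F ≡ b → adj F 1F 2F ≡ c → a ≢ c → InDFamily F
  choose true  true  false e₁ e₂ e₃ _ = inj₁ (upper D e₁ e₂ e₃)
  choose false true  true  e₁ e₂ e₃ _ = inj₂ (inj₁ (upper (rev D) e₁ e₂ e₃))
  choose false false true  e₁ e₂ e₃ _ = inj₂ (inj₂ (inj₁ (upper (compl D) e₁ e₂ e₃)))
  choose true  false false e₁ e₂ e₃ _ = inj₂ (inj₂ (inj₂ (upper (compl (rev D)) e₁ e₂ e₃)))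
  choose true  _     true  _ _ _ a≢c = contradiction refl a≢c
  choose false _     false _ _ _ a≢c = contradiction refl a≢c

poly⇒small-or-D-family : (F : OGraph k) → 2 ≤ k → PolyRemovalℕ F → k ≡ 2 ⊎ InDFamily F
poly⇒small-or-D-family {0} F () poly
poly⇒small-or-D-family {1} F (s≤s ()) poly
poly⇒small-or-D-family {2} F 2≤k poly = inj₁ refl
poly⇒small-or-D-family {3} F 2≤k poly with adj F 0F 1F BoolP.≟ adj F 1F 2F
... | yes e = contradiction poly (certificate⇒¬poly F 2≤k (certificate₃ (adj F) e))
... | no a≢c = inj₂ (D-family F a≢c)
poly⇒small-or-D-family {4} F 2≤k poly = contradiction poly (certificate⇒¬poly F 2≤k (certificate₄ (adj F)))
poly⇒small-or-D-family {5} F 2≤k poly = contradiction poly (certificate⇒¬poly F 2≤k (certificate₅ (adj F)))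
poly⇒small-or-D-family {suc (suc (suc (suc (suc (suc k)))))} F 2≤k poly =
  contradiction poly (certificate⇒¬poly F 2≤k (certificate₆₊ k (adj F)))

-- The removal lemma for `D`: the elimination forest

least : {P : Fin n → Set ℓ} → (∀ i → Dec (P i)) →
  (∃ λ i → P i × ∀ j → j Fin.< i → ¬ P j) ⊎ (∀ i → ¬ P i)
least {zero}  P? = inj₂ λ ()
least {suc n} P? with P? zero
... | yes p = inj₁ (zero , p , λ j ())
... | no ¬p with least (P? ∘ suc)
... | inj₁ (i , p , min) = inj₁ (suc i , p , λ { zero _ → ¬p ; (suc j) (s≤s j<i) → min j j<i })
... | inj₂ none = inj₂ λ { zero → ¬p ; (suc i) → none i }

Adj : OGraph n → Fin n → Fin n → Set
Adj G x y = adj G x y ≡ true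

adj? : (G : OGraph n) → ∀ x y → Dec (Adj G x y)
adj? G x y = adj G x y BoolP.≟ true

-- R is a set of vertices. In a D-free graph the forward neighbours of a vertex form a clique, so that
-- r ↦ (first forward neighbour of r in R) is an elimination forest of R. Child y ρ says that ρ would
-- become a child of y if y were added to R, and Deep j ρ that there is a path of length j below ρ.
module Forest {n} (G : OGraph n) (R : Fin n → Set) where

  Child : Fin n → Fin n → Set
  Child y ρ = R ρ × ρ Fin.< y × Adj G ρ y × (∀ r → ρ Fin.< r → r Fin.< y → R r → ¬ Adj G ρ r)

  Deep : ℕ → Fin n → Set
  Deep zero    ρ = R ρ
  Deep (suc j) ρ = R ρ × ∃ λ c → Child ρ c × Deep j c

  HeavyChild : ℕ → Fin n → Fin n → Set
  HeavyChild h y ρ = Child y ρ × Deep h ρ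

  -- z is not the last vertex of a copy of D whose other two vertices lie in R.
  Closed : Fin n → Set
  Closed z = ∀ r r′ → R r → R r′ → r Fin.< r′ → r′ Fin.< z → Adj G r r′ → Adj G r z → Adj G r′ z

  AllClosed : Set
  AllClosed = ∀ z → R z → Closed z

  Between : Fin n → Fin n → Fin n → Set
  Between r y s = R s × r Fin.< s × s Fin.< y × Adj G r s

  -- The forward neighbours of `y` in `R` that are lost when the adjacency of `y` is read off its
  -- heavy children.
  Excess : ℕ → Fin n → Fin n → Set
  Excess h y z = R z × y Fin.< z × Adj G y z × (∀ ρ → HeavyChild h y ρ → ¬ Adj G ρ z)

  First : Fin n → Fin n → Set
  First x r = R r × x Fin.< r × Adj G x r × (∀ s → x Fin.< s → s Fin.< r → R s → ¬ Adj G x s)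

  deep⇒R : ∀ j {ρ} → Deep j ρ → R ρ
  deep⇒R zero    r = r
  deep⇒R (suc j) (r , _) = r

  deep-≤ : ∀ {i j ρ} → i ≤ j → Deep j ρ → Deep i ρ
  deep-≤ {zero}  {j}     _         d = deep⇒R j d
  deep-≤ {suc i} {suc j} (s≤s i≤j) (r , c , child , d) = r , c , child , deep-≤ i≤j d

  first-unique : ∀ {x r r′} → First x r → First x r′ → r ≡ r′
  first-unique {x} {r} {r′} (R-r , x<r , a , min) (R-r′ , x<r′ , a′ , min′) = case FinP.<-cmp r r′ of λ where
    (tri< lt _ _) → contradiction a (min′ r x<r lt R-r)
    (tri≈ _ e _) → e
    (tri> _ _ gt) → contradiction a′ (min r′ x<r′ gt R-r′)

  parent-unique : ∀ {c t t′} → R t → R t′ → Child t c → Child t′ c → t ≡ t′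
  parent-unique R-t R-t′ (_ , c<t , a , none) (_ , c<t′ , a′ , none′) =
    first-unique (R-t , c<t , a , none) (R-t′ , c<t′ , a′ , none′)

  module _ (R? : ∀ v → Dec (R v)) where

    child? : ∀ y ρ → Dec (Child y ρ)
    child? y ρ = R? ρ ×-dec (ρ FinP.<? y) ×-dec adj? G ρ y ×-dec
      FinP.all? λ r → (ρ FinP.<? r) →-dec ((r FinP.<? y) →-dec (R? r →-dec ¬? (adj? G ρ r)))

    deep? : ∀ j ρ → Dec (Deep j ρ)
    deep? zero    ρ = R? ρ
    deep? (suc j) ρ = R? ρ ×-dec FinP.any? λ c → child? ρ c ×-dec deep? j c

    heavyChild? : ∀ h y ρ → Dec (HeavyChild h y ρ)
    heavyChild? h y ρ = child? y ρ ×-dec deep? h ρ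

    closed? : ∀ z → Dec (Closed z)
    closed? z = FinP.all? λ r → FinP.all? λ r′ → R? r →-dec (R? r′ →-dec ((r FinP.<? r′) →-dec
      ((r′ FinP.<? z) →-dec (adj? G r r′ →-dec (adj? G r z →-dec adj? G r′ z)))))

    allClosed? : Dec AllClosed
    allClosed? = FinP.all? λ z → R? z →-dec closed? z

    between? : ∀ r y s → Dec (Between r y s)
    between? r y s = R? s ×-dec (r FinP.<? s) ×-dec (s FinP.<? y) ×-dec adj? G r s

    excess? : ∀ h y z → Dec (Excess h y z)
    excess? h y z = R? z ×-dec (y FinP.<? z) ×-dec adj? G y z ×-dec
      FinP.all? λ ρ → heavyChild? h y ρ →-dec ¬? (adj? G ρ z)

    first? : ∀ x r → Dec (First x r)
    first? x r = R? r ×-dec (x FinP.<? r) ×-dec adj? G x r ×-dec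
      FinP.all? λ s → (x FinP.<? s) →-dec ((s FinP.<? r) →-dec (R? s →-dec ¬? (adj? G x s)))

    opaque

      between : Fin n → Fin n → ℕ
      between r y = ∑ λ s → ind (between? r y s)

      excess : ℕ → Fin n → ℕ
      excess h y = ∑ λ z → ind (excess? h y z)

      between-def : ∀ r y → between r y ≡ ∑ λ s → ind (between? r y s)
      between-def r y = refl

      excess-def : ∀ h y → excess h y ≡ ∑ λ z → ind (excess? h y z)
      excess-def h y = refl

    -- Climb from r through its ancestors to the last one before y; each forward neighbour of r before
    -- y is passed on the way.
    climb : AllClosed → ∀ {y} → Closed y → ∀ j {r} → Deep j r → r Fin.< y → Adj G r y →
      ∃ λ ρ → Child y ρ × Deep (j + between r y) ρ × (∀ z → y Fin.≤ z → Closed z → Adj G r z → Adj G ρ z)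
    climb closed {y} closed-y j {r} = go (toℕ y) j (m∸n≤m (toℕ y) (toℕ r))
      where
      -- The distance from `r` to `y` serves as fuel.
      go : ∀ fuel j {r} → toℕ y ∸ toℕ r ≤ fuel → Deep j r → r Fin.< y → Adj G r y →
        ∃ λ ρ → Child y ρ × Deep (j + between r y) ρ × (∀ z → y Fin.≤ z → Closed z → Adj G r z → Adj G ρ z)
      go fuel j {r} enough d r<y a with least (between? r y)
      ... | inj₂ none = r ,
        (deep⇒R j d , r<y , a , λ s r<s s<y R-s b → none s (R-s , r<s , s<y , b)) ,
        subst (λ t → Deep t r) (≡-sym (trans (cong (j +_) (trans (between-def r y)
          (∑-zero λ s → ind-no (between? r y s) (none s)))) (+-identityʳ j))) d ,
        λ z _ _ b → b
      go zero j enough d r<y a | inj₁ _ = contradiction (m<n⇒0<n∸m r<y) (≤⇒≯ enough)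
      -- `r′` is the first forward neighbour of `r` in `R`, so `r` is a child of `r′` and the depth
      -- grows by one, while by `shrink` the number of vertices still to be passed drops by at most
      -- one.
      go (suc fuel) j {r} enough d r<y a | inj₁ (r′ , (R-r′ , r<r′ , r′<y , b) , min) =
        let ρ , child , deep , up = go fuel (suc j)
              (≤-pred (≤-trans (∸-monoʳ-< r<r′ (<⇒≤ r′<y)) enough))
              (R-r′ , r , (deep⇒R j d , r<r′ , b , λ s r<s s<r′ R-s e →
                 min s s<r′ (R-s , r<s , FinP.<-trans s<r′ r′<y , e)) , d)
              r′<y (closed-y r r′ (deep⇒R j d) R-r′ r<r′ r′<y b a)
        in ρ , child , deep-≤ (≤-trans (+-monoʳ-≤ j shrink) (≤-reflexive (+-suc j _))) deep ,
           λ z y≤z closed-z e → up z y≤z closed-z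
             (closed-z r r′ (deep⇒R j d) R-r′ r<r′ (≤-trans r′<y y≤z) b e)
        where
        open ≤-Reasoning
        -- Apart from `r′`, a forward neighbour of `r` in `R` before `y` is also one of `r′`,
        -- because `R` spans no `D`.
        pointwise : ∀ s → ind (between? r y s) ≤ ind (s FinP.≟ r′) + ind (between? r′ y s)
        pointwise s = ind-≤ (between? r y s) λ (R-s , r<s , s<y , e) → case FinP.<-cmp s r′ of λ where
          (tri< lt _ _) → contradiction (R-s , r<s , s<y , e) (min s lt)
          (tri≈ _ refl _) → ≤-trans (≤-reflexive (≡-sym (ind-yes (s FinP.≟ r′) refl))) (m≤m+n _ _)
          (tri> _ _ gt) → ≤-trans (≤-reflexive (≡-sym (ind-yes (between? r′ y s)
            (R-s , gt , s<y , closed s R-s r r′ (deep⇒R j d) R-r′ r<r′ gt b e)))) (m≤n+m _ _)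
        shrink : between r y ≤ suc (between r′ y)
        shrink = begin
          between r y                                             ≡⟨ between-def r y ⟩
          ∑ (λ s → ind (between? r y s))                          ≤⟨ ∑-mono pointwise ⟩
          ∑ (λ s → ind (s FinP.≟ r′) + ind (between? r′ y s))     ≡⟨ ∑-+ (λ s → ind (s FinP.≟ r′)) _ ⟩
          ∑ (λ s → ind (s FinP.≟ r′)) + ∑ (λ s → ind (between? r′ y s))
            ≤⟨ +-monoˡ-≤ _ (∑-ind-unique (λ s → s FinP.≟ r′) λ _ _ e e′ → trans e (≡-sym e′)) ⟩
          suc (∑ (λ s → ind (between? r′ y s)))                   ≡⟨ cong suc (≡-sym (between-def r′ y)) ⟩
          suc (between r′ y)                                      ∎

module _ {n} (G : OGraph n) {R R′ : Fin n → Set} where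
  private
    module 𝓡 = Forest G R
    module 𝓡′ = Forest G R′

  module _ {y : Fin n} (to : ∀ v → v Fin.< y → R v → R′ v) (from : ∀ v → v Fin.< y → R′ v → R v) where

    -- Children and depth at `y` depend only on the part of `R` below `y`, so they may be computed
    -- in any set that agrees with `R` there.
    child-transfer : ∀ {t ρ} → t Fin.≤ y → 𝓡.Child t ρ → 𝓡′.Child t ρ
    child-transfer t≤y (r , ρ<t , a , none) = to _ (≤-trans ρ<t t≤y) r , ρ<t , a ,
      λ s ρ<s s<t R-s → none s ρ<s s<t (from s (≤-trans s<t t≤y) R-s)

    deep-transfer : ∀ j {ρ} → ρ Fin.< y → 𝓡.Deep j ρ → 𝓡′.Deep j ρ
    deep-transfer zero    ρ<y r = to _ ρ<y r
    deep-transfer (suc j) ρ<y (r , c , child , d) = to _ ρ<y r , c , child-transfer (<⇒≤ ρ<y) child ,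
      deep-transfer j (FinP.<-trans (proj₁ (proj₂ child)) ρ<y) d

    heavyChild-transfer : ∀ h {ρ} → 𝓡.HeavyChild h y ρ → 𝓡′.HeavyChild h y ρ
    heavyChild-transfer h (child , d) = child-transfer ≤-refl child , deep-transfer h (proj₁ (proj₂ child)) d

-- The rounding of G given by R

module Rounding {n} (G : OGraph n) (R : Fin n → Set) (R? : ∀ v → Dec (R v)) (h g : ℕ) where

  open Forest G R

  -- `AllClosed` belongs to the definition so that the rounding is `D`-free for every `R`: if `R`
  -- spans a `D`, no vertex is inner and the rounded graph has no edges.
  Inner : Fin n → Set
  Inner y = AllClosed × Closed y × ∃ (HeavyChild h y) ×
    (∀ ρ ρ′ → HeavyChild h y ρ → HeavyChild h y ρ′ → ρ ≡ ρ′) × excess R? h y <ⁿ g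

  -- Nothing is known about the depth of `r` in `OuterEdge`. The condition `h ≤ between` makes up
  -- for it: climbing from `r` gains `h` levels and so ends in a heavy child of `y`.
  InnerEdge OuterEdge Edge : Fin n → Fin n → Set
  InnerEdge x y = Inner x × ∃ λ ρ → HeavyChild h x ρ × Adj G ρ y
  OuterEdge x y = ¬ Inner x × Adj G x y ×
    ∃ λ r → First x r × r Fin.< y × Adj G r y × h ≤ between R? r y
  Edge x y = Inner y × (InnerEdge x y ⊎ OuterEdge x y)

  inner? : ∀ y → Dec (Inner y)
  inner? y = allClosed? R? ×-dec closed? R? y ×-dec FinP.any? (heavyChild? R? h y) ×-dec
    (FinP.all? λ ρ → FinP.all? λ ρ′ → heavyChild? R? h y ρ →-dec (heavyChild? R? h y ρ′ →-dec (ρ FinP.≟ ρ′))) ×-dec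
    (excess R? h y <? g)

  opaque
    edge? : ∀ x y → Dec (Edge x y)
    edge? x y = inner? y ×-dec
      ((inner? x ×-dec FinP.any? λ ρ → heavyChild? R? h x ρ ×-dec adj? G ρ y) ⊎-dec
       (¬? (inner? x) ×-dec adj? G x y ×-dec FinP.any? λ r →
          first? R? x r ×-dec (r FinP.<? y) ×-dec adj? G r y ×-dec (h ≤? between R? r y)))

  -- Both edges have the same witness, the unique heavy child of `x` or its first forward neighbour
  -- in `R`, and it sees `y` and `z`. Climbing from it ends in a heavy child of `y` that still sees
  -- `z`.
  edge-forward : ∀ {x y z} → x Fin.< y → y Fin.< z → Edge x y → Edge x z → Edge y z
  edge-forward x<y y<z (inner-y@(closed , closed-y , _) , inj₁ (inner-x , ρ , heavy , a))
               (inner-z@(_ , closed-z , _) , inj₁ (_ , ρ′ , heavy′ , a′)) with refl ← proj₁ (proj₂ (proj₂ (proj₂ inner-x))) ρ ρ′ heavy heavy′ =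
    let σ , child , deep , up = climb R? closed closed-y h (proj₂ heavy)
          (FinP.<-trans (proj₁ (proj₂ (proj₁ heavy))) x<y) a
    in inner-z , inj₁ (inner-y , σ , (child , deep-≤ (m≤m+n h _) deep) , up _ (<⇒≤ y<z) closed-z a′)
  edge-forward x<y y<z (inner-y@(closed , closed-y , _) , inj₂ (_ , _ , r , first , r<y , a , long))
               (inner-z@(_ , closed-z , _) , inj₂ (_ , _ , r′ , first′ , _ , a′ , _)) with refl ← first-unique first first′ =
    let σ , child , deep , up = climb R? closed closed-y 0 (proj₁ first) r<y a
    in inner-z , inj₁ (inner-y , σ , (child , deep-≤ long deep) , up _ (<⇒≤ y<z) closed-z a′)
  edge-forward _ _ (_ , inj₁ (inner , _)) (_ , inj₂ (¬inner , _)) = contradiction inner ¬inner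
  edge-forward _ _ (_ , inj₂ (¬inner , _)) (_ , inj₁ (inner , _)) = contradiction inner ¬inner

  opaque
    adjᴴ : Fin n → Fin n → Bool
    adjᴴ x y with FinP.<-cmp x y
    ... | tri< _ _ _ = does (edge? x y)
    ... | tri≈ _ _ _ = false
    ... | tri> _ _ _ = does (edge? y x)

    adj-< : ∀ {x y} → x Fin.< y → adjᴴ x y ≡ does (edge? x y)
    adj-< {x} {y} x<y with FinP.<-cmp x y
    ... | tri< _ _ _ = refl
    ... | tri≈ x≮y _ _ = contradiction x<y x≮y
    ... | tri> x≮y _ _ = contradiction x<y x≮y

    adj-sym : ∀ x y → adjᴴ x y ≡ adjᴴ y x
    adj-sym x y with FinP.<-cmp x y | FinP.<-cmp y x
    ... | tri< _ _ _ | tri> _ _ _ = refl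
    ... | tri≈ _ _ _ | tri≈ _ _ _ = refl
    ... | tri> _ _ _ | tri< _ _ _ = refl
    ... | tri< x<y _ _ | tri< _ _ x≮y = contradiction x<y x≮y
    ... | tri< x<y _ _ | tri≈ _ _ x≮y = contradiction x<y x≮y
    ... | tri≈ _ x≡y _ | tri< _ ¬e _ = contradiction (≡-sym x≡y) ¬e
    ... | tri≈ _ x≡y _ | tri> _ ¬e _ = contradiction (≡-sym x≡y) ¬e
    ... | tri> _ _ y<x | tri≈ y≮x _ _ = contradiction y<x y≮x
    ... | tri> _ _ y<x | tri> y≮x _ _ = contradiction y<x y≮x

    adj-irrefl : ∀ x → adjᴴ x x ≡ false
    adj-irrefl x with FinP.<-cmp x x
    ... | tri< _ ¬e _ = contradiction refl ¬e
    ... | tri≈ _ _ _ = refl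
    ... | tri> _ ¬e _ = contradiction refl ¬e

  rounded : OGraph n
  rounded = record { adj = adjᴴ ; sym = adj-sym ; irrefl = adj-irrefl }

  adj⇒edge : ∀ {x y} → x Fin.< y → adjᴴ x y ≡ true → Edge x y
  adj⇒edge {x} {y} x<y e with edge? x y | adj-< x<y
  ... | yes ed | _ = ed
  ... | no _ | e′ = contradiction (trans (≡-sym e) e′) λ ()

  edge⇒adj : ∀ {x y} → x Fin.< y → Edge x y → adjᴴ x y ≡ true
  edge⇒adj {x} {y} x<y ed with edge? x y | adj-< x<y
  ... | yes _ | e = e
  ... | no ¬ed | _ = contradiction ed ¬ed

  rounded-D-free : InducedFree D rounded
  rounded-D-free (f , order , edges) = contradiction (trans (≡-sym (edge⇒adj f1<f2
      (edge-forward f0<f1 f1<f2 (adj⇒edge f0<f1 (edges _ _)) (adj⇒edge (FinP.<-trans f0<f1 f1<f2) (edges _ _)))))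
      (edges (suc zero) (suc (suc zero)))) λ ()
    where
    f0<f1 = order zero (suc zero) (s≤s z≤n)
    f1<f2 = order (suc zero) (suc (suc zero)) (s≤s (s≤s z≤n))

-- Ranks and counting in the forest

ind-× : {P : Set ℓ} {Q : Set ℓ′} (p? : Dec P) (q? : Dec Q) → ind (p? ×-dec q?) ≡ ind p? * ind q?
ind-× (yes _) (yes _) = refl
ind-× (yes _) (no _)  = refl
ind-× (no _)  _       = refl

module _ {n} {P : Fin n → Set ℓ} (P? : ∀ i → Dec (P i)) where
  private
    before? : (y t : Fin n) → Dec (P t × t Fin.< y)
    before? y t = P? t ×-dec (t FinP.<? y)

  rank : Fin n → ℕ
  rank y = ∑ λ t → ind (before? y t)

  rank-< : ∀ {y y′} → P y → y Fin.< y′ → rank y <ⁿ rank y′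
  rank-< {y} {y′} p y<y′ = begin
    suc (rank y)                                        ≡⟨ +-comm 1 (rank y) ⟩
    rank y + 1                                          ≡⟨ cong (rank y +_) (≡-sym (ind-yes (y FinP.≟ y) refl)) ⟩
    rank y + ind (y FinP.≟ y)                           ≤⟨ +-monoʳ-≤ (rank y) (term≤∑ (λ t → ind (t FinP.≟ y)) y) ⟩
    rank y + ∑ (λ t → ind (t FinP.≟ y))                 ≡⟨ ≡-sym (∑-+ (λ t → ind (before? y t)) (λ t → ind (t FinP.≟ y))) ⟩
    ∑ (λ t → ind (before? y t) + ind (t FinP.≟ y))      ≤⟨ ∑-mono pointwise ⟩
    rank y′                                             ∎
    where
    open ≤-Reasoning
    pointwise : ∀ t → ind (before? y t) + ind (t FinP.≟ y) ≤ ind (before? y′ t)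
    pointwise t = case FinP.<-cmp t y of λ where
      (tri< lt _ _) → ≤-trans (≤-reflexive (trans (cong (ind (before? y t) +_) (ind-no (t FinP.≟ y) λ { refl → <-irrefl refl lt }))
        (+-identityʳ _))) (ind-mono (before? y t) (before? y′ t) λ (q , _) → q , FinP.<-trans lt y<y′)
      (tri≈ _ refl _) → ≤-trans (+-mono-≤ (≤-reflexive (ind-no (before? t t) λ (_ , lt) → <-irrefl refl lt)) (ind≤1 (t FinP.≟ t)))
        (≤-reflexive (≡-sym (ind-yes (before? y′ t) (p , y<y′))))
      (tri> _ _ gt) → ≤-trans (≤-reflexive (cong₂ _+_ (ind-no (before? y t) λ (_ , lt) → <-asym lt gt)
        (ind-no (t FinP.≟ y) λ { refl → <-irrefl refl gt }))) z≤n

  -- The rank is injective on the set, and only `h + 1` values are at most `h`.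
  rank-bound : ∀ h → ∑ (λ y → ind (P? y ×-dec (rank y ≤? h))) ≤ suc h
  rank-bound h = ∑-ind-fibres (λ y → P? y ×-dec (rank y ≤? h)) (λ y c → rank y ≟ toℕ c)
    (λ y (_ , r≤h) → Fin.fromℕ< (s≤s r≤h) , ≡-sym (FinP.toℕ-fromℕ< (s≤s r≤h)))
    λ {y} {y′} c (p , _) (p′ , _) e e′ → case FinP.<-cmp y y′ of λ where
      (tri< lt _ _) → contradiction (trans e (≡-sym e′)) (<⇒≢ (rank-< p lt))
      (tri≈ _ eq _) → eq
      (tri> _ _ gt) → contradiction (trans e′ (≡-sym e)) (<⇒≢ (rank-< p′ gt))

module ForestCounting {n} (G : OGraph n) (R : Fin n → Set) (R? : ∀ v → Dec (R v)) where

  open Forest G R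

  size : ℕ
  size = ∑ λ v → ind (R? v)

  -- The height of t, capped at h.
  weight : ℕ → Fin n → ℕ
  weight zero    t = 0
  weight (suc h) t = weight h t + ind (deep? R? h t)

  weight≤ : ∀ h t → weight h t ≤ h
  weight≤ zero    t = z≤n
  weight≤ (suc h) t = ≤-trans (+-mono-≤ (weight≤ h t) (ind≤1 (deep? R? h t))) (≤-reflexive (+-comm h 1))

  weight-deep : ∀ h {t} → Deep h t → weight h t ≡ h
  weight-deep zero    d = refl
  weight-deep (suc h) d = trans (cong₂ _+_ (weight-deep h (deep-≤ (n≤1+n h) d)) (ind-yes (deep? R? h _) (deep-≤ (n≤1+n h) d)))
    (+-comm h 1)

  weight-outside : ∀ h {t} → ¬ R t → weight h t ≡ 0
  weight-outside zero    ¬r = refl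
  weight-outside (suc h) ¬r = cong₂ _+_ (weight-outside h ¬r) (ind-no (deep? R? h _) (¬r ∘ deep⇒R h))

  children : ℕ → Fin n → ℕ
  children h t = ∑ λ c → ind (child? R? t c) * weight h c

  -- A path of length j + 1 below `t` passes through a child that has a path of length j below it;
  -- this is summed over j.
  weight-suc : ∀ h t → weight (suc h) t ≤ 1 + children h t
  weight-suc zero    t = ≤-trans (ind≤1 (deep? R? 0 t)) (s≤s z≤n)
  weight-suc (suc h) t = begin
    weight (suc h) t + ind (deep? R? (suc h) t)
      ≤⟨ +-mono-≤ (weight-suc h t) (≤-trans
           (ind-≤∑ (deep? R? (suc h) t) (λ c → child? R? t c ×-dec deep? R? h c) proj₂)
           (≤-reflexive (∑-cong λ c → ind-× (child? R? t c) (deep? R? h c)))) ⟩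
    1 + children h t + ∑ (λ c → ind (child? R? t c) * ind (deep? R? h c))
      ≡⟨ cong suc (≡-sym (∑-+ (λ c → ind (child? R? t c) * weight h c) _)) ⟩
    1 + ∑ (λ c → ind (child? R? t c) * weight h c + ind (child? R? t c) * ind (deep? R? h c))
      ≡⟨ cong suc (∑-cong λ c → ≡-sym (*-distribˡ-+ (ind (child? R? t c)) (weight h c) _)) ⟩
    1 + children (suc h) t ∎
    where open ≤-Reasoning

  weight-children : ∀ h t → weight h t ≤ 1 + children h t
  weight-children zero    t = z≤n
  weight-children (suc h) t = ≤-trans (weight-suc h t)
    (s≤s (∑-mono λ c → *-monoʳ-≤ (ind (child? R? t c)) (m≤m+n (weight h c) _)))

  Branching : ℕ → Fin n → Set
  Branching h t = R t × ∃ λ ρ → ∃ λ ρ′ → ρ ≢ ρ′ × HeavyChild h t ρ × HeavyChild h t ρ′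

  branching? : ∀ h t → Dec (Branching h t)
  branching? h t = R? t ×-dec FinP.any? λ ρ → FinP.any? λ ρ′ →
    ¬? (ρ FinP.≟ ρ′) ×-dec heavyChild? R? h t ρ ×-dec heavyChild? R? h t ρ′

  branching-children : ∀ h {t} → Branching h t → h + h ≤ children h t
  branching-children h {t} (_ , ρ , ρ′ , ρ≢ρ′ , heavy , heavy′) = begin
    h + h                                                    ≡⟨ cong₂ _+_ (value heavy) (value heavy′) ⟩
    ind (child? R? t ρ) * weight h ρ + ind (child? R? t ρ′) * weight h ρ′
      ≤⟨ two-terms≤∑ (λ c → ind (child? R? t c) * weight h c) ρ≢ρ′ ⟩
    children h t                                             ∎
    where
    open ≤-Reasoning
    value : ∀ {ρ} → HeavyChild h t ρ → h ≡ ind (child? R? t ρ) * weight h ρ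
    value {ρ} (child , d) = ≡-sym (trans (cong₂ _*_ (ind-yes (child? R? t ρ) child) (weight-deep h d)) (*-identityˡ h))

  -- Two heavy children carry twice the largest weight a vertex can have, so the total weight pays for h.
  branching-bound : ∀ h → h * ∑ (λ t → ind (branching? h t)) ≤ size
  branching-bound h = +-cancelʳ-≤ (∑ (weight h)) _ _ (begin
    h * ∑ (λ t → ind (branching? h t)) + ∑ (weight h)
      ≡⟨ cong (_+ ∑ (weight h)) (≡-sym (∑-*ˡ h (λ t → ind (branching? h t)))) ⟩
    ∑ (λ t → h * ind (branching? h t)) + ∑ (weight h)
      ≡⟨ ≡-sym (∑-+ (λ t → h * ind (branching? h t)) (weight h)) ⟩
    ∑ (λ t → h * ind (branching? h t) + weight h t)
      ≤⟨ ∑-mono pointwise ⟩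
    ∑ (λ t → ind (R? t) + ind (R? t) * children h t)
      ≡⟨ ∑-+ (λ t → ind (R? t)) (λ t → ind (R? t) * children h t) ⟩
    size + ∑ (λ t → ind (R? t) * children h t)
      ≡⟨ cong (size +_) (∑-cong λ t → ≡-sym (∑-*ˡ (ind (R? t)) (λ c → ind (child? R? t c) * weight h c))) ⟩
    size + ∑ (λ t → ∑ λ c → ind (R? t) * (ind (child? R? t c) * weight h c))
      ≡⟨ cong (size +_) (∑-comm λ t c → ind (R? t) * (ind (child? R? t c) * weight h c)) ⟩
    size + ∑ (λ c → ∑ λ t → ind (R? t) * (ind (child? R? t c) * weight h c))
      ≤⟨ +-monoʳ-≤ size (∑-mono parent) ⟩
    size + ∑ (weight h) ∎)
    where
    open ≤-Reasoning
    -- At a branching vertex the children carry `h + h`, which covers the extra `h` and the own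
    -- weight; at any other vertex of `R` the recursion for weights suffices.
    pointwise : ∀ t → h * ind (branching? h t) + weight h t ≤ ind (R? t) + ind (R? t) * children h t
    pointwise t = split (R? t) (branching? h t)
      where
      split : (r? : Dec (R t)) (b? : Dec (Branching h t)) →
              h * ind b? + weight h t ≤ ind r? + ind r? * children h t
      split (no ¬r) (yes b) = contradiction (proj₁ b) ¬r
      split (no ¬r) (no _)  = ≤-reflexive (cong₂ _+_ (*-zeroʳ h) (weight-outside h ¬r))
      split (yes _) (no _)  = ≤-trans (≤-reflexive (cong (_+ weight h t) (*-zeroʳ h)))
        (≤-trans (weight-children h t) (s≤s (≤-reflexive (≡-sym (+-identityʳ _)))))
      split (yes _) (yes b) = ≤-trans (+-mono-≤ (≤-reflexive (*-identityʳ h)) (weight≤ h t))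
        (≤-trans (branching-children h b) (≤-trans (≤-reflexive (≡-sym (+-identityʳ _))) (n≤1+n _)))
    -- A vertex has at most one parent in `R`, so the double sum is at most the total weight, which
    -- then cancels.
    parent : ∀ c → ∑ (λ t → ind (R? t) * (ind (child? R? t c) * weight h c)) ≤ weight h c
    parent c = begin
      ∑ (λ t → ind (R? t) * (ind (child? R? t c) * weight h c))
        ≤⟨ ∑-mono (λ t → ≤-trans (≤-reflexive (lemma (ind (R? t)) (ind (child? R? t c)) (weight h c)))
             (≤-reflexive (cong (weight h c *_) (≡-sym (ind-× (R? t) (child? R? t c)))))) ⟩
      ∑ (λ t → weight h c * ind (R? t ×-dec child? R? t c))
        ≡⟨ ∑-*ˡ (weight h c) (λ t → ind (R? t ×-dec child? R? t c)) ⟩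
      weight h c * ∑ (λ t → ind (R? t ×-dec child? R? t c))
        ≤⟨ *-monoʳ-≤ (weight h c) (∑-ind-unique (λ t → R? t ×-dec child? R? t c)
             λ t t′ (r , ch) (r′ , ch′) → parent-unique r r′ ch ch′) ⟩
      weight h c * 1 ≡⟨ *-identityʳ (weight h c) ⟩
      weight h c ∎
      where
      lemma : ∀ a b w → a * (b * w) ≡ w * (a * b)
      lemma = solve-∀

  -- By climbing, an earlier member of P has an ancestor that is a heavy child of a later one, so that the
  -- Excess sets of the members are disjoint.
  excess-bound : ∀ h g {P : Fin n → Set} (P? : ∀ y → Dec (P y)) → AllClosed →
    (∀ {y} → P y → R y × ∃ (HeavyChild h y) × g ≤ excess R? h y) →
    (∀ {y y′} → P y → P y′ → y Fin.< y′ → Adj G y y′) →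
    g * ∑ (λ y → ind (P? y)) ≤ size
  excess-bound h g {P} P? closed members clique = begin
    g * ∑ (λ y → ind (P? y))                              ≡⟨ ≡-sym (∑-*ˡ g (λ y → ind (P? y))) ⟩
    ∑ (λ y → g * ind (P? y))                              ≤⟨ ∑-mono rows ⟩
    ∑ (λ y → ∑ λ z → ind (P? y ×-dec excess? R? h y z))   ≡⟨ ∑-comm (λ y z → ind (P? y ×-dec excess? R? h y z)) ⟩
    ∑ (λ z → ∑ λ y → ind (P? y ×-dec excess? R? h y z))   ≤⟨ ∑-mono columns ⟩
    size                                                  ∎
    where
    open ≤-Reasoning
    rows : ∀ y → g * ind (P? y) ≤ ∑ (λ z → ind (P? y ×-dec excess? R? h y z))
    rows y = row (P? y)
      where
      row : (p? : Dec (P y)) → g * ind p? ≤ ∑ (λ z → ind (P? y ×-dec excess? R? h y z))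
      row (no _)  = ≤-trans (≤-reflexive (*-zeroʳ g)) z≤n
      row (yes p) = ≤-trans (≤-reflexive (*-identityʳ g)) (≤-trans (proj₂ (proj₂ (members p)))
        (≤-trans (≤-reflexive (excess-def R? h y))
          (∑-mono λ z → ind-mono (excess? R? h y z) (P? y ×-dec excess? R? h y z) (p ,_))))
    disjoint : ∀ {y y′ z} → P y → P y′ → y Fin.< y′ → Excess h y z → Excess h y′ z → ⊥
    disjoint {y} {y′} p p′ y<y′ (R-z , _ , a , _) (_ , y′<z , _ , none) =
      let R-y , (c , child , d) , _ = members p
          R-y′ , _ = members p′
          -- Having a child of depth `h`, `y` has depth `h + 1`; so the ancestor `σ` is a heavy
          -- child of `y′`, and it sees `z`, against the excess of `y′`.
          σ , child′ , deep , up = climb R? closed (closed y′ R-y′) (suc h) (R-y , c , child , d) y<y′ (clique p p′ y<y′)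
      in none σ (child′ , deep-≤ (≤-trans (n≤1+n h) (m≤m+n (suc h) _)) deep) (up _ (<⇒≤ y′<z) (closed _ R-z) a)
    columns : ∀ z → ∑ (λ y → ind (P? y ×-dec excess? R? h y z)) ≤ ind (R? z)
    columns z = column (R? z)
      where
      column : (r? : Dec (R z)) → ∑ (λ y → ind (P? y ×-dec excess? R? h y z)) ≤ ind r?
      column (no ¬r) = ≤-reflexive (∑-zero λ y → ind-no (P? y ×-dec excess? R? h y z) λ (_ , r , _) → ¬r r)
      column (yes _) = ∑-ind-unique (λ y → P? y ×-dec excess? R? h y z) λ y y′ (p , e) (p′ , e′) →
        case FinP.<-cmp y y′ of λ where
          (tri< lt _ _) → ⊥-elim (disjoint p p′ lt e e′)
          (tri≈ _ eq _) → eq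
          (tri> _ _ gt) → ⊥-elim (disjoint p′ p gt e′ e)

1≤ind-four : {P Q R S : Set ℓ} (p? : Dec P) (q? : Dec Q) (r? : Dec R) (s? : Dec S) →
  P ⊎ Q ⊎ R ⊎ S → 1 ≤ ind p? + ind q? + ind r? + ind s?
1≤ind-four p? q? r? s? (inj₁ p) =
  ≤-trans (≤-trans (≤-trans (1≤ind p? p) (m≤m+n (ind p?) (ind q?))) (m≤m+n _ (ind r?))) (m≤m+n _ (ind s?))
1≤ind-four p? q? r? s? (inj₂ (inj₁ q)) =
  ≤-trans (≤-trans (≤-trans (1≤ind q? q) (m≤n+m (ind q?) (ind p?))) (m≤m+n _ (ind r?))) (m≤m+n _ (ind s?))
1≤ind-four p? q? r? s? (inj₂ (inj₂ (inj₁ r))) =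
  ≤-trans (≤-trans (1≤ind r? r) (m≤n+m (ind r?) (ind p? + ind q?))) (m≤m+n _ (ind s?))
1≤ind-four p? q? r? s? (inj₂ (inj₂ (inj₂ s))) = ≤-trans (1≤ind s? s) (m≤n+m (ind s?) (ind p? + ind q? + ind r?))

-- Predicting one pair of a `D`-free set from its other vertices

module LeaveTwoOut {n} (G : OGraph n) (Q : Fin n → Set) (Q? : ∀ v → Dec (Q v))
  (free : ∀ {x y z} → Q x → Q y → Q z → x Fin.< y → y Fin.< z → Adj G x y → Adj G x z → Adj G y z)
  (s : ℕ) .{{_ : NonZero s}} (size≤ : ∑ (λ v → ind (Q? v)) ≤ s * s) (x : Fin n) (Q-x : Q x) where

  -- `R` will be `Q` without `x` and `y`. It agrees with `Q′` except at `y`, and with `Q` below `x`.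
  -- Stating the conditions on `y` in `Q′` and those on `x` in `Q` makes the sets independent of the
  -- pair left out, so that they can be counted over all `y`.
  Q′ : Fin n → Set
  Q′ v = Q v × v ≢ x

  Q′? : ∀ v → Dec (Q′ v)
  Q′? v = Q? v ×-dec ¬? (v FinP.≟ x)

  private
    module 𝓠 = Forest G Q
    module 𝓠′ = Forest G Q′
    open ForestCounting G Q′ Q′? using (Branching; branching?; branching-bound; excess-bound; size)

  -- The ways to miss an edge `x y`: too few neighbours of `x` precede `y` for a long climb; `y` has
  -- two heavy children; `y` has large excess; or `x` is inner and its heavy child does not see `y`.
  Next Early Branch Outgrown Missed : Fin n → Set
  Next y = Q y × x Fin.< y × Adj G x y

  next? : ∀ y → Dec (Next y)
  next? y = Q? y ×-dec (x FinP.<? y) ×-dec adj? G x y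

  Early y = Next y × rank next? y ≤ s
  Branch y = Branching s y
  Outgrown y = Next y × ∃ (𝓠′.HeavyChild s y) × s ≤ 𝓠′.excess Q′? s y
  Missed y = 𝓠.Excess s x y × 𝓠.excess Q? s x ≤ s

  early? : ∀ y → Dec (Early y)
  early? y = next? y ×-dec (rank next? y ≤? s)

  outgrown? : ∀ y → Dec (Outgrown y)
  outgrown? y = next? y ×-dec FinP.any? (𝓠′.heavyChild? Q′? s y) ×-dec (s ≤? 𝓠′.excess Q′? s y)

  missed? : ∀ y → Dec (Missed y)
  missed? y = 𝓠.excess? Q? s x y ×-dec (𝓠.excess Q? s x ≤? s)

  blame : Fin n → ℕ
  blame y = ind (early? y) + ind (branching? s y) + ind (outgrown? y) + ind (missed? y)

  size′≤ : size ≤ s * s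
  size′≤ = ≤-trans (∑-mono λ v → ind-mono (Q′? v) (Q? v) proj₁) size≤

  -- There are `s + 1` ranks up to `s`. The two forest bounds give at most `size / s` each, hence
  -- the requirement that `Q` have at most `s * s` elements. The last set is empty unless the excess
  -- of `x` is at most `s`.
  total-blame : ∑ blame ≤ suc s + s + s + s
  total-blame = begin
    ∑ blame
      ≡⟨ trans (∑-+ (λ y → ind (early? y) + ind (branching? s y) + ind (outgrown? y)) (λ y → ind (missed? y)))
           (cong (_+ ∑ (λ y → ind (missed? y)))
             (trans (∑-+ (λ y → ind (early? y) + ind (branching? s y)) (λ y → ind (outgrown? y)))
               (cong (_+ ∑ (λ y → ind (outgrown? y))) (∑-+ (λ y → ind (early? y)) (λ y → ind (branching? s y)))))) ⟩
    ∑ (λ y → ind (early? y)) + ∑ (λ y → ind (branching? s y)) + ∑ (λ y → ind (outgrown? y)) + ∑ (λ y → ind (missed? y))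
      ≤⟨ +-mono-≤ (+-mono-≤ (+-mono-≤ (rank-bound next? s)
           (*-cancelˡ-≤ s (≤-trans (branching-bound s) size′≤))) (*-cancelˡ-≤ s (≤-trans outgrown-bound size′≤))) missed-bound ⟩
    suc s + s + s + s ∎
    where
    open ≤-Reasoning
    outgrown-bound : s * ∑ (λ y → ind (outgrown? y)) ≤ size
    outgrown-bound = excess-bound s s outgrown?
      (λ z (Q-z , _) r r′ (Q-r , _) (Q-r′ , _) r<r′ r′<z a b → free Q-r Q-r′ Q-z r<r′ r′<z a b)
      (λ ((Q-y , x<y , _) , heavy , many) → (Q-y , λ { refl → <-irrefl refl x<y }) , heavy , many)
      -- The forward neighbours of `x` in the `D`-free set `Q` form a clique.
      λ ((Q-y , x<y , a) , _) ((Q-y′ , _ , a′) , _) y<y′ → free Q-x Q-y Q-y′ x<y y<y′ a a′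
    missed-bound : ∑ (λ y → ind (missed? y)) ≤ s
    missed-bound = case 𝓠.excess Q? s x ≤? s of λ where
      (yes few) → ≤-trans (∑-mono λ y → ind-mono (missed? y) (𝓠.excess? Q? s x y) proj₁)
                      (≤-trans (≤-reflexive (≡-sym (𝓠.excess-def Q? s x))) few)
      (no many) → ≤-trans (≤-reflexive (∑-zero λ y → ind-no (missed? y) (many ∘ proj₂))) z≤n

  module _ (R : Fin n → Set) (R? : ∀ v → Dec (R v)) (y : Fin n) (Q-y : Q y) (x<y : x Fin.< y)
    (R⇒ : ∀ {v} → R v → Q v × v ≢ x × v ≢ y) (⇒R : ∀ {v} → Q v → v ≢ x → v ≢ y → R v) where

    private
      module 𝓡 = Forest G R
    open Rounding G R R? s s

    closed : ∀ {z} → Q z → 𝓡.Closed z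
    closed Q-z r r′ R-r R-r′ r<r′ r′<z a b = free (proj₁ (R⇒ R-r)) (proj₁ (R⇒ R-r′)) Q-z r<r′ r′<z a b

    allClosed : 𝓡.AllClosed
    allClosed z R-z = closed (proj₁ (R⇒ R-z))

    R⇒Q′ : ∀ {v} → R v → Q′ v
    R⇒Q′ R-v = let Q-v , v≢x , _ = R⇒ R-v in Q-v , v≢x

    Q′⇒R : ∀ {v} → v ≢ y → Q′ v → R v
    Q′⇒R v≢y (Q-v , v≢x) = ⇒R Q-v v≢x v≢y

    <⇒≢′ : ∀ {u w : Fin n} → u Fin.< w → u ≢ w
    <⇒≢′ u<w refl = <-irrefl refl u<w

    heavy-y⇒ : ∀ {ρ} → 𝓡.HeavyChild s y ρ → 𝓠′.HeavyChild s y ρ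
    heavy-y⇒ = heavyChild-transfer G (λ v _ → R⇒Q′) (λ v v<y → Q′⇒R (<⇒≢′ v<y)) s

    heavy-y⇐ : ∀ {ρ} → 𝓠′.HeavyChild s y ρ → 𝓡.HeavyChild s y ρ
    heavy-y⇐ = heavyChild-transfer G (λ v v<y → Q′⇒R (<⇒≢′ v<y)) (λ v _ → R⇒Q′) s

    to-x : ∀ v → v Fin.< x → Q v → R v
    to-x v v<x Q-v = ⇒R Q-v (<⇒≢′ v<x) (<⇒≢′ (FinP.<-trans v<x x<y))

    heavy-x⇒ : ∀ {ρ} → 𝓡.HeavyChild s x ρ → 𝓠.HeavyChild s x ρ
    heavy-x⇒ = heavyChild-transfer G (λ v _ R-v → proj₁ (R⇒ R-v)) to-x s

    heavy-x⇐ : ∀ {ρ} → 𝓠.HeavyChild s x ρ → 𝓡.HeavyChild s x ρ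
    heavy-x⇐ = heavyChild-transfer G to-x (λ v _ R-v → proj₁ (R⇒ R-v)) s

    -- Errors are one-sided: a child `ρ` of `x` that sees `y` forces the edge `x y`, as `Q` spans no
    -- `D`; outer edges are edges of `G` by definition.
    edge⇒adj-G : Edge x y → Adj G x y
    edge⇒adj-G (_ , inj₁ (_ , ρ , ((R-ρ , ρ<x , a , _) , _) , b)) = free (proj₁ (R⇒ R-ρ)) Q-x Q-y ρ<x x<y a b
    edge⇒adj-G (_ , inj₂ (_ , a , _)) = a

    module _ (a : Adj G x y) (¬early : ¬ Early y) where

      -- The neighbours of `x` between its first forward neighbour `r` and `y` are neighbours of `r`
      -- too. As `y` is not early, at least `s + 1` forward neighbours of `x` precede it, and `s`
      -- remain without `r`.
      first : ∃ λ r → Next r × r Fin.< y × 𝓡.First x r × s ≤ 𝓡.between R? r y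
      first with least next?
      ... | inj₂ none = contradiction (Q-y , x<y , a) (none y)
      ... | inj₁ (r , next@(Q-r , x<r , b) , min) = r , next , r<y ,
          (⇒R Q-r (<⇒≢′ x<r ∘ ≡-sym) (<⇒≢′ r<y) , x<r , b ,
            λ t x<t t<r R-t c → min t t<r (proj₁ (R⇒ R-t) , x<t , c)) ,
          ≤-pred (≤-trans many count)
        where
        open ≤-Reasoning
        many : suc s ≤ rank next? y
        many = ≰⇒> λ few → ¬early ((Q-y , x<y , a) , few)
        r<y : r Fin.< y
        r<y = let t , nt , t<y = ∑-ind-exists (λ t → next? t ×-dec (t FinP.<? y)) (≤-trans (s≤s z≤n) many)
              in ≤-<-trans (≮⇒≥ λ t<r → min t t<r nt) t<y
        pointwise : ∀ t → ind (next? t ×-dec (t FinP.<? y)) ≤ ind (t FinP.≟ r) + ind (𝓡.between? R? r y t)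
        pointwise t = ind-≤ (next? t ×-dec (t FinP.<? y)) λ (nt@(Q-t , x<t , c) , t<y) → case FinP.<-cmp t r of λ where
          (tri< lt _ _) → contradiction nt (min t lt)
          (tri≈ _ e _) → ≤-trans (≤-reflexive (≡-sym (ind-yes (t FinP.≟ r) e))) (m≤m+n _ _)
          (tri> _ _ gt) → ≤-trans (≤-reflexive (≡-sym (ind-yes (𝓡.between? R? r y t)
            (⇒R Q-t (<⇒≢′ x<t ∘ ≡-sym) (<⇒≢′ t<y) , gt , t<y , free Q-x Q-r Q-t x<r gt b c)))) (m≤n+m _ _)
        count : rank next? y ≤ suc (𝓡.between R? r y)
        count = begin
          rank next? y                                                   ≤⟨ ∑-mono pointwise ⟩
          ∑ (λ t → ind (t FinP.≟ r) + ind (𝓡.between? R? r y t))         ≡⟨ ∑-+ (λ t → ind (t FinP.≟ r)) _ ⟩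
          ∑ (λ t → ind (t FinP.≟ r)) + ∑ (λ t → ind (𝓡.between? R? r y t))
            ≤⟨ +-mono-≤ (∑-ind-unique (λ t → t FinP.≟ r) λ _ _ e e′ → trans e (≡-sym e′))
                 (≤-reflexive (≡-sym (𝓡.between-def R? r y))) ⟩
          suc (𝓡.between R? r y) ∎

      r = proj₁ first

      Adj-r-y : Adj G r y
      Adj-r-y = let _ , (Q-r , x<r , b) , r<y , _ = first in free Q-x Q-r Q-y x<r r<y b a

      heavy-child : ∃ (𝓡.HeavyChild s y)
      heavy-child = let _ , _ , r<y , first-r , long = first
                        ρ , child , deep , _ = 𝓡.climb R? allClosed (closed Q-y) 0 (proj₁ first-r) r<y Adj-r-y
                    in ρ , child , 𝓡.deep-≤ long deep

      inner-y : ¬ Branch y → ¬ Outgrown y → Inner y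
      inner-y ¬branch ¬outgrown = allClosed , closed Q-y , heavy-child , unique ,
        ≤-<-trans excess≤ (≰⇒> λ many → ¬outgrown
          ((Q-y , x<y , a) , (proj₁ heavy-child , heavy-y⇒ (proj₂ heavy-child)) , many))
        where
        unique : ∀ ρ ρ′ → 𝓡.HeavyChild s y ρ → 𝓡.HeavyChild s y ρ′ → ρ ≡ ρ′
        unique ρ ρ′ heavy heavy′ with ρ FinP.≟ ρ′
        ... | yes e = e
        ... | no ρ≢ρ′ = contradiction ((Q-y , <⇒≢′ x<y ∘ ≡-sym) , ρ , ρ′ , ρ≢ρ′ , heavy-y⇒ heavy , heavy-y⇒ heavy′) ¬branch
        excess≤ : 𝓡.excess R? s y ≤ 𝓠′.excess Q′? s y
        excess≤ = subst₂ _≤_ (≡-sym (𝓡.excess-def R? s y)) (≡-sym (𝓠′.excess-def Q′? s y))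
          (∑-mono λ z → ind-mono (𝓡.excess? R? s y z) (𝓠′.excess? Q′? s y z)
            λ (R-z , y<z , c , none) → R⇒Q′ R-z , y<z , c , λ ρ → none ρ ∘ heavy-y⇐)

      -- Passing from `R` to `Q` adds at most `y` to the excess of `x`; so the strict bound in
      -- `Inner` becomes the weak one in `Missed`.
      missed : ¬ Edge x y → Inner y → Inner x → Missed y
      missed ¬edge inner-y inner-x@(_ , _ , _ , _ , few) =
        (Q-y , x<y , a , λ ρ heavy b → ¬edge (inner-y , inj₁ (inner-x , ρ , heavy-x⇐ heavy , b))) ,
        ≤-trans excess≤ few
        where
        open ≤-Reasoning
        pointwise : ∀ z → ind (𝓠.excess? Q? s x z) ≤ ind (z FinP.≟ y) + ind (𝓡.excess? R? s x z)
        pointwise z = ind-≤ (𝓠.excess? Q? s x z) λ (Q-z , x<z , b , none) → case z FinP.≟ y of λ where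
          (yes e) → ≤-trans (≤-reflexive (≡-sym (ind-yes (z FinP.≟ y) e))) (m≤m+n _ _)
          (no z≢y) → ≤-trans (≤-reflexive (≡-sym (ind-yes (𝓡.excess? R? s x z)
            (⇒R Q-z (<⇒≢′ x<z ∘ ≡-sym) z≢y , x<z , b , λ ρ → none ρ ∘ heavy-x⇒)))) (m≤n+m _ _)
        excess≤ : 𝓠.excess Q? s x ≤ suc (𝓡.excess R? s x)
        excess≤ = begin
          𝓠.excess Q? s x                                          ≡⟨ 𝓠.excess-def Q? s x ⟩
          ∑ (λ z → ind (𝓠.excess? Q? s x z))                       ≤⟨ ∑-mono pointwise ⟩
          ∑ (λ z → ind (z FinP.≟ y) + ind (𝓡.excess? R? s x z))    ≡⟨ ∑-+ (λ z → ind (z FinP.≟ y)) _ ⟩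
          ∑ (λ z → ind (z FinP.≟ y)) + ∑ (λ z → ind (𝓡.excess? R? s x z))
            ≤⟨ +-mono-≤ (∑-ind-unique (λ z → z FinP.≟ y) λ _ _ e e′ → trans e (≡-sym e′))
                 (≤-reflexive (≡-sym (𝓡.excess-def R? s x))) ⟩
          suc (𝓡.excess R? s x) ∎

      cause : ¬ Edge x y → Branch y ⊎ Outgrown y ⊎ Missed y
      cause ¬edge = case branching? s y of λ where
        (yes branch) → inj₁ branch
        (no ¬branch) → case outgrown? y of λ where
          (yes outgrown) → inj₂ (inj₁ outgrown)
          (no ¬outgrown) → let inner = inner-y ¬branch ¬outgrown in case inner? x of λ where
            (yes inner-x) → inj₂ (inj₂ (missed ¬edge inner inner-x))
            (no ¬inner-x) → let _ , _ , r<y , first-r , long = first in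
              ⊥-elim (¬edge (inner , inj₂ (¬inner-x , a , r , first-r , r<y , Adj-r-y , long)))

    differ⇒cause : adj G x y ≢ adj rounded x y → Early y ⊎ Branch y ⊎ Outgrown y ⊎ Missed y
    differ⇒cause differs = case edge? x y of λ where
      (yes edge) → contradiction (trans (edge⇒adj-G edge) (≡-sym (edge⇒adj x<y edge))) differs
      (no ¬edge) → case adj? G x y of λ where
        (yes a) → case early? y of λ where
          (yes early) → inj₁ early
          (no ¬early) → inj₂ (cause a ¬early ¬edge)
        (no ¬a) → contradiction (trans (BoolP.¬-not ¬a) (≡-sym (BoolP.¬-not (¬edge ∘ adj⇒edge x<y)))) differs

    differ⇒blame : adj G x y ≢ adj rounded x y → 1 ≤ blame y
    differ⇒blame differs = 1≤ind-four (early? y) (branching? s y) (outgrown? y) (missed? y) (differ⇒cause differs)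

-- Averaging over random tuples

∑-injection : (f : Fin m → Fin n) → (∀ {i j} → f i ≡ f j → i ≡ j) → (g : Fin n → ℕ) → ∑ (g ∘ f) ≤ ∑ g
∑-injection {m} {n} f injective g = begin
  ∑ (λ i → g (f i))                          ≤⟨ ∑-mono at ⟩
  ∑ (λ i → ∑ λ y → g y * ind (f i FinP.≟ y)) ≡⟨ ∑-comm (λ i y → g y * ind (f i FinP.≟ y)) ⟩
  ∑ (λ y → ∑ λ i → g y * ind (f i FinP.≟ y)) ≡⟨ ∑-cong (λ y → ∑-*ˡ (g y) (λ i → ind (f i FinP.≟ y))) ⟩
  ∑ (λ y → g y * ∑ λ i → ind (f i FinP.≟ y)) ≤⟨ ∑-mono (λ y → ≤-trans (*-monoʳ-≤ (g y)
                                                  (∑-ind-unique (λ i → f i FinP.≟ y) λ _ _ e e′ → injective (trans e (≡-sym e′))))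
                                                  (≤-reflexive (*-identityʳ (g y)))) ⟩
  ∑ g ∎
  where
  open ≤-Reasoning
  at : ∀ i → g (f i) ≤ ∑ λ y → g y * ind (f i FinP.≟ y)
  at i = ≤-trans (≤-reflexive (≡-sym (trans (cong (g (f i) *_) (ind-yes (f i FinP.≟ f i) refl)) (*-identityʳ _))))
    (term≤∑ (λ y → g y * ind (f i FinP.≟ y)) (f i))

D-Pattern : OGraph n → Fin n → Fin n → Fin n → Set
D-Pattern G x y z = x Fin.< y × y Fin.< z × Adj G x y × Adj G x z × ¬ Adj G y z

D-pattern? : (G : OGraph n) → ∀ x y z → Dec (D-Pattern G x y z)
D-pattern? G x y z = (x FinP.<? y) ×-dec (y FinP.<? z) ×-dec adj? G x y ×-dec adj? G x z ×-dec ¬? (adj? G y z)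

D-pattern-distinct : (G : OGraph n) → ∀ {x y z} → D-Pattern G x y z → x ≢ y × x ≢ z × y ≢ z
D-pattern-distinct G (x<y , y<z , _) =
  (λ { refl → <-irrefl refl x<y }) , (λ { refl → <-asym x<y y<z }) , λ { refl → <-irrefl refl y<z }

D-count : OGraph n → ℕ
D-count G = ∑ λ x → ∑ λ y → ∑ λ z → ind (D-pattern? G x y z)

-- Sampling a tuple q, the graph rounded along all of its entries but two predicts the adjacency of
-- those two up to a small error as long as q has no repeated entry and spans no copy of D.
module Averaging {n′ : ℕ} (G : OGraph (suc n′)) (s : ℕ) .{{s≢0 : NonZero s}} where

  n₀ N₀ : ℕ
  n₀ = suc n′
  N₀ = s * s

  Tuple = Vec (Fin n₀) N₀

  Rest : Fin N₀ → Fin N₀ → Tuple → Fin n₀ → Set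
  Rest a b w v = ∃ λ c → c ≢ a × c ≢ b × lookup w c ≡ v

  rest? : ∀ a b w v → Dec (Rest a b w v)
  rest? a b w v = FinP.any? λ c → ¬? (c FinP.≟ a) ×-dec ¬? (c FinP.≟ b) ×-dec (lookup w c FinP.≟ v)

  -- Overwriting the two entries makes the prediction visibly independent of them; `zero` is a
  -- placeholder at positions that `Rest` skips.
  mask : Fin N₀ → Fin N₀ → Tuple → Tuple
  mask a b q = (q [ a ]≔ zero) [ b ]≔ zero

  prediction : Fin N₀ → Fin N₀ → Tuple → OGraph n₀
  prediction a b q = Rounding.rounded G (Rest a b (mask a b q)) (rest? a b (mask a b q)) s s

  error? : ∀ a b (q : Tuple) → Dec (Differ G (prediction a b q) (lookup q a) (lookup q b))
  error? a b q = differ? G (prediction a b q) (lookup q a) (lookup q b)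

  mask-resample : ∀ {a b} → a ≢ b → ∀ q x y → mask a b ((q [ a ]≔ x) [ b ]≔ y) ≡ mask a b q
  mask-resample {a} {b} a≢b q x y = begin
    (((q [ a ]≔ x) [ b ]≔ y) [ a ]≔ zero) [ b ]≔ zero
      ≡⟨ cong (_[ b ]≔ zero) (VecP.[]≔-commutes (q [ a ]≔ x) b a (a≢b ∘ ≡-sym)) ⟩
    (((q [ a ]≔ x) [ a ]≔ zero) [ b ]≔ y) [ b ]≔ zero
      ≡⟨ VecP.[]≔-idempotent ((q [ a ]≔ x) [ a ]≔ zero) b ⟩
    ((q [ a ]≔ x) [ a ]≔ zero) [ b ]≔ zero
      ≡⟨ cong (_[ b ]≔ zero) (VecP.[]≔-idempotent q a) ⟩
    mask a b q ∎
    where open ≡-Reasoning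

  lookup-mask : ∀ {a b c} → c ≢ a → c ≢ b → ∀ q → lookup (mask a b q) c ≡ lookup q c
  lookup-mask {a} {b} c≢a c≢b q =
    trans (VecP.lookup∘update′ c≢b (q [ a ]≔ zero) zero) (VecP.lookup∘update′ c≢a q zero)

  -- The prediction ignores entries `a` and `b`, so these can be redrawn: the probability of an
  -- error is the normalised distance from `G` to the prediction.
  expected-error : ∀ {a b} → a ≢ b →
    n₀ * (n₀ * ∑ᵀ N₀ (λ q → ind (error? a b q))) ≡ ∑ᵀ N₀ (λ q → dist G (prediction a b q))
  expected-error {a} {b} a≢b = begin
    n₀ * (n₀ * ∑ᵀ N₀ err)
      ≡⟨ cong (n₀ *_) (≡-sym (∑ᵀ-resample N₀ b err)) ⟩
    n₀ * ∑ᵀ N₀ (λ q → ∑ λ y → err (q [ b ]≔ y))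
      ≡⟨ ≡-sym (∑ᵀ-resample N₀ a (λ q → ∑ λ y → err (q [ b ]≔ y))) ⟩
    ∑ᵀ N₀ (λ q → ∑ λ x → ∑ λ y → err ((q [ a ]≔ x) [ b ]≔ y))
      ≡⟨ ∑ᵀ-cong N₀ (λ q → ∑-cong λ x → ∑-cong λ y → step q x y) ⟩
    ∑ᵀ N₀ (λ q → ∑ λ x → ∑ λ y → ind (differ? G (prediction a b q) x y))
      ≡⟨ ∑ᵀ-cong N₀ (λ q → ≡-sym (dist-∑ G (prediction a b q))) ⟩
    ∑ᵀ N₀ (λ q → dist G (prediction a b q)) ∎
    where
    open ≡-Reasoning
    err : Tuple → ℕ
    err q = ind (error? a b q)
    step : ∀ q x y → err ((q [ a ]≔ x) [ b ]≔ y) ≡ ind (differ? G (prediction a b q) x y)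
    step q x y = trans (cong₂ (λ u v → ind (differ? G (prediction a b ((q [ a ]≔ x) [ b ]≔ y)) u v))
        (trans (VecP.lookup∘update′ a≢b (q [ a ]≔ x) y) (VecP.lookup∘update a q x))
        (VecP.lookup∘update b (q [ a ]≔ x) y))
      (cong (λ w → ind (differ? G (Rounding.rounded G (Rest a b w) (rest? a b w) s s) x y)) (mask-resample a≢b q x y))

  errors : Tuple → ℕ
  errors q = ∑ λ a → ∑ λ b → ind (error? a b q)

  patterns : Tuple → ℕ
  patterns q = ∑ λ a → ∑ λ b → ∑ λ c → ind (D-pattern? G (lookup q a) (lookup q b) (lookup q c))

  collision? : ∀ (q : Tuple) a b → Dec (a ≢ b × lookup q a ≡ lookup q b)
  collision? q a b = ¬? (a FinP.≟ b) ×-dec (lookup q a FinP.≟ lookup q b)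

  collisions : Tuple → ℕ
  collisions q = ∑ λ a → ∑ λ b → ind (collision? q a b)

  bound : ℕ
  bound = suc s + s + s + s

  -- For fixed `a` all `b` are handled at once, since the blame depends only on the sample and on
  -- its entry `a`.
  good-errors : ∀ q → (∀ {a b} → lookup q a ≡ lookup q b → a ≡ b) →
    (∀ a b c → ¬ D-Pattern G (lookup q a) (lookup q b) (lookup q c)) → errors q ≤ N₀ * bound
  good-errors q injective D-free = ∑-bound λ a → let open At a in begin
    ∑ (λ b → ind (error? a b q))  ≤⟨ ∑-mono each ⟩
    ∑ (λ b → blame (lookup q b))  ≤⟨ ∑-injection (lookup q) injective blame ⟩
    ∑ blame                       ≤⟨ total-blame ⟩
    bound                         ∎
    where
    open ≤-Reasoning
    Image : Fin n₀ → Set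
    Image v = ∃ λ c → lookup q c ≡ v
    image? : ∀ v → Dec (Image v)
    image? v = FinP.any? λ c → lookup q c FinP.≟ v
    free : ∀ {x y z} → Image x → Image y → Image z → x Fin.< y → y Fin.< z → Adj G x y → Adj G x z → Adj G y z
    free {x} {y} {z} (a , refl) (b , refl) (c , refl) x<y y<z e e′ with adj? G y z
    ... | yes h = h
    ... | no ¬h = contradiction (x<y , y<z , e , e′ , ¬h) (D-free a b c)
    image-size : ∑ (λ v → ind (image? v)) ≤ N₀
    image-size = ∑-ind-fibres image? (λ v c → lookup q c FinP.≟ v) (λ v p → p) λ c _ _ e e′ → trans (≡-sym e) e′
    module At (a : Fin N₀) where
      module L = LeaveTwoOut G Image image? free s image-size (lookup q a) (a , refl)
      open L public using (blame; total-blame)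
      each : ∀ b → ind (error? a b q) ≤ blame (lookup q b)
      each b = ind-≤ (error? a b q) λ (x<y , differs) →
        L.differ⇒blame (Rest a b (mask a b q)) (rest? a b (mask a b q)) (lookup q b) (b , refl) x<y
          (λ { (c , c≢a , c≢b , refl) → (c , ≡-sym (lookup-mask c≢a c≢b q)) ,
               (λ e → c≢a (injective (trans (≡-sym (lookup-mask c≢a c≢b q)) e))) ,
               λ e → c≢b (injective (trans (≡-sym (lookup-mask c≢a c≢b q)) e)) })
          (λ { (c , refl) v≢x v≢y → let c≢a = λ e → v≢x (cong (lookup q) e)
                                        c≢b = λ e → v≢y (cong (lookup q) e)
                                    in c , c≢a , c≢b , lookup-mask c≢a c≢b q })
          differs

  errors≤N² : ∀ q → errors q ≤ N₀ * N₀
  errors≤N² q = ∑-bound λ a → ∑-ind≤n (λ b → error? a b q)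

  -- A tuple with a collision or a copy of `D` pays the trivial bound `N₀ * N₀` for each of them, so
  -- the inequality holds for every tuple and can be averaged.
  errors-bound : ∀ q → errors q ≤ N₀ * bound + (N₀ * N₀ * patterns q + N₀ * N₀ * collisions q)
  errors-bound q = case FinP.any? (λ a → FinP.any? (collision? q a)) of λ where
    (yes (a , b , coll)) → ≤-trans (errors≤N² q) (≤-trans (≤-reflexive (≡-sym (*-identityʳ (N₀ * N₀))))
      (≤-trans (*-monoʳ-≤ (N₀ * N₀) (≤-trans (1≤ind (collision? q a b) coll)
        (≤-trans (term≤∑ (λ b → ind (collision? q a b)) b) (term≤∑ (λ a → ∑ λ b → ind (collision? q a b)) a))))
        (≤-trans (m≤n+m _ (N₀ * N₀ * patterns q)) (m≤n+m _ (N₀ * bound)))))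
    (no distinct) → case FinP.any? (λ a → FinP.any? (λ b → FinP.any? (λ c →
        D-pattern? G (lookup q a) (lookup q b) (lookup q c)))) of λ where
      (yes (a , b , c , pat)) → ≤-trans (errors≤N² q) (≤-trans (≤-reflexive (≡-sym (*-identityʳ (N₀ * N₀))))
        (≤-trans (*-monoʳ-≤ (N₀ * N₀) (≤-trans (1≤ind (D-pattern? G (lookup q a) (lookup q b) (lookup q c)) pat)
          (≤-trans (term≤∑ (λ c → ind (D-pattern? G (lookup q a) (lookup q b) (lookup q c))) c)
          (≤-trans (term≤∑ (λ b → ∑ λ c → ind (D-pattern? G (lookup q a) (lookup q b) (lookup q c))) b)
            (term≤∑ (λ a → ∑ λ b → ∑ λ c → ind (D-pattern? G (lookup q a) (lookup q b) (lookup q c))) a)))))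
          (≤-trans (m≤m+n _ (N₀ * N₀ * collisions q)) (m≤n+m _ (N₀ * bound)))))
      (no D-free) → ≤-trans (good-errors q (λ {a} {b} e → case a FinP.≟ b of λ where
          (yes a≡b) → a≡b
          (no a≢b) → ⊥-elim (distinct (a , b , a≢b , e)))
        (λ a b c pat → D-free (a , b , c , pat))) (m≤m+n _ _)

  -- Given the other entries, only one value of entry `a` collides with entry `b`.
  expected-collisions : n₀ * ∑ᵀ N₀ collisions ≤ N₀ * (N₀ * n₀ ^ N₀)
  expected-collisions = begin
    n₀ * ∑ᵀ N₀ collisions
      ≡⟨ cong (n₀ *_) (trans (∑ᵀ-∑-comm N₀ (λ q a → ∑ λ b → ind (collision? q a b)))
           (∑-cong λ a → ∑ᵀ-∑-comm N₀ (λ q b → ind (collision? q a b)))) ⟩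
    n₀ * ∑ (λ a → ∑ λ b → ∑ᵀ N₀ (λ q → ind (collision? q a b)))
      ≡⟨ ≡-sym (trans (∑-cong λ a → ∑-*ˡ n₀ (λ b → ∑ᵀ N₀ (λ q → ind (collision? q a b))))
           (∑-*ˡ n₀ (λ a → ∑ λ b → ∑ᵀ N₀ (λ q → ind (collision? q a b))))) ⟩
    ∑ (λ a → ∑ λ b → n₀ * ∑ᵀ N₀ (λ q → ind (collision? q a b)))
      ≤⟨ ∑-bound (λ a → ∑-bound λ b → each a b) ⟩
    N₀ * (N₀ * n₀ ^ N₀) ∎
    where
    open ≤-Reasoning
    new : ∀ (q : Tuple) {a b} → a ≢ b → ∀ {x} → lookup (q [ a ]≔ x) a ≡ lookup (q [ a ]≔ x) b → x ≡ lookup q b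
    new q {a} {b} a≢b {x} e = trans (≡-sym (VecP.lookup∘update a q x)) (trans e (VecP.lookup∘update′ (a≢b ∘ ≡-sym) q x))
    each : ∀ a b → n₀ * ∑ᵀ N₀ (λ q → ind (collision? q a b)) ≤ n₀ ^ N₀
    each a b = case a FinP.≟ b of λ where
      (yes a≡b) → ≤-trans (≤-reflexive (trans (cong (n₀ *_) (trans (∑ᵀ-cong N₀ λ q →
        ind-no (collision? q a b) (λ (a≢b , _) → a≢b a≡b)) (trans (∑ᵀ-const {n₀} N₀ 0) (*-zeroʳ (n₀ ^ N₀))))) (*-zeroʳ n₀))) z≤n
      (no a≢b) → begin
        n₀ * ∑ᵀ N₀ (λ q → ind (collision? q a b))
          ≡⟨ ≡-sym (∑ᵀ-resample N₀ a (λ q → ind (collision? q a b))) ⟩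
        ∑ᵀ N₀ (λ q → ∑ λ x → ind (collision? (q [ a ]≔ x) a b))
          ≤⟨ ∑ᵀ-mono N₀ (λ q → ∑-ind-unique (λ x → collision? (q [ a ]≔ x) a b) λ x x′ (_ , e) (_ , e′) →
               trans (new q a≢b e) (≡-sym (new q a≢b e′))) ⟩
        ∑ᵀ {n₀} N₀ (λ q → 1) ≡⟨ trans (∑ᵀ-const {n₀} N₀ 1) (*-identityʳ (n₀ ^ N₀)) ⟩
        n₀ ^ N₀ ∎

  module _ (E : ℕ) (far : ∀ H → InducedFree D H → n₀ * n₀ ≤ E * dist G H) where

    T₀ : ℕ
    T₀ = n₀ ^ N₀

    far-on-average : ∀ {a b} → a ≢ b → T₀ ≤ E * ∑ᵀ N₀ (λ q → ind (error? a b q))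
    far-on-average {a} {b} a≢b = *-cancelʳ-≤ _ _ (n₀ * n₀) (begin
      T₀ * (n₀ * n₀)                                        ≡⟨ ≡-sym (∑ᵀ-const {n₀} N₀ (n₀ * n₀)) ⟩
      ∑ᵀ {n₀} N₀ (λ q → n₀ * n₀)                            ≤⟨ ∑ᵀ-mono N₀ (λ q → far (prediction a b q)
                                                                 (Rounding.rounded-D-free G (Rest a b (mask a b q)) (rest? a b (mask a b q)) s s)) ⟩
      ∑ᵀ N₀ (λ q → E * dist G (prediction a b q))           ≡⟨ ∑ᵀ-*ˡ N₀ E (λ q → dist G (prediction a b q)) ⟩
      E * ∑ᵀ N₀ (λ q → dist G (prediction a b q))           ≡⟨ cong (E *_) (≡-sym (expected-error a≢b)) ⟩
      E * (n₀ * (n₀ * ∑ᵀ N₀ (λ q → ind (error? a b q))))    ≡⟨ lemma E n₀ _ ⟩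
      E * ∑ᵀ N₀ (λ q → ind (error? a b q)) * (n₀ * n₀)      ∎)
      where
      open ≤-Reasoning
      lemma : ∀ e n x → e * (n * (n * x)) ≡ e * x * (n * n)
      lemma = solve-∀

    -- Each pair `a ≠ b` contributes at least `T₀ / E`; the term `N₀ * T₀` pays for the pairs with
    -- `a = b`.
    many-errors : N₀ * (N₀ * T₀) ≤ N₀ * T₀ + E * ∑ᵀ N₀ errors
    many-errors = begin
      N₀ * (N₀ * T₀)
        ≡⟨ ≡-sym (trans (∑-cong λ a → ∑-const N₀ T₀) (∑-const N₀ (N₀ * T₀))) ⟩
      ∑ {N₀} (λ a → ∑ {N₀} λ b → T₀)
        ≤⟨ ∑-mono (λ a → ∑-mono λ b → each a b) ⟩
      ∑ (λ a → ∑ λ b → T₀ * ind (b FinP.≟ a) + E * err a b)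
        ≡⟨ ∑-cong (λ a → ∑-+ (λ b → T₀ * ind (b FinP.≟ a)) (λ b → E * err a b)) ⟩
      ∑ (λ a → ∑ (λ b → T₀ * ind (b FinP.≟ a)) + ∑ (λ b → E * err a b))
        ≡⟨ ∑-+ (λ a → ∑ λ b → T₀ * ind (b FinP.≟ a)) (λ a → ∑ λ b → E * err a b) ⟩
      ∑ (λ a → ∑ λ b → T₀ * ind (b FinP.≟ a)) + ∑ (λ a → ∑ λ b → E * err a b)
        ≤⟨ +-mono-≤ (∑-bound λ a → ≤-trans (≤-reflexive (∑-*ˡ T₀ (λ b → ind (b FinP.≟ a))))
             (≤-trans (*-monoʳ-≤ T₀ (∑-ind-unique (λ b → b FinP.≟ a) λ _ _ e e′ → trans e (≡-sym e′)))
               (≤-reflexive (*-identityʳ T₀))))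
             (≤-reflexive (trans (∑-cong λ a → ∑-*ˡ E (err a)) (trans (∑-*ˡ E (λ a → ∑ (err a)))
               (cong (E *_) (≡-sym (trans (∑ᵀ-∑-comm N₀ (λ q a → ∑ λ b → ind (error? a b q)))
                 (∑-cong λ a → ∑ᵀ-∑-comm N₀ (λ q b → ind (error? a b q))))))))) ⟩
      N₀ * T₀ + E * ∑ᵀ N₀ errors ∎
      where
      open ≤-Reasoning
      err : Fin N₀ → Fin N₀ → ℕ
      err a b = ∑ᵀ N₀ (λ q → ind (error? a b q))
      each : ∀ a b → T₀ ≤ T₀ * ind (b FinP.≟ a) + E * err a b
      each a b = case b FinP.≟ a of λ where
        (yes e) → ≤-trans (≤-reflexive (≡-sym (trans (cong (T₀ *_) (ind-yes (b FinP.≟ a) e)) (*-identityʳ T₀)))) (m≤m+n _ _)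
        (no ¬e) → ≤-trans (far-on-average (¬e ∘ ≡-sym)) (m≤n+m _ _)

    few-errors : ∑ᵀ N₀ errors ≤ T₀ * (N₀ * bound) + (N₀ * N₀ * ∑ᵀ N₀ patterns + N₀ * N₀ * ∑ᵀ N₀ collisions)
    few-errors = ≤-trans (∑ᵀ-mono N₀ errors-bound) (≤-reflexive
      (trans (∑ᵀ-+ N₀ (λ q → N₀ * bound) (λ q → N₀ * N₀ * patterns q + N₀ * N₀ * collisions q))
        (cong₂ _+_ (∑ᵀ-const {n₀} N₀ (N₀ * bound))
          (trans (∑ᵀ-+ N₀ (λ q → N₀ * N₀ * patterns q) (λ q → N₀ * N₀ * collisions q))
            (cong₂ _+_ (∑ᵀ-*ˡ N₀ (N₀ * N₀) patterns) (∑ᵀ-*ˡ N₀ (N₀ * N₀) collisions))))))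

    -- The two estimates of the expected number of errors combined. In densities, N ≤ 1 + E (4 s + 1
    -- + N⁴ δ + N³ / n), where δ is the density of `D`.
    balance : N₀ * n₀ ^ 3 ≤ n₀ ^ 3 + E * (bound * n₀ ^ 3 + (N₀ ^ 4 * D-count G + N₀ ^ 3 * n₀ ^ 2))
    balance = *-cancelʳ-≤ _ _ (N₀ * T₀) {{m*n≢0 N₀ T₀ {{m*n≢0 s s}} {{m^n≢0 n₀ N₀}}}} (begin
      N₀ * n₀ ^ 3 * (N₀ * T₀)
        ≡⟨ lemma₁ N₀ (n₀ ^ 3) T₀ ⟩
      n₀ ^ 3 * (N₀ * (N₀ * T₀))
        ≤⟨ *-monoʳ-≤ (n₀ ^ 3) (≤-trans many-errors (+-monoʳ-≤ (N₀ * T₀) (*-monoʳ-≤ E few-errors))) ⟩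
      n₀ ^ 3 * (N₀ * T₀ + E * (T₀ * (N₀ * bound) + (N₀ * N₀ * ∑ᵀ N₀ patterns + N₀ * N₀ * ∑ᵀ N₀ collisions)))
        ≡⟨ lemma₂ n₀ N₀ T₀ E bound (∑ᵀ N₀ patterns) (∑ᵀ N₀ collisions) ⟩
      n₀ ^ 3 * (N₀ * T₀) + E * (n₀ ^ 3 * (T₀ * (N₀ * bound)) +
        (N₀ * N₀ * (n₀ ^ 3 * ∑ᵀ N₀ patterns) + N₀ * N₀ * n₀ ^ 2 * (n₀ * ∑ᵀ N₀ collisions)))
        ≤⟨ +-monoʳ-≤ (n₀ ^ 3 * (N₀ * T₀)) (*-monoʳ-≤ E (+-monoʳ-≤ (n₀ ^ 3 * (T₀ * (N₀ * bound)))
             (+-mono-≤ (*-monoʳ-≤ (N₀ * N₀) (triples-in-tuples N₀ (D-pattern? G) (D-pattern-distinct G)))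
               (*-monoʳ-≤ (N₀ * N₀ * n₀ ^ 2) expected-collisions)))) ⟩
      n₀ ^ 3 * (N₀ * T₀) + E * (n₀ ^ 3 * (T₀ * (N₀ * bound)) +
        (N₀ * N₀ * (N₀ ^ 3 * (T₀ * D-count G)) + N₀ * N₀ * n₀ ^ 2 * (N₀ * (N₀ * T₀))))
        ≡⟨ lemma₃ (n₀ ^ 3) (n₀ ^ 2) N₀ T₀ E bound (D-count G) ⟩
      (n₀ ^ 3 + E * (bound * n₀ ^ 3 + (N₀ ^ 4 * D-count G + N₀ ^ 3 * n₀ ^ 2))) * (N₀ * T₀) ∎)
      where
      open ≤-Reasoning
      lemma₁ : ∀ a b t → a * b * (a * t) ≡ b * (a * (a * t))
      lemma₁ = solve-∀
      lemma₂ : ∀ n a t e k p c → n * (n * (n * 1)) * (a * t + e * (t * (a * k) + (a * a * p + a * a * c))) ≡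
        n * (n * (n * 1)) * (a * t) + e * (n * (n * (n * 1)) * (t * (a * k)) +
          (a * a * (n * (n * (n * 1)) * p) + a * a * (n * (n * 1)) * (n * c)))
      lemma₂ = solve-∀
      lemma₃ : ∀ n³ n² a t e k d → n³ * (a * t) + e * (n³ * (t * (a * k)) +
          (a * a * (a * (a * (a * 1)) * (t * d)) + a * a * n² * (a * (a * t)))) ≡
        (n³ + e * (k * n³ + (a * (a * (a * (a * 1))) * d + a * (a * (a * 1)) * n²))) * (a * t)
      lemma₃ = solve-∀

  no-pattern⇒D-free : D-count G ≡ 0 → InducedFree D G
  no-pattern⇒D-free none (f , order , edges) = contradiction (≤-trans some (≤-reflexive none)) λ ()
    where
    v₀ v₁ v₂ : Fin 3
    v₀ = zero
    v₁ = suc zero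
    v₂ = suc (suc zero)
    pat : D-Pattern G (f v₀) (f v₁) (f v₂)
    pat = order v₀ v₁ (s≤s z≤n) , order v₁ v₂ (s≤s (s≤s z≤n)) , edges v₀ v₁ , edges v₀ v₂ ,
      λ e → contradiction (trans (≡-sym (edges v₁ v₂)) e) λ ()
    some : 1 ≤ D-count G
    some = ≤-trans (1≤ind (D-pattern? G (f v₀) (f v₁) (f v₂)) pat)
      (≤-trans (term≤∑ (λ z → ind (D-pattern? G (f v₀) (f v₁) z)) (f v₂))
      (≤-trans (term≤∑ (λ y → ∑ λ z → ind (D-pattern? G (f v₀) y z)) (f v₁))
        (term≤∑ (λ x → ∑ λ y → ∑ λ z → ind (D-pattern? G x y z)) (f v₀))))

dist-self : (G : OGraph n) → dist G G ≡ 0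
dist-self G = trans (dist-∑ G G) (∑-zero λ x → ∑-zero λ y → ind-no (differ? G G x y) λ (_ , ≢) → ≢ refl)

D-count≤copies : (G : OGraph n) → D-count G ≤ copies D G
D-count≤copies {n} G = begin
  D-count G
    ≤⟨ ∑-mono (λ x → ∑-mono λ y → ∑-mono λ z →
         ind-mono (D-pattern? G x y z) (isInducedCopy? D G (lookup (x ∷ y ∷ z ∷ []))) (embed x y z)) ⟩
  ∑ (λ x → ∑ λ y → ∑ λ z → ind (isInducedCopy? D G (lookup (x ∷ y ∷ z ∷ []))))
    ≡⟨ unroll ⟩
  ∑ᵀ 3 (λ w → ind (isInducedCopy? D G (lookup w)))
    ≡⟨ ≡-sym (copies-∑ᵀ D G) ⟩
  copies D G ∎
  where
  open ≤-Reasoning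
  opaque
    unfolding ∑ᵀ
    unroll : ∑ (λ x → ∑ λ y → ∑ λ z → ind (isInducedCopy? D G (lookup (x ∷ y ∷ z ∷ [])))) ≡
             ∑ᵀ 3 (λ w → ind (isInducedCopy? D G (lookup w)))
    unroll = refl
  embed : ∀ x y z → D-Pattern G x y z → IsInducedCopy D G (lookup (x ∷ y ∷ z ∷ []))
  embed x y z (x<y , y<z , a , b , ¬c) = order , edges
    where
    order : ∀ i j → i Fin.< j → lookup (x ∷ y ∷ z ∷ []) i Fin.< lookup (x ∷ y ∷ z ∷ []) j
    order 0F 1F _ = x<y
    order 0F 2F _ = FinP.<-trans x<y y<z
    order 1F 2F _ = y<z
    order 1F 1F (s≤s ())
    order 2F 1F (s≤s ())
    order 2F 2F (s≤s (s≤s ()))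
    c : adj G y z ≡ false
    c = BoolP.¬-not ¬c
    edges : ∀ i j → adj G (lookup (x ∷ y ∷ z ∷ []) i) (lookup (x ∷ y ∷ z ∷ []) j) ≡ adj D i j
    edges 0F 0F = OGraph.irrefl G x
    edges 0F 1F = a
    edges 0F 2F = b
    edges 1F 0F = trans (OGraph.sym G y x) a
    edges 1F 1F = OGraph.irrefl G y
    edges 1F 2F = c
    edges 2F 0F = trans (OGraph.sym G z x) b
    edges 2F 1F = trans (OGraph.sym G z y) c
    edges 2F 2F = OGraph.irrefl G z

-- From `M` vertices on, collisions are rare enough that the terms of `balance` without `D` use up
-- at most three quarters of its left side. With fewer vertices one copy of `D` suffices, and it
-- exists because `G` is far.
poly-D-bound : ∀ e {n′} (G : OGraph (suc n′)) → let E = suc e ; N₁ = 12 * E * (12 * E) ; M = 4 * E * (N₁ * N₁) in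
  (∀ H → InducedFree D H → suc n′ * suc n′ ≤ E * dist G H) → suc n′ ^ 3 ≤ M ^ 3 * D-count G
poly-D-bound e {n′} G far = split (M ≤? n₁) (d ≟ 0)
  where
  open ≤-Reasoning
  E s N₁ M n₁ d : ℕ
  E = suc e
  s = 12 * E
  N₁ = s * s
  M = 4 * E * (N₁ * N₁)
  n₁ = suc n′
  d = D-count G
  bound = suc s + s + s + s
  instance
    N≢0 : NonZero N₁
    N≢0 = m*n≢0 s s
    M≢0 : NonZero M
    M≢0 = m*n≢0 (4 * E) (N₁ * N₁) {{m*n≢0 4 E}} {{m*n≢0 N₁ N₁}}

  NM≤ : N₁ * M ≤ M ^ 3
  NM≤ = begin
    N₁ * M              ≤⟨ *-monoˡ-≤ M (≤-trans (m≤m*n N₁ N₁) (m≤n*m (N₁ * N₁) (4 * E) {{m*n≢0 4 E}})) ⟩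
    M * M              ≤⟨ *-monoʳ-≤ M (m≤m*n M (M * 1) {{m*n≢0 M 1}}) ⟩
    M ^ 3              ∎

  -- 12 is chosen so that 4 (1 + E bound) ≤ 2 N₁.
  cheap : 4 * (n₁ ^ 3 + E * (bound * n₁ ^ 3)) ≤ 2 * N₁ * n₁ ^ 3
  cheap = ≤-trans (≤-reflexive (lemma E bound (n₁ ^ 3))) (*-monoˡ-≤ (n₁ ^ 3) (begin
    4 + 4 * (E * bound)               ≤⟨ +-monoʳ-≤ 4 (*-monoʳ-≤ 4 (*-monoʳ-≤ E bound≤)) ⟩
    4 + 4 * (E * (49 * E))            ≤⟨ +-monoˡ-≤ (4 * (E * (49 * E))) (*-mono-≤ {4} {92} {1} {E * E} (≤-trans (m≤m+n 4 88) ≤-refl) (s≤s z≤n)) ⟩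
    92 * (E * E) + 4 * (E * (49 * E)) ≡⟨ lemma′ E ⟩
    2 * N₁                             ∎))
    where
    lemma : ∀ e b t → 4 * (t + e * (b * t)) ≡ (4 + 4 * (e * b)) * t
    lemma = solve-∀
    lemma′ : ∀ e → 92 * (e * e) + 4 * (e * (49 * e)) ≡ 2 * (12 * e * (12 * e))
    lemma′ = solve-∀
    lemma″ : ∀ e → 1 + (12 * e + 12 * e + 12 * e + 12 * e) ≡ 1 + 48 * e
    lemma″ = solve-∀
    bound≤ : bound ≤ 49 * E
    bound≤ = ≤-trans (≤-reflexive (lemma″ E)) (+-monoˡ-≤ (48 * E) {1} {E} (s≤s z≤n))

  cube : M ≤ n₁ → n₁ ^ 3 ≤ N₁ * M * d
  cube large = *-cancelˡ-≤ N₁ (+-cancelˡ-≤ (3 * N₁ * n₁ ^ 3) _ _ (begin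
    3 * N₁ * n₁ ^ 3 + N₁ * n₁ ^ 3
      ≡⟨ lemma₁ N₁ (n₁ ^ 3) ⟩
    4 * (N₁ * n₁ ^ 3)
      ≤⟨ *-monoʳ-≤ 4 (Averaging.balance G s E far) ⟩
    4 * (n₁ ^ 3 + E * (bound * n₁ ^ 3 + (N₁ ^ 4 * d + N₁ ^ 3 * n₁ ^ 2)))
      ≡⟨ lemma₂ E bound (n₁ ^ 3) (n₁ ^ 2) N₁ d ⟩
    4 * (n₁ ^ 3 + E * (bound * n₁ ^ 3)) + N₁ * (4 * E * (N₁ * N₁)) * n₁ ^ 2 + N₁ * (N₁ * (4 * E * (N₁ * N₁)) * d)
      ≤⟨ +-monoˡ-≤ (N₁ * (N₁ * M * d)) (+-mono-≤ cheap (≤-trans (≤-reflexive (*-assoc N₁ M (n₁ ^ 2)))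
           (*-monoʳ-≤ N₁ (*-monoˡ-≤ (n₁ ^ 2) large)))) ⟩
    2 * N₁ * n₁ ^ 3 + N₁ * n₁ ^ 3 + N₁ * (N₁ * M * d)
      ≡⟨ cong (_+ N₁ * (N₁ * M * d)) (lemma₃ N₁ (n₁ ^ 3)) ⟩
    3 * N₁ * n₁ ^ 3 + N₁ * (N₁ * M * d) ∎))
    where
    lemma₁ : ∀ a t → 3 * a * t + a * t ≡ 4 * (a * t)
    lemma₁ = solve-∀
    lemma₂ : ∀ e b t u a d → 4 * (t + e * (b * t + (a * (a * (a * (a * 1))) * d + a * (a * (a * 1)) * u))) ≡
      4 * (t + e * (b * t)) + a * (4 * e * (a * a)) * u + a * (a * (4 * e * (a * a)) * d)
    lemma₂ = solve-∀
    lemma₃ : ∀ a t → 2 * a * t + a * t ≡ 3 * a * t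
    lemma₃ = solve-∀

  split : Dec (M ≤ n₁) → Dec (d ≡ 0) → n₁ ^ 3 ≤ M ^ 3 * d
  split (yes large) _ = ≤-trans (cube large) (*-monoˡ-≤ d NM≤)
  split (no _) (yes none) = contradiction (≤-trans (far G (Averaging.no-pattern⇒D-free G s none))
    (≤-reflexive (trans (cong (E *_) (dist-self G)) (*-zeroʳ E)))) λ ()
  split (no small) (no some) = ≤-trans (^-monoˡ-≤ 3 (<⇒≤ (≰⇒> small)))
    (≤-trans (≤-reflexive (≡-sym (*-identityʳ (M ^ 3)))) (*-monoʳ-≤ (M ^ 3) (n≢0⇒n>0 some)))

poly-D : PolyRemovalℕ D
-- The threshold `M` is `c * E ^ 5`, and its cube enters the bound, whence the exponent 15.
poly-D = c ^ 3 , 15 , prove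
  where
  c : ℕ
  c = 4 * (12 * 12 * (12 * 12))
  collect : ∀ t e → 4 * e * (t * e * (t * e) * (t * e * (t * e))) ≡ 4 * (t * t * (t * t)) * (e * (e * (e * (e * (e * 1)))))
  collect = solve-∀
  prove : ∀ E n (G : OGraph n) → 2 ≤ E → (∀ H → InducedFree D H → n * n ≤ E * dist G H) →
          n ^ 3 ≤ c ^ 3 * E ^ 15 * copies D G
  prove (suc e) zero G _ far = z≤n
  prove (suc e) (suc n′) G _ far = begin
    suc n′ ^ 3                                                ≤⟨ poly-D-bound e G far ⟩
    (4 * E * (12 * E * (12 * E) * (12 * E * (12 * E)))) ^ 3 * D-count G
      ≡⟨ cong (_* D-count G) (trans (cong (_^ 3) (collect 12 E)) (trans (^-distribʳ-* 3 c (E ^ 5)) (cong (c ^ 3 *_) (^-*-assoc E 5 3)))) ⟩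
    c ^ 3 * E ^ 15 * D-count G                                ≤⟨ *-monoʳ-≤ (c ^ 3 * E ^ 15) (D-count≤copies G) ⟩
    c ^ 3 * E ^ 15 * copies D G                               ∎
    where
    open ≤-Reasoning
    E = suc e

-- Symmetries and graphs on two vertices

copies-≤ : {F : OGraph k} {F′ : OGraph k} {G : OGraph n} {G′ : OGraph n} (φ : Vec (Fin n) k → Vec (Fin n) k) →
  (∀ {v w} → φ v ≡ φ w → v ≡ w) →
  (∀ w → IsInducedCopy F G (lookup w) → IsInducedCopy F′ G′ (lookup (φ w))) → copies F G ≤ copies F′ G′
copies-≤ {k} {n} {F} {F′} {G} {G′} φ injective maps = length-injection φ
  (UniqueP.filter⁺ (λ w → isInducedCopy? F G (lookup w)) (allVecs-unique n k))
  (λ {w} w∈ → Mem.∈-filter⁺ (λ w → isInducedCopy? F′ G′ (lookup w)) (∈-allVecs (φ w))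
    (maps w (proj₂ (Mem.∈-filter⁻ (λ w → isInducedCopy? F G (lookup w)) {xs = allVecs n k} w∈))))
  (λ _ _ → injective)

module _ {n} {G H : OGraph n} where
  private
    δ? : (p : Fin n × Fin n) → Dec (Differ G H (proj₁ p) (proj₂ p))
    δ? (x , y) = differ? G H x y

  dist-≤ : ∀ {a} {A : Set a} {ys : List.List A} (φ : Fin n × Fin n → A) → (∀ {p q} → φ p ≡ φ q → p ≡ q) →
    (∀ x y → Differ G H x y → φ (x , y) ∈ ys) → dist G H ≤ length ys
  dist-≤ φ injective maps = length-injection φ
    (UniqueP.filter⁺ δ? (UniqueP.cartesianProduct⁺ (UniqueP.allFin⁺ n) (UniqueP.allFin⁺ n)))
    (λ {p} p∈ → maps (proj₁ p) (proj₂ p)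
      (proj₂ (Mem.∈-filter⁻ δ? {xs = cartesianProduct (allFin n) (allFin n)} p∈)))
    (λ _ _ → injective)

dist-≤-dist : {G H G′ H′ : OGraph n} (φ : Fin n × Fin n → Fin n × Fin n) → (∀ {p q} → φ p ≡ φ q → p ≡ q) →
  (∀ x y → Differ G H x y → Differ G′ H′ (proj₁ (φ (x , y))) (proj₂ (φ (x , y)))) → dist G H ≤ dist G′ H′
dist-≤-dist {n} {G} {H} {G′} {H′} φ injective maps = dist-≤ {G = G} {H} φ injective λ x y δ →
  Mem.∈-filter⁺ (λ p → differ? G′ H′ (proj₁ p) (proj₂ p))
    (Mem.∈-cartesianProduct⁺ (Mem.∈-allFin (proj₁ (φ (x , y)))) (Mem.∈-allFin (proj₂ (φ (x , y))))) (maps x y δ)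

poly-transfer : {F F′ : OGraph k} (τ : ∀ {n} → OGraph n → OGraph n) →
  (∀ {n} (H : OGraph n) → InducedFree F H → InducedFree F′ (τ H)) →
  (∀ {n} (G H : OGraph n) → dist G (τ H) ≤ dist (τ G) H) →
  (∀ {n} (G : OGraph n) → copies F (τ G) ≤ copies F′ G) →
  PolyRemovalℕ F → PolyRemovalℕ F′
poly-transfer τ free dist≤ copies≤ (q , C , poly) = q , C , λ E n G 2≤E far →
  ≤-trans (poly E n (τ G) 2≤E λ H free-H → ≤-trans (far (τ H) (free H free-H)) (*-monoʳ-≤ E (dist≤ G H)))
    (*-monoʳ-≤ (q * E ^ C) (copies≤ G))

poly-≅ : {F F′ : OGraph k} → F′ ≅ F → PolyRemovalℕ F → PolyRemovalℕ F′
poly-≅ {F = F} {F′} F′≅F = poly-transfer {F = F} {F′} id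
  (λ H free (f , order , edges) → free (f , order , λ i j → trans (edges i j) (F′≅F i j)))
  (λ G H → ≤-refl)
  (λ G → copies-≤ {F = F} {F′} {G} {G} id id λ w (order , edges) → order , λ i j → trans (edges i j) (≡-sym (F′≅F i j)))

compl-adj : (G : OGraph n) → ∀ {i j} → i ≢ j → adj (compl G) i j ≡ not (adj G i j)
compl-adj G {i} {j} i≢j with i FinP.≟ j
... | yes i≡j = contradiction i≡j i≢j
... | no _ = refl

copy-distinct : ∀ {F : OGraph k} {G : OGraph n} {f} → IsInducedCopy F G f → ∀ {i j} → i ≢ j → f i ≢ f j
copy-distinct (order , _) {i} {j} i≢j e = case FinP.<-cmp i j of λ where
  (tri< lt _ _) → <-irrefl (cong toℕ e) (order i j lt)
  (tri≈ _ i≡j _) → i≢j i≡j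
  (tri> _ _ gt) → <-irrefl (cong toℕ (≡-sym e)) (order j i gt)

poly-compl : {F : OGraph k} → PolyRemovalℕ F → PolyRemovalℕ (compl F)
poly-compl {F = F} = poly-transfer {F = F} {compl F} compl free dist≤ copies≤
  where
  free : ∀ {n} (H : OGraph n) → InducedFree F H → InducedFree (compl F) (compl H)
  free H free-H (f , copy@(order , edges)) = free-H (f , order , edges′)
    where
    edges′ : ∀ i j → adj H (f i) (f j) ≡ adj F i j
    edges′ i j = case i FinP.≟ j of λ where
      (yes refl) → trans (OGraph.irrefl H (f i)) (≡-sym (OGraph.irrefl F i))
      (no i≢j) → BoolP.not-injective (trans (≡-sym (compl-adj H (copy-distinct {F = compl F} {compl H} copy i≢j)))
        (trans (edges i j) (compl-adj F i≢j)))
  dist≤ : ∀ {n} (G H : OGraph n) → dist G (compl H) ≤ dist (compl G) H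
  dist≤ G H = dist-≤-dist {G = G} {compl H} {compl G} {H} id id λ x y (x<y , differs) → x<y , λ e →
    let x≢y = λ x≡y → <-irrefl (cong toℕ x≡y) x<y
    in differs (trans (BoolP.not-injective (trans (≡-sym (compl-adj G x≢y))
         (trans e (≡-sym (BoolP.not-involutive (adj H x y)))))) (≡-sym (compl-adj H x≢y)))
  copies≤ : ∀ {n} (G : OGraph n) → copies F (compl G) ≤ copies (compl F) G
  copies≤ G = copies-≤ {F = F} {compl F} {compl G} {G} id id λ w copy → proj₁ copy , edges′ w copy
    where
    edges′ : ∀ w → IsInducedCopy F (compl G) (lookup w) → ∀ i j → adj G (lookup w i) (lookup w j) ≡ adj (compl F) i j
    edges′ w copy@(_ , edges) i j = case i FinP.≟ j of λ where
      (yes refl) → trans (OGraph.irrefl G (lookup w i)) (≡-sym (OGraph.irrefl (compl F) i))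
      (no i≢j) → BoolP.not-injective (trans (≡-sym (compl-adj G (copy-distinct {F = F} {compl G} copy i≢j)))
        (trans (edges i j) (≡-sym (trans (cong not (compl-adj F i≢j)) (BoolP.not-involutive (adj F i j))))))

opposite-< : {i j : Fin n} → i Fin.< j → opposite j Fin.< opposite i
opposite-< {n} {i} {j} i<j = subst₂ _<ⁿ_ (≡-sym (FinP.opposite-prop j)) (≡-sym (FinP.opposite-prop i))
  (∸-monoʳ-< (s≤s i<j) (FinP.toℕ<n j))

poly-rev : {F : OGraph k} → PolyRemovalℕ F → PolyRemovalℕ (rev F)
poly-rev {k} {F} = poly-transfer {F = F} {rev F} rev free dist≤ copies≤
  where
  flip-order : ∀ {n} (f : Fin k → Fin n) → (∀ i j → i Fin.< j → f i Fin.< f j) →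
    ∀ i j → i Fin.< j → opposite (f (opposite i)) Fin.< opposite (f (opposite j))
  flip-order f order i j i<j = opposite-< (order _ _ (opposite-< i<j))
  free : ∀ {n} (H : OGraph n) → InducedFree F H → InducedFree (rev F) (rev H)
  free H free-H (f , order , edges) = free-H ((λ i → opposite (f (opposite i))) , flip-order f order ,
    λ i j → trans (edges (opposite i) (opposite j))
      (cong₂ (adj F) (FinP.opposite-involutive i) (FinP.opposite-involutive j)))
  dist≤ : ∀ {n} (G H : OGraph n) → dist G (rev H) ≤ dist (rev G) H
  -- The two ends of a pair are swapped as well, which keeps them in increasing order.
  dist≤ G H = dist-≤-dist {G = G} {rev H} {rev G} {H} (λ (x , y) → opposite y , opposite x)
    (λ { {x , y} {x′ , y′} e → cong₂ _,_ (opposite-injective (cong proj₂ e)) (opposite-injective (cong proj₁ e)) })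
    λ x y (x<y , differs) → opposite-< x<y , λ e → differs
      (trans (OGraph.sym G x y) (trans (≡-sym (cong₂ (adj G) (FinP.opposite-involutive y) (FinP.opposite-involutive x)))
        (trans e (OGraph.sym H (opposite y) (opposite x)))))
    where
    opposite-injective : ∀ {n} {i j : Fin n} → opposite i ≡ opposite j → i ≡ j
    opposite-injective {i = i} {j} e = trans (≡-sym (FinP.opposite-involutive i))
      (trans (cong opposite e) (FinP.opposite-involutive j))
  copies≤ : ∀ {n} (G : OGraph n) → copies F (rev G) ≤ copies (rev F) G
  copies≤ {n} G = copies-≤ {F = F} {rev F} {rev G} {G} flip
    (λ {v} {w} e → trans (≡-sym (flip-flip v)) (trans (cong flip e) (flip-flip w)))
    λ w (order , edges) →
      (λ i j i<j → subst₂ Fin._<_ (≡-sym (lookup-flip w i)) (≡-sym (lookup-flip w j)) (flip-order (lookup w) order i j i<j)) ,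
      λ i j → trans (cong₂ (adj G) (lookup-flip w i) (lookup-flip w j)) (edges (opposite i) (opposite j))
    where
    flip : Vec (Fin n) k → Vec (Fin n) k
    flip w = Vec.tabulate λ i → opposite (lookup w (opposite i))
    lookup-flip : ∀ w i → lookup (flip w) i ≡ opposite (lookup w (opposite i))
    lookup-flip w = VecP.lookup∘tabulate λ i → opposite (lookup w (opposite i))
    flip-flip : ∀ w → flip (flip w) ≡ w
    flip-flip w = trans (VecP.tabulate-cong λ i → trans (cong opposite (lookup-flip w (opposite i)))
      (trans (FinP.opposite-involutive _) (cong (lookup w) (FinP.opposite-involutive i)))) (VecP.tabulate∘lookup w)

uniform : ∀ n → Bool → OGraph n
uniform n c = record
  { adj    = λ x y → if does (x FinP.≟ y) then false else c
  ; sym    = symmetric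
  ; irrefl = irreflexive }
  where
  symmetric : (x y : Fin n) → (if does (x FinP.≟ y) then false else c) ≡ (if does (y FinP.≟ x) then false else c)
  symmetric x y with x FinP.≟ y | y FinP.≟ x
  ... | yes _ | yes _ = refl
  ... | no _  | no _  = refl
  ... | yes e | no ¬e = contradiction (≡-sym e) ¬e
  ... | no ¬e | yes e = contradiction (≡-sym e) ¬e
  irreflexive : (x : Fin n) → (if does (x FinP.≟ x) then false else c) ≡ false
  irreflexive x with x FinP.≟ x
  ... | yes _ = refl
  ... | no ¬e = contradiction refl ¬e

uniform-adj : ∀ {c} {x y : Fin n} → x ≢ y → adj (uniform n c) x y ≡ c
uniform-adj {x = x} {y} x≢y with x FinP.≟ y
... | yes e = contradiction e x≢y
... | no _ = refl

-- The complete or empty graph of the other colour is free of `F`, and every pair on which `G`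
-- differs from it is a copy of `F`; so the bound is linear in ε.
poly-two : (F : OGraph 2) → PolyRemovalℕ F
poly-two F = 1 , 1 , λ E n G 2≤E far → begin
  n ^ 2                     ≡⟨ cong (n *_) (*-identityʳ n) ⟩
  n * n                     ≤⟨ far (uniform n (not c)) free ⟩
  E * dist G (uniform n (not c)) ≤⟨ *-monoʳ-≤ E (dist≤copies G) ⟩
  E * copies F G            ≡⟨ cong (_* copies F G) (≡-sym (trans (*-identityˡ (E * 1)) (*-identityʳ E))) ⟩
  1 * E ^ 1 * copies F G    ∎
  where
  open ≤-Reasoning
  c : Bool
  c = adj F 0F 1F
  free : ∀ {n} → InducedFree F (uniform n (not c))
  free {n} (f , copy@(order , edges)) = BoolP.not-¬ refl
    (trans (≡-sym (edges 0F 1F)) (uniform-adj (copy-distinct {F = F} {uniform n (not c)} copy λ ())))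
  dist≤copies : ∀ {n} (G : OGraph n) → dist G (uniform n (not c)) ≤ copies F G
  dist≤copies {n} G = dist-≤ {G = G} {uniform n (not c)} (λ (x , y) → x ∷ y ∷ []) (λ { refl → refl }) λ x y δ →
    Mem.∈-filter⁺ (λ w → isInducedCopy? F G (lookup w)) (∈-allVecs (x ∷ y ∷ [])) (order x y δ , edges x y δ)
    where
    order : ∀ x y → Differ G (uniform n (not c)) x y → ∀ i j → i Fin.< j →
            lookup (x ∷ y ∷ []) i Fin.< lookup (x ∷ y ∷ []) j
    order x y (x<y , _) 0F 1F _ = x<y
    order x y _ 1F 1F (s≤s ())
    edge : ∀ x y → Differ G (uniform n (not c)) x y → adj G x y ≡ c
    edge x y (x<y , differs) = trans (BoolP.¬-not λ e → differs (trans e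
      (≡-sym (uniform-adj λ x≡y → <-irrefl (cong toℕ x≡y) x<y)))) (BoolP.not-involutive c)
    edges : ∀ x y → Differ G (uniform n (not c)) x y → ∀ i j →
            adj G (lookup (x ∷ y ∷ []) i) (lookup (x ∷ y ∷ []) j) ≡ adj F i j
    edges x y δ 0F 0F = trans (OGraph.irrefl G x) (≡-sym (OGraph.irrefl F 0F))
    edges x y δ 0F 1F = edge x y δ
    edges x y δ 1F 0F = trans (OGraph.sym G y x) (trans (edge x y δ) (OGraph.sym F 0F 1F))
    edges x y δ 1F 1F = trans (OGraph.irrefl G y) (≡-sym (OGraph.irrefl F 1F))

small-or-D-family⇒poly : (F : OGraph k) → k ≡ 2 ⊎ InDFamily F → PolyRemovalℕ F
small-or-D-family⇒poly F (inj₁ refl) = poly-two F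
small-or-D-family⇒poly {3} F (inj₂ (inj₁ e)) = poly-≅ {F = D} {F} e poly-D
small-or-D-family⇒poly {3} F (inj₂ (inj₂ (inj₁ e))) = poly-≅ {F = rev D} {F} e (poly-rev {F = D} poly-D)
small-or-D-family⇒poly {3} F (inj₂ (inj₂ (inj₂ (inj₁ e)))) = poly-≅ {F = compl D} {F} e (poly-compl {F = D} poly-D)
small-or-D-family⇒poly {3} F (inj₂ (inj₂ (inj₂ (inj₂ e)))) =
  poly-≅ {F = compl (rev D)} {F} e (poly-compl {F = rev D} (poly-rev {F = D} poly-D))

-- From rational ε to integral E

ℕ→ℚᵘ : ∀ m → ℚ.toℚᵘ (ℕ→ℚ m) ℚᵘ.≃ mkℚᵘ (ℤ.+ m) 0
ℕ→ℚᵘ m = ℚP.toℚᵘ-fromℚᵘ (mkℚᵘ (ℤ.+ m) 0)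

ℕ→ℚ-mono : m ≤ n → ℕ→ℚ m ℚ.≤ ℕ→ℚ n
ℕ→ℚ-mono {m} {n} m≤n = ℚP.toℚᵘ-cancel-≤ (ℚᵘP.≤-respˡ-≃ (ℚᵘP.≃-sym (ℕ→ℚᵘ m)) (ℚᵘP.≤-respʳ-≃ (ℚᵘP.≃-sym (ℕ→ℚᵘ n))
  (*≤* (ℤP.*-monoʳ-≤-nonNeg (ℤ.+ 1) (ℤ.+≤+ m≤n)))))

ℕ→ℚ-cancel : ℕ→ℚ m ℚ.≤ ℕ→ℚ n → m ≤ n
ℕ→ℚ-cancel {m} {n} h = ℤP.drop‿+≤+ (subst₂ ℤ._≤_ (ℤP.*-identityʳ (ℤ.+ m)) (ℤP.*-identityʳ (ℤ.+ n)) (ℚᵘP.drop-*≤*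
  (ℚᵘP.≤-respˡ-≃ (ℕ→ℚᵘ m) (ℚᵘP.≤-respʳ-≃ (ℕ→ℚᵘ n) (ℚP.toℚᵘ-mono-≤ h)))))

ℕ→ℚ-pos : ∀ n → 0ℚ ℚ.< ℕ→ℚ (suc n)
ℕ→ℚ-pos n = ℚP.toℚᵘ-cancel-< (ℚᵘP.<-respʳ-≃ (ℚᵘP.≃-sym (ℕ→ℚᵘ (suc n))) (*<* (ℤ.+<+ (s≤s z≤n))))

ℕ→ℚ-* : ∀ m n → ℕ→ℚ (m * n) ≡ ℕ→ℚ m ℚ.* ℕ→ℚ n
ℕ→ℚ-* m n = ℚP.toℚᵘ-injective (ℚᵘP.≃-trans (ℕ→ℚᵘ (m * n)) (ℚᵘP.≃-trans
  (*≡* (cong (ℤ._* (ℤ.+ 1)) (ℤP.pos-* m n)))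
  (ℚᵘP.≃-sym (ℚᵘP.≃-trans (ℚP.toℚᵘ-homo-* (ℕ→ℚ m) (ℕ→ℚ n)) (ℚᵘP.*-cong (ℕ→ℚᵘ m) (ℕ→ℚᵘ n))))))

ℕ→ℚ-^ : ∀ m C → ℕ→ℚ (m ^ C) ≡ ℕ→ℚ m ^ℚ C
ℕ→ℚ-^ m zero    = refl
ℕ→ℚ-^ m (suc C) = trans (ℕ→ℚ-* m (m ^ C)) (cong (ℕ→ℚ m ℚ.*_) (ℕ→ℚ-^ m C))

fraction : ∀ p → 0ℚ ℚ.< p → ∃ λ a → ∃ λ b → p ℚ.* ℕ→ℚ (suc b) ≡ ℕ→ℚ (suc a)
fraction p 0<p = from p (ℚ.positive 0<p)
  where
  from : ∀ p → ℚ.Positive p → ∃ λ a → ∃ λ b → p ℚ.* ℕ→ℚ (suc b) ≡ ℕ→ℚ (suc a)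
  from p@(mkℚ +[1+ a ] b _) _ = a , b , ℚP.toℚᵘ-injective (ℚᵘP.≃-trans (ℚP.toℚᵘ-homo-* p (ℕ→ℚ (suc b)))
    (ℚᵘP.≃-trans (ℚᵘP.*-cong (ℚᵘP.≃-refl {ℚ.toℚᵘ p}) (ℕ→ℚᵘ (suc b))) (ℚᵘP.≃-trans cancel (ℚᵘP.≃-sym (ℕ→ℚᵘ (suc a))))))
    where
    cancel : mkℚᵘ +[1+ a ] b ℚᵘ.* mkℚᵘ (ℤ.+ suc b) 0 ℚᵘ.≃ mkℚᵘ +[1+ a ] 0
    cancel = *≡* (trans (ℤP.*-assoc +[1+ a ] (ℤ.+ suc b) (ℤ.+ 1)) (cong (+[1+ a ] ℤ.*_)
      (trans (ℤP.*-identityʳ (ℤ.+ suc b)) (≡-sym (cong ℤ.+_ (*-identityʳ (suc b)))))))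

*-monoˡ : ∀ r {p q} → 0ℚ ℚ.≤ r → p ℚ.≤ q → r ℚ.* p ℚ.≤ r ℚ.* q
*-monoˡ r 0≤r = ℚP.*-monoˡ-≤-nonNeg r {{ℚ.nonNegative 0≤r}}

*-monoʳ : ∀ r {p q} → 0ℚ ℚ.≤ r → p ℚ.≤ q → p ℚ.* r ℚ.≤ q ℚ.* r
*-monoʳ r 0≤r = ℚP.*-monoʳ-≤-nonNeg r {{ℚ.nonNegative 0≤r}}

*-cancelʳ : ∀ r {p q} → 0ℚ ℚ.< r → p ℚ.* r ℚ.≤ q ℚ.* r → p ℚ.≤ q
*-cancelʳ r 0<r = ℚP.*-cancelʳ-≤-pos r {{ℚ.positive 0<r}}

0≤* : ∀ {p q} → 0ℚ ℚ.≤ p → 0ℚ ℚ.≤ q → 0ℚ ℚ.≤ p ℚ.* q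
0≤* {p} {q} 0≤p 0≤q = subst (ℚ._≤ p ℚ.* q) (ℚP.*-zeroʳ p) (*-monoˡ p 0≤p 0≤q)

0≤^ : ∀ {p} C → 0ℚ ℚ.≤ p → 0ℚ ℚ.≤ p ^ℚ C
0≤^ zero    0≤p = ℚP.<⇒≤ (ℕ→ℚ-pos 0)
0≤^ (suc C) 0≤p = 0≤* 0≤p (0≤^ C 0≤p)

^-mono : ∀ {p q} C → 0ℚ ℚ.≤ p → p ℚ.≤ q → p ^ℚ C ℚ.≤ q ^ℚ C
^-mono zero 0≤p p≤q = ℚP.≤-refl
^-mono {p} {q} (suc C) 0≤p p≤q = ℚP.≤-trans (*-monoʳ (p ^ℚ C) (0≤^ C 0≤p) p≤q)
  (*-monoˡ q (ℚP.≤-trans 0≤p p≤q) (^-mono C 0≤p p≤q))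

open +-*-Solver using (solve; _:*_; _:=_)

^-distrib : ∀ p q C → (p ℚ.* q) ^ℚ C ≡ p ^ℚ C ℚ.* q ^ℚ C
^-distrib p q zero    = ≡-sym (ℚP.*-identityˡ 1ℚ)
^-distrib p q (suc C) = trans (cong (p ℚ.* q ℚ.*_) (^-distrib p q C))
  (solve 4 (λ a b c d → (a :* b) :* (c :* d) := (a :* c) :* (b :* d)) refl p q (p ^ℚ C) (q ^ℚ C))

1^ : ∀ C → 1ℚ ^ℚ C ≡ 1ℚ
1^ zero    = refl
1^ (suc C) = trans (ℚP.*-identityˡ (1ℚ ^ℚ C)) (1^ C)

reciprocal : ∀ e → ∃ λ ε → 0ℚ ℚ.< ε × ε ℚ.* ℕ→ℚ (suc e) ≡ 1ℚ
reciprocal e = ℚ.1/ E , ℚP.positive⁻¹ (ℚ.1/ E) {{ℚP.1/pos⇒pos E}} , ℚP.*-inverseˡ E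
  where
  E = ℕ→ℚ (suc e)
  instance
    E>0 : ℚ.Positive E
    E>0 = ℚ.positive (ℕ→ℚ-pos e)
    E≢0 : ℚ.NonZero E
    E≢0 = ℚP.pos⇒nonZero E

private
  ι = ℕ→ℚ

  0≤ι : ∀ m → 0ℚ ℚ.≤ ι m
  0≤ι m = ℕ→ℚ-mono {0} {m} z≤n

-- Take ε = 1 / E, which is below 1 as `2 ≤ E`. The denominator `suc b` of `c` is at least 1 / c and
-- becomes the constant.
poly⇒polyℕ : {F : OGraph k} → PolyRemoval F → PolyRemovalℕ F
poly⇒polyℕ {k} {F} (c , C , 0<c , poly) = suc b , C , prove
  where
  a b : ℕ
  a = proj₁ (fraction c 0<c)
  b = proj₁ (proj₂ (fraction c 0<c))
  open ℚP.≤-Reasoning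
  prove : ∀ E n (G : OGraph n) → 2 ≤ E → (∀ H → InducedFree F H → n * n ≤ E * dist G H) →
          n ^ k ≤ suc b * E ^ C * copies F G
  prove (suc e) n G 2≤E far = ℕ→ℚ-cancel (begin
    ι (n ^ k)
      ≤⟨ ℕ→ℚ-mono (m≤n*m (n ^ k) (suc a)) ⟩
    ι (suc a * n ^ k)
      ≡⟨ trans (ℕ→ℚ-* (suc a) (n ^ k)) (cong (ℚ._* ι (n ^ k)) (≡-sym (proj₂ (proj₂ (fraction c 0<c))))) ⟩
    c ℚ.* ι (suc b) ℚ.* ι (n ^ k)
      ≡⟨ cong (ℚ._* ι (n ^ k)) (≡-sym (trans (cong (c ℚ.* ι (suc b) ℚ.*_) unit) (ℚP.*-identityʳ (c ℚ.* ι (suc b))))) ⟩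
    c ℚ.* ι (suc b) ℚ.* (ε ^ℚ C ℚ.* ι E ^ℚ C) ℚ.* ι (n ^ k)
      ≡⟨ solve 5 (λ c b x y t → (c :* b) :* (x :* y) :* t := (b :* y) :* (c :* x :* t)) refl c (ι (suc b)) (ε ^ℚ C) (ι E ^ℚ C) (ι (n ^ k)) ⟩
    ι (suc b) ℚ.* ι E ^ℚ C ℚ.* (c ℚ.* ε ^ℚ C ℚ.* ι (n ^ k))
      ≡⟨ cong (ℚ._* (c ℚ.* ε ^ℚ C ℚ.* ι (n ^ k))) (≡-sym (trans (ℕ→ℚ-* (suc b) (E ^ C)) (cong (ι (suc b) ℚ.*_) (ℕ→ℚ-^ E C)))) ⟩
    ι (suc b * E ^ C) ℚ.* (c ℚ.* ε ^ℚ C ℚ.* ι (n ^ k))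
      ≤⟨ *-monoˡ (ι (suc b * E ^ C)) (0≤ι (suc b * E ^ C)) (poly ε 0<ε ε<1 n G far-ℚ) ⟩
    ι (suc b * E ^ C) ℚ.* ι (copies F G)
      ≡⟨ ≡-sym (ℕ→ℚ-* (suc b * E ^ C) (copies F G)) ⟩
    ι (suc b * E ^ C * copies F G) ∎)
    where
    E = suc e
    ε = proj₁ (reciprocal e)
    0<ε = proj₁ (proj₂ (reciprocal e))
    εE : ε ℚ.* ι E ≡ 1ℚ
    εE = proj₂ (proj₂ (reciprocal e))
    unit : ε ^ℚ C ℚ.* ι E ^ℚ C ≡ 1ℚ
    unit = trans (≡-sym (^-distrib ε (ι E) C)) (trans (cong (_^ℚ C) εE) (1^ C))
    ε<1 : ε ℚ.< 1ℚ
    ε<1 = ℚP.≰⇒> λ 1≤ε → <-irrefl refl (≤-trans 2≤E (ℕ→ℚ-cancel {E} {1} (begin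
      ι E         ≡⟨ ≡-sym (ℚP.*-identityˡ (ι E)) ⟩
      1ℚ ℚ.* ι E  ≤⟨ *-monoʳ (ι E) (0≤ι E) 1≤ε ⟩
      ε ℚ.* ι E   ≡⟨ εE ⟩
      1ℚ          ∎)))
    far-ℚ : Far F ε G
    far-ℚ H free = begin
      ε ℚ.* ι (n * n)                ≤⟨ *-monoˡ ε (ℚP.<⇒≤ 0<ε) (ℕ→ℚ-mono (far H free)) ⟩
      ε ℚ.* ι (E * dist G H)         ≡⟨ trans (cong (ε ℚ.*_) (ℕ→ℚ-* E (dist G H))) (≡-sym (ℚP.*-assoc ε (ι E) (ι (dist G H)))) ⟩
      ε ℚ.* ι E ℚ.* ι (dist G H)     ≡⟨ trans (cong (ℚ._* ι (dist G H)) εE) (ℚP.*-identityˡ (ι (dist G H))) ⟩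
      ι (dist G H)                   ∎

-- The next integer E above 1 / ε satisfies `1 ≤ ε E ≤ 2`. The lower bound transfers farness; the
-- upper one gives `E ^ C ≤ (2 / ε) ^ C`, whence the factor `2 ^ C` in `w`.
polyℕ⇒poly : {F : OGraph k} → PolyRemovalℕ F → PolyRemoval F
polyℕ⇒poly {k} {F} (q , C , poly) = c , C , 0<c , prove
  where
  w : ℕ
  w = q * 2 ^ C
  c : ℚ
  -- This is `1 / (w + 1)`; the added one covers `q = 0`.
  c = proj₁ (reciprocal w)
  0<c = proj₁ (proj₂ (reciprocal w))
  open ℚP.≤-Reasoning
  prove : ∀ ε → 0ℚ ℚ.< ε → ε ℚ.< 1ℚ → ∀ n (G : OGraph n) → Far F ε G →
          c ℚ.* ε ^ℚ C ℚ.* ι (n ^ k) ℚ.≤ ι (copies F G)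
  prove ε 0<ε ε<1 n G far = begin
    c ℚ.* ε ^ℚ C ℚ.* ι (n ^ k)
      ≤⟨ *-monoˡ (c ℚ.* ε ^ℚ C) (0≤* (ℚP.<⇒≤ 0<c) (0≤^ C 0≤ε)) (ℕ→ℚ-mono (poly E n G 2≤E far-ℕ)) ⟩
    c ℚ.* ε ^ℚ C ℚ.* ι (q * E ^ C * copies F G)
      ≡⟨ cong (c ℚ.* ε ^ℚ C ℚ.*_) (trans (ℕ→ℚ-* (q * E ^ C) (copies F G)) (cong (ℚ._* ι (copies F G))
           (trans (ℕ→ℚ-* q (E ^ C)) (cong (ι q ℚ.*_) (ℕ→ℚ-^ E C))))) ⟩
    c ℚ.* ε ^ℚ C ℚ.* (ι q ℚ.* ι E ^ℚ C ℚ.* ι (copies F G))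
      ≡⟨ trans (solve 5 (λ c x q y t → (c :* x) :* (q :* y :* t) := c :* (q :* (x :* y)) :* t) refl c (ε ^ℚ C) (ι q) (ι E ^ℚ C) (ι (copies F G)))
           (cong (λ u → c ℚ.* (ι q ℚ.* u) ℚ.* ι (copies F G)) (≡-sym (^-distrib ε (ι E) C))) ⟩
    c ℚ.* (ι q ℚ.* (ε ℚ.* ι E) ^ℚ C) ℚ.* ι (copies F G)
      ≤⟨ *-monoʳ (ι (copies F G)) (0≤ι (copies F G)) (*-monoˡ c (ℚP.<⇒≤ 0<c) (*-monoˡ (ι q) (0≤ι q)
           (^-mono C (0≤* 0≤ε (0≤ι E)) εE≤2))) ⟩
    c ℚ.* (ι q ℚ.* ι 2 ^ℚ C) ℚ.* ι (copies F G)
      ≡⟨ cong (λ u → c ℚ.* u ℚ.* ι (copies F G)) (≡-sym (trans (ℕ→ℚ-* q (2 ^ C)) (cong (ι q ℚ.*_) (ℕ→ℚ-^ 2 C)))) ⟩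
    c ℚ.* ι w ℚ.* ι (copies F G)
      ≤⟨ *-monoʳ (ι (copies F G)) (0≤ι (copies F G)) (*-monoˡ c (ℚP.<⇒≤ 0<c) (ℕ→ℚ-mono (n≤1+n w))) ⟩
    c ℚ.* ι (suc w) ℚ.* ι (copies F G)
      ≡⟨ trans (cong (ℚ._* ι (copies F G)) (proj₂ (proj₂ (reciprocal w)))) (ℚP.*-identityˡ (ι (copies F G))) ⟩
    ι (copies F G) ∎
    where
    0≤ε : 0ℚ ℚ.≤ ε
    0≤ε = ℚP.<⇒≤ 0<ε
    a b : ℕ
    a = proj₁ (fraction ε 0<ε)
    b = proj₁ (proj₂ (fraction ε 0<ε))
    εb : ε ℚ.* ι (suc b) ≡ ι (suc a)
    εb = proj₂ (proj₂ (fraction ε 0<ε))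
    -- ε = (a + 1) / (b + 1) and E = ⌊1 / ε⌋ + 1
    E : ℕ
    E = suc (suc b / suc a)
    a≤b : suc a ≤ suc b
    a≤b = ℕ→ℚ-cancel (begin
      ι (suc a)         ≡⟨ ≡-sym εb ⟩
      ε ℚ.* ι (suc b)   ≤⟨ *-monoʳ (ι (suc b)) (0≤ι (suc b)) (ℚP.<⇒≤ ε<1) ⟩
      1ℚ ℚ.* ι (suc b)  ≡⟨ ℚP.*-identityˡ (ι (suc b)) ⟩
      ι (suc b)         ∎)
    2≤E : 2 ≤ E
    2≤E = s≤s (m≥n⇒m/n>0 a≤b)
    εEb : ε ℚ.* ι E ℚ.* ι (suc b) ≡ ι (E * suc a)
    εEb = trans (solve 3 (λ x y z → (x :* y) :* z := y :* (x :* z)) refl ε (ι E) (ι (suc b)))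
      (trans (cong (ι E ℚ.*_) εb) (≡-sym (ℕ→ℚ-* E (suc a))))
    lower : suc b ≤ E * suc a
    lower = ≤-trans (≤-reflexive (m≡m%n+[m/n]*n (suc b) (suc a)))
      (+-monoˡ-≤ (suc b / suc a * suc a) (<⇒≤ (m%n<n (suc b) (suc a))))
    upper : E * suc a ≤ 2 * suc b
    upper = ≤-trans (+-mono-≤ a≤b (m/n*n≤m (suc b) (suc a))) (≤-reflexive (cong (suc b +_) (≡-sym (+-identityʳ (suc b)))))
    1≤εE : 1ℚ ℚ.≤ ε ℚ.* ι E
    1≤εE = *-cancelʳ (ι (suc b)) (ℕ→ℚ-pos b) (begin
      1ℚ ℚ.* ι (suc b)           ≡⟨ ℚP.*-identityˡ (ι (suc b)) ⟩
      ι (suc b)                  ≤⟨ ℕ→ℚ-mono lower ⟩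
      ι (E * suc a)              ≡⟨ ≡-sym εEb ⟩
      ε ℚ.* ι E ℚ.* ι (suc b)    ∎)
    εE≤2 : ε ℚ.* ι E ℚ.≤ ι 2
    εE≤2 = *-cancelʳ (ι (suc b)) (ℕ→ℚ-pos b) (begin
      ε ℚ.* ι E ℚ.* ι (suc b)    ≡⟨ εEb ⟩
      ι (E * suc a)              ≤⟨ ℕ→ℚ-mono upper ⟩
      ι (2 * suc b)              ≡⟨ ℕ→ℚ-* 2 (suc b) ⟩
      ι 2 ℚ.* ι (suc b)          ∎)
    far-ℕ : ∀ H → InducedFree F H → n * n ≤ E * dist G H
    far-ℕ H free = ℕ→ℚ-cancel (begin
      ι (n * n)                      ≡⟨ ≡-sym (ℚP.*-identityˡ (ι (n * n))) ⟩
      1ℚ ℚ.* ι (n * n)               ≤⟨ *-monoʳ (ι (n * n)) (0≤ι (n * n)) 1≤εE ⟩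
      ε ℚ.* ι E ℚ.* ι (n * n)        ≡⟨ solve 3 (λ x y z → (x :* y) :* z := y :* (x :* z)) refl ε (ι E) (ι (n * n)) ⟩
      ι E ℚ.* (ε ℚ.* ι (n * n))      ≤⟨ *-monoˡ (ι E) (0≤ι E) (far H free) ⟩
      ι E ℚ.* ι (dist G H)           ≡⟨ ≡-sym (ℕ→ℚ-* E (dist G H)) ⟩
      ι (E * dist G H)               ∎)

theorem1p1 : ∀ {k : ℕ} (F : OGraph k) → 2 ≤ k →
    PolyRemoval F ⇔ (k ≡ 2 ⊎ InDFamily F)
theorem1p1 F 2≤k = mk⇔
  (λ poly → poly⇒small-or-D-family F 2≤k (poly⇒polyℕ {F = F} poly))
  (λ family → polyℕ⇒poly {F = F} (small-or-D-family⇒poly F family))
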